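{- There exists a polynomial-time algorithm which, given cographs $G$ and $H$, computes $\alpha(G\times H)$.
   Context: A cograph is a graph with no induced path on four vertices. For graphs $G$ and $H$, the categorical (tensor) product $G \times H$ has vertex set $V(G)\times V(H)$, and $(g_1,h_1)$ is adjacent to $(g_2,h_2)$ iff $\{g_1,g_2\}\in E(G)$ and $\{h_1,h_2\}\in E(H)$. $\alpha(\cdot)$ is the independence number. -}

module Defs where

open import Data.Nat using (ℕ; zero; suc; _+_; _*_; _^_; _≤_)
open import Data.Bool using (Bool; true; false; _∧_)
open import Data.Fin using (Fin; zero; suc; remQuot)
open import Data.Fin.Subset using (Subset; _∈_; ∣_∣)
open import Data.List using (List; []; _∷_; _++_; map; concatMap; allFin; length)
open import Data.Maybe using (Maybe; just; nothing)
open import Data.Product using (_×_; _,_; Σ)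
open import Data.Empty using (⊥)
open import Relation.Binary.PropositionalEquality using (_≡_)

record Graph (n : ℕ) : Set where
  field adj : Fin n → Fin n → Bool
open Graph public

record SimpleGraph {n : ℕ} (G : Graph n) : Set where
  field
    symmetric   : ∀ i j → adj G i j ≡ adj G j i
    irreflexive : ∀ i → adj G i i ≡ false

-- cograph: no induced path a - b - c - d on four vertices
-- (for simple graphs, the four vertices are automatically distinct)
Cograph : {n : ℕ} → Graph n → Set
Cograph {n} G = (a b c d : Fin n) →
  adj G a b ≡ true → adj G b c ≡ true → adj G c d ≡ true →
  adj G a c ≡ false → adj G b d ≡ false → adj G a d ≡ false → ⊥

_⊗_ : {n m : ℕ} → Graph n → Graph m → Graph (n * m)
adj (_⊗_ {n} {m} G H) x y with remQuot {n} m x | remQuot {n} m y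
... | g₁ , h₁ | g₂ , h₂ = adj G g₁ g₂ ∧ adj H h₁ h₂

Independent : {n : ℕ} → Graph n → Subset n → Set
Independent G S = ∀ i j → i ∈ S → j ∈ S → adj G i j ≡ false

IsIndependenceNumber : {n : ℕ} → Graph n → ℕ → Set
IsIndependenceNumber {n} G k =
  Σ (Subset n) (λ S → Independent G S × ∣ S ∣ ≡ k) ×
  (∀ (S : Subset n) → Independent G S → ∣ S ∣ ≤ k)

-- Deterministic single-tape Turing machines.
-- Tape alphabet Fin (4 + extra):
--   0 = blank, 1 = bit 0, 2 = bit 1, 3 = separator '#', others = work symbols.

data Move : Set where
  L R S : Move

record TM : Set where
  field
    extra  : ℕ
    states : ℕ           -- states are Fin (suc states); start state is zero
    δ : Fin (suc states) → Fin (4 + extra) →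
        Maybe (Fin (suc states) × Fin (4 + extra) × Move)
        -- nothing = halt

module _ (M : TM) where
  open TM M

  Sym : Set
  Sym = Fin (4 + extra)

  blank : Sym
  blank = zero

  -- configuration: state, left part of tape (reversed), scanned symbol, right part
  record Config : Set where
    constructor cfg
    field
      state : Fin (suc states)
      left  : List Sym
      here  : Sym
      right : List Sym

  step : Config → Maybe Config
  step (cfg q l a r) with δ q a
  ... | nothing = nothing
  ... | just (q' , b , S) = just (cfg q' l b r)
  ... | just (q' , b , R) with r
  ...   | []     = just (cfg q' (b ∷ l) blank [])
  ...   | x ∷ r' = just (cfg q' (b ∷ l) x r')
  step (cfg q l a r) | just (q' , b , L) with l
  ...   | []     = just (cfg q' [] b r)          -- left end of tape: stay
  ...   | x ∷ l' = just (cfg q' l' x (b ∷ r))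

  run : ℕ → Config → Maybe Config
  run t c with step c
  ... | nothing = just c
  run zero    c | just _  = nothing
  run (suc t) c | just c' = run t c'

  initial : List Sym → Config
  initial []       = cfg zero [] blank []
  initial (x ∷ xs) = cfg zero [] x xs

  -- output: maximal block of bit symbols starting at the head,
  -- read as a binary number, most significant bit first
  readBits : List Sym → ℕ → ℕ
  readBits []                     acc = acc
  readBits (suc zero ∷ xs)        acc = readBits xs (2 * acc)
  readBits (suc (suc zero) ∷ xs)  acc = readBits xs (2 * acc + 1)
  readBits (_ ∷ xs)               acc = acc

  output : Config → ℕ
  output (cfg _ _ a r) = readBits (a ∷ r) 0

  -- input encoding of a pair of graphs: adjacency matrix of G (row-major,
  -- n² bits), separator, adjacency matrix of H (m² bits)
  bit : Bool → Sym
  bit false = suc zero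
  bit true  = suc (suc zero)

  encodeGraph : {n : ℕ} → Graph n → List Sym
  encodeGraph {n} G = concatMap (λ i → map (λ j → bit (adj G i j)) (allFin n)) (allFin n)

  encodePair : {n m : ℕ} → Graph n → Graph m → List Sym
  encodePair G H = encodeGraph G ++ (suc (suc (suc zero)) ∷ encodeGraph H)

{-# OPTIONS --safe #-}
-- If G is a disjoint union or H is a single vertex, then α(G × H) is the sum of α(Gᵢ × H) over the
-- two parts Gᵢ of G (and symmetrically); if G and H are both joins, an independent set of G × H lies
-- in Gᵢ × H or G × Hⱼ for one of the parts, so α(G × H) is a maximum of four values. By Seinsche's
-- theorem a cograph with at least two vertices is a disjoint union or a join. Splitting off the
-- component (or co-component) of the least vertex of each class yields a sequence of partitions of
-- each vertex set; since components of P₄-free graphs have diameter at most two, each partition is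
-- first-order definable from the previous one, and the table of the numbers α of pairs of classes,
-- written in unary, is obtained by iterating a first-order definable operator.
--
-- First-order definitions and bounded iteration are executable in polynomial time: a relation on
-- [0, N) is stored as one bit in each of N⁵ tape cells, a variable is a mask on the cells whose
-- coordinate equals its value, and atomic steps are finite-state passes over the tape. Loops run
-- exactly N times, N being the input length, so every program halts in polynomial time.
module Submission where

open import Defs hiding (L; R; S)
open import Data.Bool using (Bool; true; false; _∧_; _∨_; not; if_then_else_; T; _xor_)
open import Data.Bool.ListAction using (any)
open import Data.Bool.Properties using (∧-zeroʳ; ∧-identityʳ; T-≡; ∨-assoc; ∨-identityʳ; T-∧; not-injective) renaming (_≟_ to _≟ᵇ_)
open import Data.Empty using (⊥-elim; ⊥)
open import Data.Fin using (Fin; zero; suc; join; splitAt; combine; remQuot; toℕ; _↑ˡ_; fromℕ<; #_)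
open import Data.Fin.Properties using (splitAt-join; remQuot-combine; toℕ<n; toℕ-injective; toℕ-↑ˡ; toℕ-fromℕ<; ↑ˡ-injective; fromℕ<-toℕ; toℕ-combine)
open import Data.Fin.Subset using (Subset; ∣_∣) renaming (_∈_ to _∈ˢ_)
open import Data.Fin.Subset.Properties using (∣p∣≤n)
open import Data.List using (List; []; _∷_; _++_; map; length; replicate; _ʳ++_; reverse; allFin; concatMap) renaming (tabulate to tabulateᴸ)
open import Data.List.Membership.Propositional using (_∈_)
open import Data.List.Membership.Propositional.Properties using (∈-map⁺; ∈-++⁺ˡ; ∈-++⁺ʳ)
open import Data.List.Properties using (ʳ++-defn; reverse-map; reverse-involutive; length-reverse; length-map; map-++; ++-assoc; ++-identityʳ; length-++; map-∘; map-cong; map-cong-local; length-tabulate; map-concatMap; concatMap-cong)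
open import Data.List.Relation.Unary.All as All using (All; []; _∷_)
open import Data.List.Relation.Unary.All.Properties as AllP using ()
open import Data.List.Relation.Unary.Any using (here; there)
open import Data.Maybe as Maybe using (Maybe; just; nothing)
open import Data.Nat using (ℕ; zero; suc; _+_; _*_; _^_; _∸_; pred; _≤_; _<_; z≤n; s≤s; _⊔_; _≡ᵇ_; _<ᵇ_; _≤ᵇ_; _≟_; _<?_)
open import Data.Nat.Properties
open import Data.Product using (Σ; _×_; _,_; proj₁; proj₂; ∃)
open import Data.Sum using (_⊎_; inj₁; inj₂; [_,_])
open import Data.Unit using (⊤; tt)
open import Data.Vec as Vec using (Vec; []; _∷_; lookup; tabulate)
open import Data.Vec.Properties using (lookup∘tabulate; tabulate-cong; lookup-map; []=⇒lookup; lookup⇒[]=) renaming (map-cong to Vec-map-cong)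
open import Function.Bundles using (Equivalence)
open import Relation.Binary.Definitions using (tri<; tri≈; tri>)
open import Relation.Binary.PropositionalEquality using (_≡_; _≢_; refl; sym; trans; cong; cong₂; subst; subst₂; module ≡-Reasoning)
open import Relation.Nullary using (¬_; Dec; yes; no; ¬?; _×-dec_; _⊎-dec_)
open import Relation.Nullary.Decidable using (map′)
open import Algebra.Properties.CommutativeSemigroup +-commutativeSemigroup using () renaming (interchange to +-interchange)

-- A single-tape machine has no pointers, so the cotree is never stored as a tree: a node is named
-- by a level and any vertex of its class. A pair of nodes and a unary index make five coordinates,
-- hence the exponent in N⁵. The least vertex is a canonical pivot: all members of a class agree on
-- it, so the next partition is definable without arbitrary choices. A repeated assignment
-- recomputes its whole relation in every round and its starting content is arbitrary; correct
-- entries spread round by round, level k of a partition being settled after k + 1 rounds and an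
-- entry of the table after as many rounds as its two classes have vertices together. N rounds
-- suffice, and all numbers fit below N = n² + 1 + m², because this exceeds n + m as well as nm,
-- hence α. The recursion for α enters as a set of rules rather than as a function: several rules
-- and several choices of representatives may apply to one pair of classes, and they agree because
-- each derives an independence number, which is unique.

-- Finite types, Turing machines and single passes over the tape

record Finite (A : Set) : Set where
  field
    size    : ℕ
    enc     : A → Fin size
    dec     : Fin size → A
    dec-enc : ∀ a → dec (enc a) ≡ a
open Finite

finite-⊤ : Finite ⊤
finite-⊤ = record { size = 1 ; enc = λ _ → zero ; dec = λ _ → tt ; dec-enc = λ _ → refl }

finite-Fin : ∀ n → Finite (Fin n)
finite-Fin n = record { size = n ; enc = λ i → i ; dec = λ i → i ; dec-enc = λ _ → refl }

finite-⊎ : ∀ {A B} → Finite A → Finite B → Finite (A ⊎ B)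
finite-⊎ {A} {B} a b = record
  { size = size a + size b ; enc = e ; dec = λ i → d (splitAt (size a) i) ; dec-enc = de }
  where
  e : A ⊎ B → Fin (size a + size b)
  e (inj₁ x) = join (size a) (size b) (inj₁ (enc a x))
  e (inj₂ y) = join (size a) (size b) (inj₂ (enc b y))
  d : Fin (size a) ⊎ Fin (size b) → A ⊎ B
  d (inj₁ i) = inj₁ (dec a i)
  d (inj₂ j) = inj₂ (dec b j)
  de : ∀ x → d (splitAt (size a) (e x)) ≡ x
  de (inj₁ x) = trans (cong d (splitAt-join (size a) (size b) (inj₁ (enc a x)))) (cong inj₁ (dec-enc a x))
  de (inj₂ y) = trans (cong d (splitAt-join (size a) (size b) (inj₂ (enc b y)))) (cong inj₂ (dec-enc b y))

finite-× : ∀ {A B} → Finite A → Finite B → Finite (A × B)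
finite-× {A} {B} a b = record
  { size = size a * size b
  ; enc = λ { (x , y) → combine (enc a x) (enc b y) }
  ; dec = λ i → d (remQuot {size a} (size b) i)
  ; dec-enc = λ { (x , y) → trans (cong d (remQuot-combine (enc a x) (enc b y)))
                                  (cong₂ _,_ (dec-enc a x) (dec-enc b y)) } }
  where
  d : Fin (size a) × Fin (size b) → A × B
  d (i , j) = dec a i , dec b j

finite-retract : ∀ {A B} → Finite A → (f : A → B) (g : B → A) → (∀ b → f (g b) ≡ b) → Finite B
finite-retract a f g fg = record
  { size = size a ; enc = λ b → enc a (g b) ; dec = λ i → f (dec a i)
  ; dec-enc = λ b → trans (cong f (dec-enc a (g b))) (fg b) }

finite-Bool : Finite Bool
finite-Bool = finite-retract (finite-⊎ finite-⊤ finite-⊤)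
  (λ { (inj₁ _) → false ; (inj₂ _) → true }) (λ { false → inj₁ tt ; true → inj₂ tt })
  (λ { false → refl ; true → refl })

finite-Vec : ∀ {A} → Finite A → ∀ n → Finite (Vec A n)
finite-Vec a zero    = finite-retract finite-⊤ (λ _ → []) (λ _ → tt) (λ { [] → refl })
finite-Vec a (suc n) = finite-retract (finite-× a (finite-Vec a n))
  (λ { (x , xs) → x ∷ xs }) (λ { (x ∷ xs) → x , xs }) (λ { (x ∷ xs) → refl })

mealy : {A X Y : Set} → (A → X → A × Y) → A → List X → A × List Y
mealy g a []       = a , []
mealy g a (x ∷ xs) =
  proj₁ (mealy g (proj₁ (g a x)) xs) , proj₂ (g a x) ∷ proj₂ (mealy g (proj₁ (g a x)) xs)

length-mealy : ∀ {A X Y} (g : A → X → A × Y) a xs → length (proj₂ (mealy g a xs)) ≡ length xs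
length-mealy g a []       = refl
length-mealy g a (x ∷ xs) = cong suc (length-mealy g (proj₁ (g a x)) xs)

module Machine {Q C : Set} (finQ : Finite Q) (finC : Finite C)
  (δ′ : ⊤ ⊎ Q → Fin 4 ⊎ C → Maybe ((⊤ ⊎ Q) × (Fin 4 ⊎ C) × Move)) where

  -- The summand `⊤` stands first so that its element is encoded as `zero`, the start state. For the
  -- same reason `Fin 4` stands first in `Γ`: the blank, the two bits and the separator keep their
  -- codes.
  State : Set
  State = ⊤ ⊎ Q

  Γ : Set
  Γ = Fin 4 ⊎ C

  finState : Finite State
  finState = finite-⊎ finite-⊤ finQ

  finΓ : Finite Γ
  finΓ = finite-⊎ (finite-Fin 4) finC

  encodeAction : State × Γ × Move → Fin (suc (size finQ)) × Fin (4 + size finC) × Move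
  encodeAction (q , a , m) = enc finState q , enc finΓ a , m

  machine : TM
  machine = record
    { extra  = size finC
    ; states = size finQ
    ; δ      = λ q a → Maybe.map encodeAction (δ′ (dec finState q) (dec finΓ a)) }

  record Conf : Set where
    constructor conf
    field
      state : State
      left  : List Γ
      scanned : Γ
      right : List Γ

  toConfig : Conf → Config machine
  toConfig (conf q l a r) = cfg (enc finState q) (map (enc finΓ) l) (enc finΓ a) (map (enc finΓ) r)

  □ : Γ
  □ = inj₁ zero

  □s : ℕ → List Γ
  □s k = replicate k □

  advance : State → List Γ → List Γ → Conf
  advance q l []      = conf q l □ []
  advance q l (x ∷ r) = conf q l x r

  -- A move to the left is provided only for a nonempty left part: the first cell is recognised by
  -- its mark, so the head never runs against the end of the tape.
  data _↦_ : Conf → Conf → Set where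
    stay  : ∀ {q a q' b l r} → δ′ q a ≡ just (q' , b , Move.S) → conf q l a r ↦ conf q' l b r
    goR   : ∀ {q a q' b l r} → δ′ q a ≡ just (q' , b , Move.R) → conf q l a r ↦ advance q' (b ∷ l) r
    goL   : ∀ {q a q' b x l r} → δ′ q a ≡ just (q' , b , Move.L) → conf q (x ∷ l) a r ↦ conf q' l x (b ∷ r)

  step-↦ : ∀ {c c'} → c ↦ c' → step machine (toConfig c) ≡ just (toConfig c')
  step-↦ (stay {q} {a} e) rewrite dec-enc finState q | dec-enc finΓ a | e = refl
  step-↦ (goR {q} {a} {r = []} e) rewrite dec-enc finState q | dec-enc finΓ a | e = refl
  step-↦ (goR {q} {a} {r = x ∷ r} e) rewrite dec-enc finState q | dec-enc finΓ a | e = refl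
  step-↦ (goL {q} {a} e) rewrite dec-enc finState q | dec-enc finΓ a | e = refl

  step-halt : ∀ {q a l r} → δ′ q a ≡ nothing → step machine (toConfig (conf q l a r)) ≡ nothing
  step-halt {q} {a} e rewrite dec-enc finState q | dec-enc finΓ a | e = refl

  -- The number is an upper bound on the number of steps.
  data Reach : ℕ → Conf → Conf → Set where
    done : ∀ {n c} → Reach n c c
    _◅_  : ∀ {n c d e} → c ↦ d → Reach n d e → Reach (suc n) c e

  infixr 5 _◅_ _◅◅_

  weaken : ∀ {m n c d} → m ≤ n → Reach m c d → Reach n c d
  weaken _       done     = done
  weaken (s≤s p) (s ◅ ss) = s ◅ weaken p ss

  _◅◅_ : ∀ {m n c d e} → Reach m c d → Reach n d e → Reach (m + n) c e
  _◅◅_ {m} {n} done ss = weaken (m≤n+m n m) ss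
  (s ◅ rs) ◅◅ ss       = s ◅ (rs ◅◅ ss)

  run-halted : ∀ T c → step machine c ≡ nothing → run machine T c ≡ just c
  run-halted zero    c e rewrite e = refl
  run-halted (suc T) c e rewrite e = refl

  run-Reach : ∀ {T c d} → Reach T c d → step machine (toConfig d) ≡ nothing →
              run machine T (toConfig c) ≡ just (toConfig d)
  run-Reach {T} {c} done e = run-halted T (toConfig c) e
  run-Reach (s ◅ ss) e rewrite step-↦ s = run-Reach ss e

  -- The state of the transducer is carried inside the control state `q a`. The output piles up on
  -- the left part, whence the reversal.
  scanR : {A X Y : Set} (q : A → State) (g : A → X → A × Y) (σ : X → Γ) (τ : Y → Γ) →
    (∀ a x → δ′ (q a) (σ x) ≡ just (q (proj₁ (g a x)) , τ (proj₂ (g a x)) , Move.R)) →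
    ∀ a l xs r → Reach (length xs) (advance (q a) l (map σ xs ++ r))
                       (advance (q (proj₁ (mealy g a xs))) (map τ (proj₂ (mealy g a xs)) ʳ++ l) r)
  scanR q g σ τ h a l []       r = done
  scanR q g σ τ h a l (x ∷ xs) r =
    goR (h a x) ◅ scanR q g σ τ h (proj₁ (g a x)) (τ (proj₂ (g a x)) ∷ l) xs r

  scanL : {X : Set} (q : State) (σ τ : X → Γ) →
    (∀ x → δ′ q (σ x) ≡ just (q , τ x , Move.L)) →
    ∀ zs z y r → Reach (suc (length zs)) (conf q (map σ zs ++ y ∷ []) (σ z) r)
                       (conf q [] y (map τ zs ʳ++ τ z ∷ r))
  scanL q σ τ h []        z y r = goL (h z) ◅ done
  scanL q σ τ h (z' ∷ zs) z y r = goL (h z) ◅ scanL q σ τ h zs z' y (τ z ∷ r)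

  -- The pass to the right ends on the first blank. If `k` is zero the tape is extended by this
  -- blank, otherwise one of the `k` blanks already visited is used up; both cases leave `pred k`.
  turn : {X : Set} (q q' : State) (β : Γ) (σ τ : X → Γ) →
    δ′ q □ ≡ just (q' , β , Move.L) → (∀ x → δ′ q' (σ x) ≡ just (q' , τ x , Move.L)) →
    ∀ zs y k → Reach (suc (length zs)) (advance q (map σ zs ++ y ∷ []) (□s k))
                     (conf q' [] y (map τ zs ʳ++ β ∷ □s (pred k)))
  turn q q' β σ τ hb h [] y zero          = goL hb ◅ done
  turn q q' β σ τ hb h [] y (suc k)       = goL hb ◅ done
  turn q q' β σ τ hb h (z ∷ zs) y zero    = goL hb ◅ scanL q' σ τ h zs z y (β ∷ [])
  turn q q' β σ τ hb h (z ∷ zs) y (suc k) = goL hb ◅ scanL q' σ τ h zs z y (β ∷ □s k)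

  -- A pass to the first blank and back to the leftmost cell, whose symbol carries its own marker.
  roundTrip : {A X Y : Set} (q : A → State) (q' : A → State) (β : A → Γ)
    (g : A → X → A × Y) (σ : X → Γ) (τ υ : Y → Γ) →
    (∀ a x → δ′ (q a) (σ x) ≡ just (q (proj₁ (g a x)) , τ (proj₂ (g a x)) , Move.R)) →
    (∀ a → δ′ (q a) □ ≡ just (q' a , β a , Move.L)) →
    (∀ a y → δ′ (q' a) (τ y) ≡ just (q' a , υ y , Move.L)) →
    ∀ {p a x₀ y₀} → δ′ p x₀ ≡ just (q a , y₀ , Move.R) → ∀ xs k →
    let a' = proj₁ (mealy g a xs) ; ys = proj₂ (mealy g a xs) in
    Reach (2 + (length xs + length xs)) (conf p [] x₀ (map σ xs ++ □s k))
          (conf (q' a') [] y₀ (map υ ys ++ β a' ∷ □s (pred k)))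
  roundTrip q q' β g σ τ υ hR h□ hL {p} {a} {x₀} {y₀} h₀ xs k =
    goR h₀ ◅ subst (λ n → Reach n (advance (q a) (y₀ ∷ []) (map σ xs ++ □s k)) end)
                   (+-suc (length xs) (length xs))
                   (scanR q g σ τ hR a (y₀ ∷ []) xs (□s k) ◅◅ back)
    where
    a' = proj₁ (mealy g a xs)
    ys = proj₂ (mealy g a xs)
    end = conf (q' a') [] y₀ (map υ ys ++ β a' ∷ □s (pred k))
    -- The left part lists the output from right to left, so the pass back consumes the reversed
    -- list, and its own reversal restores the order.
    left≡ : map τ (reverse ys) ++ y₀ ∷ [] ≡ map τ ys ʳ++ y₀ ∷ []
    left≡ = trans (cong (_++ y₀ ∷ []) (reverse-map τ ys)) (sym (ʳ++-defn (map τ ys)))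
    right≡ : ∀ {zs} → map υ (reverse ys) ʳ++ zs ≡ map υ ys ++ zs
    right≡ {zs} = trans (ʳ++-defn (map υ (reverse ys))) (cong (_++ zs)
      (trans (cong reverse (reverse-map υ ys)) (reverse-involutive (map υ ys))))
    len≡ : length (reverse ys) ≡ length xs
    len≡ = trans (length-reverse ys) (length-mealy g a xs)
    back : Reach (suc (length xs)) (advance (q a') (map τ ys ʳ++ y₀ ∷ []) (□s k)) end
    back = subst₂ (λ l r → Reach (suc (length xs)) (advance (q a') l (□s k)) (conf (q' a') [] y₀ r))
             left≡ right≡
             (subst (λ n → Reach (suc n) (advance (q a') (map τ (reverse ys) ++ y₀ ∷ []) (□s k))
                                  (conf (q' a') [] y₀ (map υ (reverse ys) ʳ++ β a' ∷ □s (pred k))))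
                    len≡ (turn (q a') (q' a') (β a') τ υ (h□ a') (hL a') (reverse ys) y₀ k))

-- An imperative language of sweeps and its simulation by machines

data While (F C : Set) : Set where
  upd : (F → F) → While F C
  swp : (F → C → F × C) → While F C
  app : (F → C) → While F C
  _⨾_ : While F C → While F C → While F C
  ite : (F → Bool) → While F C → While F C → While F C
  whl : (F → Bool) → While F C → While F C

infixr 4 _⨾_

-- `M` bounds the length of the tape throughout the run and the last index counts basic operations;
-- together they bound the running time. Sweeping and appending ask for a first cell, because its
-- mark is where the pass back stops.
data _⊢_∶_⇓_#_ {F C : Set} (M : ℕ) : While F C → F × List C → F × List C → ℕ → Set where
  ⇓upd : ∀ {h f xs} → M ⊢ upd h ∶ (f , xs) ⇓ (h f , xs) # 1
  ⇓swp : ∀ {g f x xs} → suc (length xs) ≤ M → M ⊢ swp g ∶ (f , x ∷ xs) ⇓ mealy g f (x ∷ xs) # 1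
  ⇓app : ∀ {a f x xs} → suc (length xs) ≤ M → M ⊢ app a ∶ (f , x ∷ xs) ⇓ (f , x ∷ xs ++ a f ∷ []) # 1
  ⇓⨾   : ∀ {p q s s' s'' u v} → M ⊢ p ∶ s ⇓ s' # u → M ⊢ q ∶ s' ⇓ s'' # v → M ⊢ p ⨾ q ∶ s ⇓ s'' # (u + v)
  ⇓iteT : ∀ {b p q f xs s' u} → b f ≡ true → M ⊢ p ∶ (f , xs) ⇓ s' # u → M ⊢ ite b p q ∶ (f , xs) ⇓ s' # suc u
  ⇓iteF : ∀ {b p q f xs s' u} → b f ≡ false → M ⊢ q ∶ (f , xs) ⇓ s' # u → M ⊢ ite b p q ∶ (f , xs) ⇓ s' # suc u
  ⇓whlF : ∀ {b p f xs} → b f ≡ false → M ⊢ whl b p ∶ (f , xs) ⇓ (f , xs) # 1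
  ⇓whlT : ∀ {b p f xs s' s'' u v} → b f ≡ true → M ⊢ p ∶ (f , xs) ⇓ s' # u → M ⊢ whl b p ∶ s' ⇓ s'' # v →
          M ⊢ whl b p ∶ (f , xs) ⇓ s'' # suc (u + v)

-- Renames the control states of a subprogram into those of the surrounding program, where an exit
-- becomes the entry of whatever comes next.
retarget : {A B Y : Set} → (A → B) → Maybe (A × Y) → Maybe (B × Y)
retarget f nothing        = nothing
retarget f (just (a , y)) = just (f a , y)

retarget-∘ : ∀ {A B C Y : Set} {f : B → C} {g : A → B} {h : A → C} → (∀ x → f (g x) ≡ h x) →
             (m : Maybe (A × Y)) → retarget f (retarget g m) ≡ retarget h m
retarget-∘ e nothing        = refl
retarget-∘ e (just (a , y)) = cong (λ z → just (z , y)) (e a)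

module Control {F C : Set} where

  Symbol : Set
  Symbol = Fin 4 ⊎ (Bool × C)

  -- For a sweep or an append, `inj₁` is the pass to the right and `inj₂` the return to the marked
  -- cell. For branches and loops, `inj₁` is the moment of the test.
  Ctl : While F C → Set
  Ctl (upd h)     = F
  Ctl (swp g)     = F ⊎ F
  Ctl (app a)     = F ⊎ F
  Ctl (p ⨾ q)     = Ctl p ⊎ Ctl q
  Ctl (ite b p q) = F ⊎ (Ctl p ⊎ Ctl q)
  Ctl (whl b p)   = F ⊎ Ctl p

  finite-Ctl : Finite F → ∀ p → Finite (Ctl p)
  finite-Ctl φ (upd h)     = φ
  finite-Ctl φ (swp g)     = finite-⊎ φ φ
  finite-Ctl φ (app a)     = finite-⊎ φ φ
  finite-Ctl φ (p ⨾ q)     = finite-⊎ (finite-Ctl φ p) (finite-Ctl φ q)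
  finite-Ctl φ (ite b p q) = finite-⊎ φ (finite-⊎ (finite-Ctl φ p) (finite-Ctl φ q))
  finite-Ctl φ (whl b p)   = finite-⊎ φ (finite-Ctl φ p)

  entry : ∀ p → F → Ctl p
  entry (upd h)     f = f
  entry (swp g)     f = inj₁ f
  entry (app a)     f = inj₁ f
  entry (p ⨾ q)     f = inj₁ (entry p f)
  entry (ite b p q) f = inj₁ f
  entry (whl b p)   f = inj₁ f

  δW : ∀ p → Ctl p → Symbol → Maybe ((Ctl p ⊎ F) × Symbol × Move)
  δW (upd h) f a = just (inj₂ (h f) , a , Move.S)
  δW (swp g) (inj₁ f) (inj₂ (b , c))     = just (inj₁ (inj₁ (proj₁ (g f c))) , inj₂ (b , proj₂ (g f c)) , Move.R)
  δW (swp g) (inj₁ f) (inj₁ _)           = just (inj₁ (inj₂ f) , inj₁ zero , Move.L)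
  δW (swp g) (inj₂ f) (inj₂ (true , c))  = just (inj₂ f , inj₂ (true , c) , Move.S)
  δW (swp g) (inj₂ f) (inj₂ (false , c)) = just (inj₁ (inj₂ f) , inj₂ (false , c) , Move.L)
  δW (swp g) (inj₂ f) (inj₁ _)           = nothing
  δW (app a) (inj₁ f) (inj₂ c)           = just (inj₁ (inj₁ f) , inj₂ c , Move.R)
  δW (app a) (inj₁ f) (inj₁ _)           = just (inj₁ (inj₂ f) , inj₂ (false , a f) , Move.L)
  δW (app a) (inj₂ f) (inj₂ (true , c))  = just (inj₂ f , inj₂ (true , c) , Move.S)
  δW (app a) (inj₂ f) (inj₂ (false , c)) = just (inj₁ (inj₂ f) , inj₂ (false , c) , Move.L)
  δW (app a) (inj₂ f) (inj₁ _)           = nothing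
  δW (p ⨾ q) (inj₁ s) a = retarget [ (λ s' → inj₁ (inj₁ s')) , (λ f → inj₁ (inj₂ (entry q f))) ] (δW p s a)
  δW (p ⨾ q) (inj₂ s) a = retarget [ (λ s' → inj₁ (inj₂ s')) , inj₂ ] (δW q s a)
  δW (ite b p q) (inj₁ f) a =
    just (inj₁ (inj₂ (if b f then inj₁ (entry p f) else inj₂ (entry q f))) , a , Move.S)
  δW (ite b p q) (inj₂ (inj₁ s)) a = retarget [ (λ s' → inj₁ (inj₂ (inj₁ s'))) , inj₂ ] (δW p s a)
  δW (ite b p q) (inj₂ (inj₂ s)) a = retarget [ (λ s' → inj₁ (inj₂ (inj₂ s'))) , inj₂ ] (δW q s a)
  δW (whl b p) (inj₁ f) a = just ((if b f then inj₁ (inj₂ (entry p f)) else inj₂ f) , a , Move.S)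
  δW (whl b p) (inj₂ s) a = retarget [ (λ s' → inj₁ (inj₂ s')) , (λ f → inj₁ (inj₁ f)) ] (δW p s a)

mealy-id : ∀ {A X : Set} (a : A) (xs : List X) → mealy (λ a x → a , x) a xs ≡ (a , xs)
mealy-id a []       = refl
mealy-id a (x ∷ xs) = cong₂ _,_ (cong proj₁ (mealy-id a xs)) (cong (λ z → x ∷ proj₂ z) (mealy-id a xs))

module Simulate {Q F C : Set} (finQ : Finite Q) (finC : Finite (Bool × C))
  (δ′ : ⊤ ⊎ Q → Fin 4 ⊎ (Bool × C) → Maybe ((⊤ ⊎ Q) × (Fin 4 ⊎ (Bool × C)) × Move)) where

  open Machine finQ finC δ′ public
  open Control {F} {C} public

  cell : C → Γ
  cell c = inj₂ (false , c)

  -- The configuration between two operations: the head stands on the first cell, the only one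
  -- marked `true`, and `k` visited blanks follow the last cell. The clause for the empty list is a
  -- default.
  at : State → List C → ℕ → Conf
  at q []       k = conf q [] □ (□s k)
  at q (x ∷ xs) k = conf q [] (inj₂ (true , x)) (map cell xs ++ □s k)

  stay-at : ∀ {q q'} → (∀ a → δ′ q a ≡ just (q' , a , Move.S)) → ∀ xs k → at q xs k ↦ at q' xs k
  stay-at h []       k = stay (h _)
  stay-at h (x ∷ xs) k = stay (h _)

  -- The induction has to cover every copy of a program inside a larger one: `ι` places its control
  -- states and `ε` receives its exits.
  Embedded : ∀ p → (Ctl p → State) → (F → State) → Set
  Embedded p ι ε = ∀ s a → δ′ (ι s) a ≡ retarget [ ι , ε ] (δW p s a)

  -- Crossing `suc l` cells to the right and back takes `2 + (l + l)` steps and leaving takes one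
  -- more. This fixes `suc (M + M)` as the price of one operation.
  pass-cost : ∀ {l M} → suc l ≤ M → (2 + (l + l)) + 1 ≤ 1 * suc (M + M)
  pass-cost {l} {M} le = begin
    (2 + (l + l)) + 1    ≡⟨ +-comm (2 + (l + l)) 1 ⟩
    3 + (l + l)          ≡⟨ cong (λ z → suc (suc z)) (sym (+-suc l l)) ⟩
    suc (suc l + suc l)  ≤⟨ s≤s (+-mono-≤ le le) ⟩
    suc (M + M)          ≡⟨ sym (*-identityˡ (suc (M + M))) ⟩
    1 * suc (M + M)      ∎
    where open ≤-Reasoning

  -- Every operation is charged one round trip over at most `M` cells. Sweeps and appends change the
  -- number of visited blanks, so the final `k'` is existential.
  simulate : ∀ {M p s s' u} {ι : Ctl p → State} {ε : F → State} → Embedded p ι ε → M ⊢ p ∶ s ⇓ s' # u →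
    ∀ k → Σ ℕ λ k' → Reach (u * suc (M + M)) (at (ι (entry p (proj₁ s))) (proj₂ s) k) (at (ε (proj₁ s')) (proj₂ s') k')
  simulate {M} E (⇓upd {h} {f} {xs}) k = k , weaken (s≤s z≤n) (stay-at (E f) xs k ◅ done)
  simulate {M} {ι = ι} {ε} E (⇓swp {g} {f} {x} {xs} le) k = suc (pred k) , weaken (pass-cost le)
    (roundTrip (λ a → ι (inj₁ a)) (λ a → ι (inj₂ a)) (λ _ → □) g cell cell cell
       (λ a y → E (inj₁ a) (cell y)) (λ a → E (inj₁ a) □) (λ a y → E (inj₂ a) (cell y))
       (E (inj₁ f) (inj₂ (true , x))) xs k
     ◅◅ (stay (E (inj₂ _) _) ◅ done))
  simulate {M} {ι = ι} {ε} E (⇓app {a} {f} {x} {xs} le) k = pred k , weaken (pass-cost le)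
    (subst (λ c → Reach (2 + (length xs + length xs)) (at (ι (inj₁ f)) (x ∷ xs) k) c) eq
      (roundTrip (λ a → ι (inj₁ a)) (λ a → ι (inj₂ a)) (λ f → cell (a f)) (λ a x → a , x) cell cell cell
       (λ a y → E (inj₁ a) (cell y)) (λ a → E (inj₁ a) □) (λ a y → E (inj₂ a) (cell y))
       (E (inj₁ f) (inj₂ (true , x))) xs k)
     ◅◅ (stay (E (inj₂ f) _) ◅ done))
    where
    eq : conf (ι (inj₂ (proj₁ (mealy (λ a x → a , x) f xs)))) [] (inj₂ (true , x))
           (map cell (proj₂ (mealy (λ a x → a , x) f xs)) ++ cell (a (proj₁ (mealy (λ a x → a , x) f xs))) ∷ □s (pred k))
         ≡ at (ι (inj₂ f)) (x ∷ xs ++ a f ∷ []) (pred k)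
    eq rewrite mealy-id f xs = cong (conf (ι (inj₂ f)) [] (inj₂ (true , x)))
      (sym (trans (cong (_++ □s (pred k)) (map-++ cell xs (a f ∷ []))) (++-assoc (map cell xs) _ _)))
  simulate {M} {p ⨾ q} {ι = ι} {ε} E (⇓⨾ {u = u} {v} d e) k
    with simulate {ι = λ s → ι (inj₁ s)} {ε = λ f → ι (inj₂ (entry q f))}
           (λ s a → trans (E (inj₁ s) a) (retarget-∘ (λ { (inj₁ _) → refl ; (inj₂ _) → refl }) (δW p s a))) d k
  ... | k₁ , r₁
    with simulate {ι = λ s → ι (inj₂ s)} {ε = ε}
           (λ s a → trans (E (inj₂ s) a) (retarget-∘ (λ { (inj₁ _) → refl ; (inj₂ _) → refl }) (δW q s a))) e k₁
  ... | k₂ , r₂ = k₂ , weaken (≤-reflexive (sym (*-distribʳ-+ (suc (M + M)) u v))) (r₁ ◅◅ r₂)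
  simulate {M} {ite b p q} {ι = ι} {ε} E (⇓iteT {f = f} {xs} {u = u} bf d) k
    with simulate {ι = λ s → ι (inj₂ (inj₁ s))} {ε = ε}
           (λ s a → trans (E (inj₂ (inj₁ s)) a) (retarget-∘ (λ { (inj₁ _) → refl ; (inj₂ _) → refl }) (δW p s a))) d k
  ... | k₁ , r = k₁ , weaken (s≤s (m≤n+m _ (M + M)))
    (stay-at (λ a → trans (E (inj₁ f) a) (cong (λ z → just (ι (inj₂ (if z then inj₁ (entry p f) else inj₂ (entry q f))) , a , Move.S)) bf)) xs k ◅ r)
  simulate {M} {ite b p q} {ι = ι} {ε} E (⇓iteF {f = f} {xs} {u = u} bf d) k
    with simulate {ι = λ s → ι (inj₂ (inj₂ s))} {ε = ε}
           (λ s a → trans (E (inj₂ (inj₂ s)) a) (retarget-∘ (λ { (inj₁ _) → refl ; (inj₂ _) → refl }) (δW q s a))) d k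
  ... | k₁ , r = k₁ , weaken (s≤s (m≤n+m _ (M + M)))
    (stay-at (λ a → trans (E (inj₁ f) a) (cong (λ z → just (ι (inj₂ (if z then inj₁ (entry p f) else inj₂ (entry q f))) , a , Move.S)) bf)) xs k ◅ r)
  simulate {M} {whl b p} {ι = ι} {ε} E (⇓whlF {f = f} {xs} bf) k = k , weaken (s≤s z≤n)
    (stay-at (λ a → trans (E (inj₁ f) a) (cong (λ z → just ([ ι , ε ] (if z then inj₁ (inj₂ (entry p f)) else inj₂ f) , a , Move.S)) bf)) xs k ◅ done)
  simulate {M} {whl b p} {ι = ι} {ε} E (⇓whlT {f = f} {xs} {u = u} {v} bf d e) k
    with simulate {ι = λ s → ι (inj₂ s)} {ε = λ f → ι (inj₁ f)}
           (λ s a → trans (E (inj₂ s) a) (retarget-∘ (λ { (inj₁ _) → refl ; (inj₂ _) → refl }) (δW p s a))) d k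
  ... | k₁ , r₁ with simulate E e k₁
  ... | k₂ , r₂ = k₂ , weaken (s≤s (≤-trans (≤-reflexive (sym (*-distribʳ-+ (suc (M + M)) u v))) (m≤n+m _ (M + M))))
    (stay-at (λ a → trans (E (inj₁ f) a) (cong (λ z → just ([ ι , ε ] (if z then inj₁ (inj₂ (entry p f)) else inj₂ f) , a , Move.S)) bf)) xs k ◅ r₁ ◅◅ r₂)

-- The complete machine: reading the input word and printing the result

data Phase : Set where
  fill rewind scan print halt : Phase

finite-Phase : Finite Phase
finite-Phase = finite-retract (finite-Fin 5)
  (λ { zero → fill ; (suc zero) → rewind ; (suc (suc zero)) → scan ; (suc (suc (suc zero))) → print ; (suc (suc (suc (suc _)))) → halt })
  (λ { fill → zero ; rewind → suc zero ; scan → suc (suc zero) ; print → suc (suc (suc zero)) ; halt → suc (suc (suc (suc zero))) })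
  (λ { fill → refl ; rewind → refl ; scan → refl ; print → refl ; halt → refl })

readBinary : List (Fin 4) → ℕ → ℕ
readBinary []                    acc = acc
readBinary (zero ∷ xs)           acc = acc
readBinary (suc zero ∷ xs)       acc = readBinary xs (2 * acc)
readBinary (suc (suc zero) ∷ xs) acc = readBinary xs (2 * acc + 1)
readBinary (suc (suc (suc _)) ∷ xs) acc = acc

module Whole {F C : Set} (finF : Finite F) (finC : Finite (Bool × C)) (p : While F C)
  (f₀ : F) (inp : Fin 4 → C) (out : C → Fin 4) where

  open Control {F} {C}

  pattern start = inj₁ tt
  pattern phase x = inj₂ (inj₁ x)

  transition : ⊤ ⊎ (Phase ⊎ Ctl p) → Symbol → Maybe ((⊤ ⊎ (Phase ⊎ Ctl p)) × Symbol × Move)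
  transition start (inj₁ s)                        = just (phase fill , inj₂ (true , inp s) , Move.R)
  transition start (inj₂ _)                        = nothing
  transition (phase fill) (inj₁ zero)              = just (phase rewind , inj₁ zero , Move.L)
  transition (phase fill) (inj₁ (suc s))           = just (phase fill , inj₂ (false , inp (suc s)) , Move.R)
  transition (phase fill) (inj₂ _)                 = nothing
  transition (phase rewind) (inj₂ (false , c))     = just (phase rewind , inj₂ (false , c) , Move.L)
  transition (phase rewind) (inj₂ (true , c))      = just (inj₂ (inj₂ (entry p f₀)) , inj₂ (true , c) , Move.S)
  transition (phase rewind) (inj₁ _)               = nothing
  transition (phase scan) (inj₂ c)                 = just (phase scan , inj₂ c , Move.R)
  transition (phase scan) (inj₁ _)                 = just (phase print , inj₁ zero , Move.L)
  -- Output symbols are written on the way back, because the output is read from the position of the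
  -- head, which must therefore end on the first cell.
  transition (phase print) (inj₂ (false , c))      = just (phase print , inj₁ (out c) , Move.L)
  transition (phase print) (inj₂ (true , c))       = just (phase halt , inj₁ (out c) , Move.S)
  transition (phase print) (inj₁ _)                = nothing
  transition (phase halt) _                        = nothing
  transition (inj₂ (inj₂ s)) a                     = retarget [ (λ s' → inj₂ (inj₂ s')) , (λ _ → phase scan) ] (δW p s a)

  open Simulate {F = F} (finite-⊎ finite-Phase (finite-Ctl finF p)) finC transition hiding (Ctl; δW; entry; Symbol; finite-Ctl) public

  symbol : Fin 3 → Fin (4 + size finC)
  symbol s = enc finΓ (inj₁ (suc s))

  readBits≡ : ∀ zs k acc → readBits machine (map (enc finΓ) (map inj₁ zs ++ □s k)) acc ≡ readBinary zs acc
  readBits≡ [] zero    acc = refl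
  readBits≡ [] (suc k) acc = refl
  readBits≡ (zero ∷ zs) k acc = refl
  readBits≡ (suc zero ∷ zs) k acc = readBits≡ zs k _
  readBits≡ (suc (suc zero) ∷ zs) k acc = readBits≡ zs k _
  readBits≡ (suc (suc (suc zero)) ∷ zs) k acc = refl

  cellOf : Fin 3 → C
  cellOf s = inp (suc s)

  whole : ∀ {M x xs f' y ys u} → M ⊢ p ∶ (f₀ , cellOf x ∷ map cellOf xs) ⇓ (f' , y ∷ ys) # u →
    ∀ T → (3 + (length xs + length xs)) + (u * suc (M + M) + (3 + (length ys + length ys))) ≤ T →
    Σ (Config machine) λ final →
      run machine T (initial machine (map symbol (x ∷ xs))) ≡ just final
      × output machine final ≡ readBinary (map out (y ∷ ys)) 0
  whole {M} {x} {xs} {f'} {y} {ys} {u} d T le = toConfig final , runs , out≡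
    where
    -- The filling pass stops on one blank behind the input, hence the argument 1.
    k₁ = proj₁ (simulate {ι = λ s → inj₂ (inj₂ s)} {ε = λ _ → phase scan} (λ s a → refl) d 1)
    r₁ = proj₂ (simulate {ι = λ s → inj₂ (inj₂ s)} {ε = λ _ → phase scan} (λ s a → refl) d 1)
    mealy-map : ∀ zs → mealy (λ (a : ⊤) s → a , cellOf s) tt zs ≡ (tt , map cellOf zs)
    mealy-map []       = refl
    mealy-map (z ∷ zs) = cong₂ _,_ (cong proj₁ (mealy-map zs)) (cong (λ w → cellOf z ∷ proj₂ w) (mealy-map zs))
    sy : Fin 3 → Γ
    sy s = inj₁ (suc s)
    r₀ : Reach (3 + (length xs + length xs)) (conf start [] (sy x) (map sy xs))
               (at (inj₂ (inj₂ (entry p f₀))) (cellOf x ∷ map cellOf xs) 1)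
    r₀ = subst₂ (λ n r → Reach n (conf start [] (sy x) r) (at (inj₂ (inj₂ (entry p f₀))) (cellOf x ∷ map cellOf xs) 1))
           (+-comm (2 + (length xs + length xs)) 1) (++-identityʳ (map sy xs))
         (subst (λ w → Reach (2 + (length xs + length xs)) (conf start [] (sy x) (map sy xs ++ []))
                  (conf (phase rewind) [] (inj₂ (true , cellOf x)) (map cell (proj₂ w) ++ □ ∷ []))) (mealy-map xs)
           (roundTrip (λ _ → phase fill) (λ _ → phase rewind) (λ _ → □) (λ (a : ⊤) s → a , cellOf s) sy cell cell
             (λ _ _ → refl) (λ _ → refl) (λ _ _ → refl) {start} {tt} refl xs 0)
         ◅◅ (stay refl ◅ done))
    final = conf (phase halt) [] (inj₁ (out y)) (map inj₁ (map out ys) ++ □s (suc (pred k₁)))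
    r₂ : Reach (3 + (length ys + length ys)) (at (phase scan) (y ∷ ys) k₁) final
    r₂ = subst₂ (λ n r → Reach n (at (phase scan) (y ∷ ys) k₁) (conf (phase halt) [] (inj₁ (out y)) (r ++ □s (suc (pred k₁)))))
           (+-comm (2 + (length ys + length ys)) 1) (map-∘ ys)
         (subst (λ w → Reach (2 + (length ys + length ys)) (at (phase scan) (y ∷ ys) k₁)
                  (conf (phase print) [] (inj₂ (true , y)) (map (λ c → inj₁ (out c)) (proj₂ w) ++ □ ∷ □s (pred k₁)))) (mealy-id tt ys)
           (roundTrip (λ _ → phase scan) (λ _ → phase print) (λ _ → □) (λ (a : ⊤) c → a , c) cell cell (λ c → inj₁ (out c))
             (λ _ _ → refl) (λ _ → refl) (λ _ _ → refl) {phase scan} {tt} refl ys k₁)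
         ◅◅ (stay refl ◅ done))
    init≡ : initial machine (map symbol (x ∷ xs)) ≡ toConfig (conf start [] (sy x) (map sy xs))
    init≡ = cong (cfg zero [] (symbol x)) (map-∘ xs)
    runs : run machine T (initial machine (map symbol (x ∷ xs))) ≡ just (toConfig final)
    runs = trans (cong (run machine T) init≡) (run-Reach (weaken le (r₀ ◅◅ r₁ ◅◅ r₂)) (step-halt {phase halt} {inj₁ (out y)} {[]} {map inj₁ (map out ys) ++ □s (suc (pred k₁))} refl))
    out≡ : output machine (toConfig final) ≡ readBinary (map out (y ∷ ys)) 0
    out≡ = readBits≡ (out y ∷ map out ys) (suc (pred k₁)) 0

-- Structured programs with loops of fixed length, and polynomial cost

data Prog (F C : Set) : Set where
  update : (F → F) → Prog F C
  sweep  : (F → C → F × C) → Prog F C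
  append : (F → C) → Prog F C
  _▸_    : Prog F C → Prog F C → Prog F C
  branch : (F → Bool) → Prog F C → Prog F C → Prog F C
  loop   : Prog F C → Prog F C

infixr 4 _▸_

iterate : {A : Set} → ℕ → (A → A) → A → A
iterate zero    f x = x
iterate (suc n) f x = iterate n f (f x)

exec : {F C : Set} → ℕ → Prog F C → F × List C → F × List C
exec N (update h)     s = h (proj₁ s) , proj₂ s
exec N (sweep g)      s = mealy g (proj₁ s) (proj₂ s)
exec N (append a)     s = proj₁ s , proj₂ s ++ a (proj₁ s) ∷ []
exec N (p ▸ q)        s = exec N q (exec N p s)
exec N (branch b p q) s = if b (proj₁ s) then exec N p s else exec N q s
exec N (loop p)       s = iterate N (exec N p) s

-- In a loop, marking, the first `clear` (two operations) and the last test make 4; every round adds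
-- its test and another `clear`, hence 3. A branch is charged for both arms.
ops : {F C : Set} → ℕ → Prog F C → ℕ
ops N (update h)     = 1
ops N (sweep g)      = 1
ops N (append a)     = 1
ops N (p ▸ q)        = ops N p + ops N q
ops N (branch b p q) = suc (ops N p + ops N q)
ops N (loop p)       = 4 + N * (3 + ops N p)

depth : {F C : Set} → Prog F C → ℕ
depth (update h)     = 0
depth (sweep g)      = 0
depth (append a)     = 0
depth (p ▸ q)        = depth p ⊔ depth q
depth (branch b p q) = depth p ⊔ depth q
depth (loop p)       = suc (depth p)

-- The base `suc n` is positive, so powers grow with the exponent even at `n = 0`, and the degree of
-- a sum may simply be the sum of the degrees.
record PolyBounded (f : ℕ → ℕ) : Set where
  constructor poly
  field
    coeff  : ℕ
    degree : ℕ
    bound  : ∀ n → f n ≤ coeff * suc n ^ degree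

pow-mono : ∀ n {d e} → d ≤ e → suc n ^ d ≤ suc n ^ e
pow-mono n {e = e} z≤n = m^n>0 (suc n) e
pow-mono n (s≤s le)    = *-monoʳ-≤ (suc n) (pow-mono n le)

poly-const : ∀ k → PolyBounded (λ _ → k)
poly-const k = poly k 0 (λ n → ≤-reflexive (sym (*-identityʳ k)))

poly-id : PolyBounded (λ n → n)
poly-id = poly 1 1 (λ n → ≤-trans (n≤1+n n) (≤-reflexive (sym (trans (*-identityˡ (suc n * 1)) (*-identityʳ (suc n))))))

poly-+ : ∀ {f g} → PolyBounded f → PolyBounded g → PolyBounded (λ n → f n + g n)
poly-+ (poly a d p) (poly b e q) = poly (a + b) (d + e) λ n →
  ≤-trans (+-mono-≤ (≤-trans (p n) (*-monoʳ-≤ a (pow-mono n (m≤m+n d e))))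
                    (≤-trans (q n) (*-monoʳ-≤ b (pow-mono n (m≤n+m e d)))))
          (≤-reflexive (sym (*-distribʳ-+ (suc n ^ (d + e)) a b)))

poly-* : ∀ {f g} → PolyBounded f → PolyBounded g → PolyBounded (λ n → f n * g n)
poly-* (poly a d p) (poly b e q) = poly (a * b) (d + e) λ n →
  ≤-trans (*-mono-≤ (p n) (q n)) (≤-reflexive (trans
    ([m*n]*[o*p]≡[m*o]*[n*p] a (suc n ^ d) b (suc n ^ e))
    (cong (a * b *_) (sym (^-distribˡ-+-* (suc n) d e)))))

poly-ops : ∀ {F C} (p : Prog F C) → PolyBounded (λ N → ops N p)
poly-ops (update h)     = poly-const 1
poly-ops (sweep g)      = poly-const 1
poly-ops (append a)     = poly-const 1
poly-ops (p ▸ q)        = poly-+ (poly-ops p) (poly-ops q)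
poly-ops (branch b p q) = poly-+ (poly-const 1) (poly-+ (poly-ops p) (poly-ops q))
poly-ops (loop p)       = poly-+ (poly-const 4) (poly-* poly-id (poly-+ (poly-const 3) (poly-ops p)))

-- Loop counters kept on tracks of the tape

getTrack : ∀ {n} → ℕ → Vec Bool n → Bool
getTrack i       []       = false
getTrack zero    (b ∷ bs) = b
getTrack (suc i) (b ∷ bs) = getTrack i bs

setTrack : ∀ {n} → ℕ → Bool → Vec Bool n → Vec Bool n
setTrack i       x []       = []
setTrack zero    x (b ∷ bs) = x ∷ bs
setTrack (suc i) x (b ∷ bs) = b ∷ setTrack i x bs

get-set : ∀ {n} i x (bs : Vec Bool n) → i < n → getTrack i (setTrack i x bs) ≡ x
get-set zero    x (b ∷ bs) _        = refl
get-set (suc i) x (b ∷ bs) (s≤s lt) = get-set i x bs lt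

get-set-≢ : ∀ {n} i j x (bs : Vec Bool n) → i ≢ j → getTrack i (setTrack j x bs) ≡ getTrack i bs
get-set-≢ i       j       x []       ne = refl
get-set-≢ zero    zero    x (b ∷ bs) ne = ⊥-elim (ne refl)
get-set-≢ zero    (suc j) x (b ∷ bs) ne = refl
get-set-≢ (suc i) zero    x (b ∷ bs) ne = refl
get-set-≢ (suc i) (suc j) x (b ∷ bs) ne = get-set-≢ i j x bs (λ e → ne (cong suc e))

getTrack-false : ∀ n i → getTrack i (Vec.replicate n false) ≡ false
getTrack-false zero    i       = refl
getTrack-false (suc n) zero    = refl
getTrack-false (suc n) (suc i) = getTrack-false n i

positive : ℕ → Bool
positive zero    = false
positive (suc _) = true

-- Every cell carries, besides its content, one bit per loop nesting level. Track 0 marks the input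
-- cells; an active loop at level d clears, on track d, one input cell per iteration.
module Loops {F C : Set} (D : ℕ) where

  H : Set
  H = Vec Bool (suc D)

  Cell⁺ : Set
  Cell⁺ = H × C

  F⁺ : Set
  F⁺ = Bool × F

  -- Track 0 singles out the input cells, so this pass puts one mark on track `d` for each iteration
  -- to come.
  markStep : ℕ → F⁺ → Cell⁺ → F⁺ × Cell⁺
  markStep d s (h , c) = s , (setTrack d (getTrack 0 h) h , c)

  -- The flag becomes `true` as soon as a mark has been cleared, after which the pass only copies.
  -- Its final value is the loop condition.
  clearStep : ℕ → F⁺ → Cell⁺ → F⁺ × Cell⁺
  clearStep d (true  , f) hc      = (true , f) , hc
  clearStep d (false , f) (h , c) =
    if getTrack d h then ((true , f) , (setTrack d false h , c)) else ((false , f) , (h , c))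

  liftStep : (F → C → F × C) → F⁺ → Cell⁺ → F⁺ × Cell⁺
  liftStep g (b , f) (h , c) = (b , proj₁ (g f c)) , (h , proj₂ (g f c))

  clear : ℕ → While F⁺ Cell⁺
  clear d = upd (λ s → false , proj₂ s) ⨾ swp (clearStep d)

  -- `d` is the first track not in use by an enclosing loop. Appended cells are unmarked on every
  -- track, so the number of iterations remains the input length while the tape grows.
  compile : ℕ → Prog F C → While F⁺ Cell⁺
  compile d (update h)     = upd (λ s → proj₁ s , h (proj₂ s))
  compile d (sweep g)      = swp (liftStep g)
  compile d (append a)     = app (λ s → Vec.replicate (suc D) false , a (proj₂ s))
  compile d (p ▸ q)        = compile d p ⨾ compile d q
  compile d (branch b p q) = ite (λ s → b (proj₂ s)) (compile d p) (compile d q)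
  compile d (loop p)       = swp (markStep d) ⨾ (clear d ⨾ whl proj₁ (compile (suc d) p ⨾ clear d))

  one : Bool → ℕ
  one b = if b then 1 else 0

  count : ℕ → List Cell⁺ → ℕ
  count e []             = 0
  count e ((h , c) ∷ xs) = one (getTrack e h) + count e xs

  contents : List Cell⁺ → List C
  contents = map proj₂

  count-++ : ∀ e xs ys → count e (xs ++ ys) ≡ count e xs + count e ys
  count-++ e []       ys = refl
  count-++ e (x ∷ xs) ys = trans (cong (one (getTrack e (proj₁ x)) +_) (count-++ e xs ys))
                                 (sym (+-assoc (one (getTrack e (proj₁ x))) _ _))

  lift-flag : ∀ g b f xs → proj₁ (mealy (liftStep g) (b , f) xs) ≡ (b , proj₁ (mealy g f (contents xs)))
  lift-flag g b f []             = refl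
  lift-flag g b f ((h , c) ∷ xs) = lift-flag g b (proj₁ (g f c)) xs

  lift-contents : ∀ g b f xs → contents (proj₂ (mealy (liftStep g) (b , f) xs)) ≡ proj₂ (mealy g f (contents xs))
  lift-contents g b f []             = refl
  lift-contents g b f ((h , c) ∷ xs) = cong (proj₂ (g f c) ∷_) (lift-contents g b (proj₁ (g f c)) xs)

  lift-count : ∀ e g b f xs → count e (proj₂ (mealy (liftStep g) (b , f) xs)) ≡ count e xs
  lift-count e g b f []             = refl
  lift-count e g b f ((h , c) ∷ xs) = cong (one (getTrack e h) +_) (lift-count e g b (proj₁ (g f c)) xs)

  mark-flag : ∀ d s xs → proj₁ (mealy (markStep d) s xs) ≡ s
  mark-flag d s []       = refl
  mark-flag d s (x ∷ xs) = mark-flag d s xs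

  mark-contents : ∀ d s xs → contents (proj₂ (mealy (markStep d) s xs)) ≡ contents xs
  mark-contents d s []       = refl
  mark-contents d s (x ∷ xs) = cong (proj₂ x ∷_) (mark-contents d s xs)

  mark-count : ∀ d s xs → d < suc D → count d (proj₂ (mealy (markStep d) s xs)) ≡ count 0 xs
  mark-count d s []       lt = refl
  mark-count d s (x ∷ xs) lt = cong₂ (λ a b → one a + b) (get-set d _ (proj₁ x) lt) (mark-count d s xs lt)

  mark-count-≢ : ∀ e d s xs → e ≢ d → count e (proj₂ (mealy (markStep d) s xs)) ≡ count e xs
  mark-count-≢ e d s []       ne = refl
  mark-count-≢ e d s (x ∷ xs) ne = cong₂ (λ a b → one a + b) (get-set-≢ e d _ (proj₁ x) ne) (mark-count-≢ e d s xs ne)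

  clear-true : ∀ d f xs → mealy (clearStep d) (true , f) xs ≡ ((true , f) , xs)
  clear-true d f []       = refl
  clear-true d f (x ∷ xs) = cong₂ _,_ (cong proj₁ (clear-true d f xs)) (cong (λ w → x ∷ proj₂ w) (clear-true d f xs))

  clear-zero : ∀ d f xs → count d xs ≡ 0 → mealy (clearStep d) (false , f) xs ≡ ((false , f) , xs)
  clear-zero d f []             _ = refl
  clear-zero d f ((h , c) ∷ xs) z with getTrack d h
  clear-zero d f ((h , c) ∷ xs) z | false =
    cong₂ _,_ (cong proj₁ (clear-zero d f xs z)) (cong (λ w → (h , c) ∷ proj₂ w) (clear-zero d f xs z))

  clear-suc : ∀ d f xs n → d < suc D → count d xs ≡ suc n → Σ (List Cell⁺) λ ys →
    mealy (clearStep d) (false , f) xs ≡ ((true , f) , ys) × contents ys ≡ contents xs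
    × count d ys ≡ n × (∀ e → e ≢ d → count e ys ≡ count e xs)
  clear-suc d f ((h , c) ∷ xs) n lt z with getTrack d h in eq
  ... | true  = (setTrack d false h , c) ∷ xs
              , cong (λ w → proj₁ w , (setTrack d false h , c) ∷ proj₂ w) (clear-true d f xs) , refl
              , trans (cong (λ b → one b + count d xs) (get-set d false h lt)) (suc-injective z)
              , λ e ne → cong (λ b → one b + count e xs) (get-set-≢ e d false h ne)
  ... | false with clear-suc d f xs n lt z
  ...   | ys , e₁ , e₂ , e₃ , e₄ = (h , c) ∷ ys
              , cong (λ w → proj₁ w , (h , c) ∷ proj₂ w) e₁ , cong (c ∷_) e₂
              , trans (cong (λ b → one b + count d ys) eq) e₃
              , λ e ne → cong (one (getTrack e h) +_) (e₄ e ne)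

  -- Tracks below `d` hold the input marks and the counters of enclosing loops, whose counts must
  -- survive. By `length≤` an operation adds at most one cell, so the present length plus the cost
  -- still to come bounds the tape.
  record Outcome (M : ℕ) (w : While F⁺ Cell⁺) (b : Bool) (f : F) (xs : List Cell⁺) (d bound : ℕ) (goal : F × List C) : Set where
    constructor outcome
    field
      flag     : Bool
      tape     : List Cell⁺
      used     : ℕ
      derives  : M ⊢ w ∶ ((b , f) , xs) ⇓ ((flag , proj₁ goal) , tape) # used
      used≤    : used ≤ bound
      content≡ : contents tape ≡ proj₂ goal
      count≡   : ∀ e → e < d → count e tape ≡ count e xs
      length≤  : length tape ≤ length xs + used
      nonempty : 1 ≤ length tape

  ⇓swp′ : ∀ {M} {g : F⁺ → Cell⁺ → F⁺ × Cell⁺} {f} xs → 1 ≤ length xs → length xs ≤ M → M ⊢ swp g ∶ (f , xs) ⇓ mealy g f xs # 1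
  ⇓swp′ (x ∷ xs) _ le = ⇓swp le

  ⇓app′ : ∀ {M} {a : F⁺ → Cell⁺} {f} xs → 1 ≤ length xs → length xs ≤ M → M ⊢ app a ∶ (f , xs) ⇓ (f , xs ++ a f ∷ []) # 1
  ⇓app′ (x ∷ xs) _ le = ⇓app le

  split-room : ∀ {x y u A B M} → x + (A + B) ≤ M → y ≤ x + u → u ≤ A → y + B ≤ M
  split-room {x} {y} {u} {A} {B} le l u≤ =
    ≤-trans (+-monoˡ-≤ B (≤-trans l (+-monoʳ-≤ x u≤))) (≤-trans (≤-reflexive (+-assoc x A B)) le)

  clear-outcome : ∀ {M b f xs d n} → d < suc D → count d xs ≡ n → 1 ≤ length xs → length xs ≤ M →
    Σ (List Cell⁺) λ ys → M ⊢ clear d ∶ ((b , f) , xs) ⇓ ((positive n , f) , ys) # 2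
    × contents ys ≡ contents xs × count d ys ≡ pred n × (∀ e → e ≢ d → count e ys ≡ count e xs) × length ys ≡ length xs
  clear-outcome {M} {f = f} {xs} {d} {zero} lt z ne le = xs
    , ⇓⨾ ⇓upd (subst (λ w → M ⊢ swp (clearStep d) ∶ ((false , f) , xs) ⇓ w # 1) (clear-zero d f xs z) (⇓swp′ xs ne le))
    , refl , z , (λ _ _ → refl) , refl
  clear-outcome {M} {f = f} {xs} {d} {suc n} lt z ne le with clear-suc d f xs n lt z
  ... | ys , e₁ , e₂ , e₃ , e₄ = ys
    , ⇓⨾ ⇓upd (subst (λ w → M ⊢ swp (clearStep d) ∶ ((false , f) , xs) ⇓ w # 1) e₁ (⇓swp′ xs ne le))
    , e₂ , e₃ , e₄
    , trans (sym (length-map proj₂ ys)) (trans (cong length e₂) (length-map proj₂ xs))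

  correct : ∀ {M N d} p b f xs → d + depth p ≤ suc D → 1 ≤ d → 1 ≤ length xs → count 0 xs ≡ N →
    length xs + ops N p ≤ M → Outcome M (compile d p) b f xs d (ops N p) (exec N p (f , contents xs))

  -- Induction on the number `n` of marks left on track `d`. The `clear` before the loop belongs to
  -- the statement because it sets the flag that the loop tests first.
  iterations : ∀ {M N d} p n b f xs → suc d + depth p ≤ suc D → 1 ≤ d → 1 ≤ length xs → count 0 xs ≡ N →
    count d xs ≡ n → length xs + (3 + n * (3 + ops N p)) ≤ M →
    Σ (F⁺ × List Cell⁺) λ s → M ⊢ clear d ∶ ((b , f) , xs) ⇓ s # 2
    × Σ Bool λ b' → Σ (List Cell⁺) λ ys → Σ ℕ λ u →
      M ⊢ whl proj₁ (compile (suc d) p ⨾ clear d) ∶ s ⇓ ((b' , proj₁ (iterate n (exec N p) (f , contents xs))) , ys) # u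
      × u ≤ 1 + n * (3 + ops N p)
      × contents ys ≡ proj₂ (iterate n (exec N p) (f , contents xs))
      × (∀ e → e < d → count e ys ≡ count e xs) × length ys ≤ length xs + u × 1 ≤ length ys

  correct (update h) b f xs dp 1≤d ne c0 le =
    outcome b xs 1 ⇓upd ≤-refl refl (λ _ _ → refl) (m≤m+n _ 1) ne
  correct {M} (sweep g) b f xs dp 1≤d ne c0 le = outcome b (proj₂ (mealy (liftStep g) (b , f) xs)) 1
    (subst (λ s → M ⊢ swp (liftStep g) ∶ ((b , f) , xs) ⇓ (s , proj₂ (mealy (liftStep g) (b , f) xs)) # 1)
       (lift-flag g b f xs) (⇓swp′ xs ne (m+n≤o⇒m≤o (length xs) le)))
    ≤-refl (lift-contents g b f xs) (λ e _ → lift-count e g b f xs)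
    (≤-trans (≤-reflexive (length-mealy (liftStep g) (b , f) xs)) (m≤m+n _ 1))
    (≤-trans ne (≤-reflexive (sym (length-mealy (liftStep g) (b , f) xs))))
  correct (append a) b f xs dp 1≤d ne c0 le = outcome b (xs ++ (Vec.replicate (suc D) false , a f) ∷ []) 1
    (⇓app′ xs ne (m+n≤o⇒m≤o (length xs) le)) ≤-refl (map-++ proj₂ xs _)
    (λ e _ → trans (count-++ e xs _) (trans (cong (λ z → count e xs + (one z + 0)) (getTrack-false (suc D) e)) (+-identityʳ _)))
    (≤-reflexive (length-++ xs)) (≤-trans ne (≤-trans (m≤m+n _ 1) (≤-reflexive (sym (length-++ xs)))))
  correct {M} {N} {d} (p ▸ q) b f xs dp 1≤d ne c0 le
    with correct p b f xs (≤-trans (+-monoʳ-≤ d (m≤m⊔n (depth p) (depth q))) dp) 1≤d ne c0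
                 (≤-trans (+-monoʳ-≤ (length xs) (m≤m+n (ops N p) (ops N q))) le)
  ... | outcome b₁ ys u der u≤ c≡ k≡ l≤ ne₁
    with correct q b₁ (proj₁ (exec N p (f , contents xs))) ys
           (≤-trans (+-monoʳ-≤ d (m≤n⊔m (depth p) (depth q))) dp) 1≤d ne₁ (trans (k≡ 0 1≤d) c0)
           (split-room {length xs} {length ys} {u} {ops N p} le l≤ u≤)
  ... | o rewrite c≡ with o
  ... | outcome b₂ zs v der₂ v≤ c≡₂ k≡₂ l≤₂ ne₂ = outcome b₂ zs (u + v) (⇓⨾ der der₂)
    (+-mono-≤ u≤ v≤) c≡₂ (λ e lt → trans (k≡₂ e lt) (k≡ e lt))
    (≤-trans l≤₂ (≤-trans (+-monoˡ-≤ v l≤) (≤-reflexive (+-assoc (length xs) u v)))) ne₂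
  correct {M} {N} {d} (branch b? p q) b f xs dp 1≤d ne c0 le with b? f in eq
  ... | true with correct {M} p b f xs (≤-trans (+-monoʳ-≤ d (m≤m⊔n (depth p) (depth q))) dp) 1≤d ne c0
                 (≤-trans (+-monoʳ-≤ (length xs) (≤-trans (m≤m+n (ops N p) (ops N q)) (n≤1+n _))) le)
  ...   | outcome b₁ ys u der u≤ c≡ k≡ l≤ ne₁ = outcome b₁ ys (suc u) (⇓iteT eq der)
            (s≤s (≤-trans u≤ (m≤m+n _ _))) c≡ k≡ (≤-trans l≤ (+-monoʳ-≤ (length xs) (n≤1+n u))) ne₁
  correct {M} {N} {d} (branch b? p q) b f xs dp 1≤d ne c0 le | false
    with correct {M} q b f xs (≤-trans (+-monoʳ-≤ d (m≤n⊔m (depth p) (depth q))) dp) 1≤d ne c0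
                 (≤-trans (+-monoʳ-≤ (length xs) (≤-trans (m≤n+m (ops N q) (ops N p)) (n≤1+n _))) le)
  ...   | outcome b₁ ys u der u≤ c≡ k≡ l≤ ne₁ = outcome b₁ ys (suc u) (⇓iteF eq der)
            (s≤s (≤-trans u≤ (m≤n+m _ _))) c≡ k≡ (≤-trans l≤ (+-monoʳ-≤ (length xs) (n≤1+n u))) ne₁
  correct {M} {N} {d} (loop p) b f xs dp 1≤d ne c0 le
    with iterations {M} {N} {d} p N b f xs₁ dp' 1≤d ne₁ (trans (mark-count-≢ 0 d (b , f) xs 0≢d) c0)
           (trans (mark-count d (b , f) xs d<) c0) (≤-trans (≤-reflexive (cong (_+ _) len₁)) (≤-trans (+-monoʳ-≤ (length xs) (n≤1+n _)) le))
    where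
    xs₁ = proj₂ (mealy (markStep d) (b , f) xs)
    len₁ : length xs₁ ≡ length xs
    len₁ = length-mealy (markStep d) (b , f) xs
    ne₁ : 1 ≤ length xs₁
    ne₁ = ≤-trans ne (≤-reflexive (sym len₁))
    dp' : suc d + depth p ≤ suc D
    dp' = ≤-trans (≤-reflexive (sym (+-suc d (depth p)))) dp
    d< : d < suc D
    d< = m+n≤o⇒m≤o (suc d) dp'
    0≢d : 0 ≢ d
    0≢d e = <⇒≢ 1≤d e
  ... | s , der₁ , b' , ys , u , der₂ , u≤ , c≡ , k≡ , l≤ , ne₂
    rewrite mark-contents d (b , f) xs | length-mealy (markStep d) (b , f) xs =
    outcome b' ys (1 + (2 + u))
      (⇓⨾ (subst (λ z → M ⊢ swp (markStep d) ∶ ((b , f) , xs) ⇓ (z , proj₂ (mealy (markStep d) (b , f) xs)) # 1)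
             (mark-flag d (b , f) xs) (⇓swp′ xs ne (m+n≤o⇒m≤o (length xs) le))) (⇓⨾ der₁ der₂))
      (s≤s (s≤s (s≤s u≤))) c≡
      (λ e lt → trans (k≡ e lt) (mark-count-≢ e d (b , f) xs (<⇒≢ lt)))
      (≤-trans l≤ (+-monoʳ-≤ (length xs) (m≤n+m u 3))) ne₂

  iterations {M} {N} {d} p zero b f xs dp 1≤d ne c0 cd le
    with clear-outcome {M} {b} {f} {xs} {d} {0} (m+n≤o⇒m≤o (suc d) dp) cd ne (m+n≤o⇒m≤o (length xs) le)
  ... | ys , der , e₂ , e₃ , e₄ , e₅ = _ , der , false , ys , 1 , ⇓whlF refl , ≤-refl , e₂
      , (λ e lt → e₄ e (<⇒≢ lt)) , ≤-trans (≤-reflexive e₅) (m≤m+n _ 1) , ≤-trans ne (≤-reflexive (sym e₅))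
  iterations {M} {N} {d} p (suc n) b f xs dp 1≤d ne c0 cd le
    with clear-outcome {M} {b} {f} {xs} {d} {suc n} (m+n≤o⇒m≤o (suc d) dp) cd ne (m+n≤o⇒m≤o (length xs) le)
  ... | ys , der , e₂ , e₃ , e₄ , e₅
    with correct {M} {N} {suc d} p true f ys dp (s≤s z≤n) (≤-trans ne (≤-reflexive (sym e₅)))
           (trans (e₄ 0 (<⇒≢ 1≤d)) c0)
           (≤-trans (+-mono-≤ (≤-reflexive e₅) (≤-trans (m≤n+m (ops N p) 3) (≤-trans (m≤m+n _ (n * (3 + ops N p))) (m≤n+m _ 3)))) le)
  ... | o rewrite e₂ with o
  ... | outcome b₁ zs u der₁ u≤ c≡ k≡ l≤ ne₁
    with iterations {M} {N} {d} p n b₁ (proj₁ (exec N p (f , contents xs))) zs dp 1≤d ne₁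
           (trans (k≡ 0 (s≤s z≤n)) (trans (e₄ 0 (<⇒≢ 1≤d)) c0)) (trans (k≡ d ≤-refl) e₃)
           (room (≤-trans l≤ (+-monoˡ-≤ u (≤-reflexive e₅))) u≤)
    where
    room : ∀ {z u} → z ≤ length xs + u → u ≤ ops N p → z + (3 + n * (3 + ops N p)) ≤ M
    room {z} {u} l v = begin
      z + (3 + n * (3 + ops N p))                 ≤⟨ +-monoˡ-≤ _ (≤-trans l (+-monoʳ-≤ (length xs) v)) ⟩
      length xs + ops N p + (3 + n * (3 + ops N p)) ≡⟨ +-assoc (length xs) _ _ ⟩
      length xs + (ops N p + (3 + n * (3 + ops N p))) ≡⟨ cong (length xs +_) (sym (+-assoc (ops N p) 3 _)) ⟩
      length xs + (ops N p + 3 + n * (3 + ops N p)) ≡⟨ cong (λ w → length xs + (w + n * (3 + ops N p))) (+-comm (ops N p) 3) ⟩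
      length xs + (3 + ops N p + n * (3 + ops N p)) ≤⟨ +-monoʳ-≤ (length xs) (m≤n+m _ 3) ⟩
      length xs + (3 + (3 + ops N p + n * (3 + ops N p))) ≤⟨ le ⟩
      M ∎
      where open ≤-Reasoning
  ... | s , der₂ , b' , ws , v , der₃ , v≤ , c≡₂ , k≡₂ , l≤₂ , ne₂ rewrite c≡ =
    _ , der , b' , ws , suc ((u + 2) + v) , ⇓whlT refl (⇓⨾ der₁ der₂) der₃
      , cost , c≡₂
      , (λ e lt → trans (k≡₂ e lt) (trans (k≡ e (m≤n⇒m≤1+n lt)) (e₄ e (<⇒≢ lt))))
      , ≤-trans l≤₂ (≤-trans (+-monoˡ-≤ v (≤-trans l≤ (+-monoˡ-≤ u (≤-reflexive e₅))))
          (≤-trans (≤-reflexive (+-assoc (length xs) u v)) (+-monoʳ-≤ (length xs) (≤-trans (+-monoˡ-≤ v (m≤m+n u 2)) (n≤1+n _)))))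
      , ne₂
    where
    cost : suc ((u + 2) + v) ≤ 1 + suc n * (3 + ops N p)
    cost = s≤s (≤-trans (+-mono-≤ (+-monoˡ-≤ 2 u≤) v≤) (≤-reflexive (trans (sym (+-assoc (ops N p + 2) 1 _))
      (cong (_+ n * (3 + ops N p)) (trans (+-assoc (ops N p) 2 1) (+-comm (ops N p) 3))))))

-- A polynomial running time for compiled programs

module Realise {F C : Set} (finF : Finite F) (finC : Finite C) (P : Prog F C)
  (f₀ : F) (inp : Fin 4 → C) (out : C → Fin 4) where

  open Loops {F} {C} (depth P)

  inp⁺ : Fin 4 → Cell⁺
  inp⁺ s = true ∷ Vec.replicate (depth P) false , inp s

  out⁺ : Cell⁺ → Fin 4
  out⁺ hc = out (proj₂ hc)

  finF⁺ : Finite F⁺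
  finF⁺ = finite-× finite-Bool finF

  finCell⁺ : Finite (Bool × Cell⁺)
  finCell⁺ = finite-× finite-Bool (finite-× (finite-Vec finite-Bool (suc (depth P))) finC)

  open Whole finF⁺ finCell⁺ (compile 1 P) (false , f₀) inp⁺ out⁺ public using (machine; symbol)
  open Whole finF⁺ finCell⁺ (compile 1 P) (false , f₀) inp⁺ out⁺ using (whole; cellOf)

  -- An operation appends at most one cell, so the tape outgrows the input by no more than the
  -- number of operations.
  room : ℕ → ℕ
  room N = N + ops N P

  time : ℕ → ℕ
  time N = (3 + (N + N)) + (ops N P * suc (room N + room N) + (3 + (room N + room N)))

  poly-time : PolyBounded time
  poly-time = poly-+ (poly-+ (poly-const 3) (poly-+ poly-id poly-id))
    (poly-+ (poly-* (poly-ops P) (poly-+ (poly-const 1) (poly-+ poly-room poly-room)))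
            (poly-+ (poly-const 3) (poly-+ poly-room poly-room)))
    where
    poly-room : PolyBounded room
    poly-room = poly-+ poly-id (poly-ops P)

  input : List (Fin 3) → List C
  input = map (λ s → inp (suc s))

  count-input : ∀ xs → count 0 (map cellOf xs) ≡ length xs
  count-input []       = refl
  count-input (x ∷ xs) = cong suc (count-input xs)

  realise : ∀ x xs T → let N = length (x ∷ xs) in time N ≤ T →
    Σ (Config machine) λ final →
      run machine T (initial machine (map symbol (x ∷ xs))) ≡ just final
      × output machine final ≡ readBinary (map out (proj₂ (exec N P (f₀ , input (x ∷ xs))))) 0
  realise x xs T le
    with correct {room (suc (length xs))} {suc (length xs)} {1} P false f₀ (map cellOf (x ∷ xs)) ≤-refl ≤-refl (s≤s z≤n)
           (count-input (x ∷ xs)) (≤-reflexive (cong (_+ ops (suc (length xs)) P) (length-map cellOf (x ∷ xs))))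
  ... | outcome b (y ∷ ys) u der u≤ c≡ k≡ l≤ ne with whole {room (suc (length xs))} der T (≤-trans fits le)
    where
    N = suc (length xs)
    ys≤ : length ys ≤ room N
    ys≤ = ≤-trans (n≤1+n _) (≤-trans l≤ (+-mono-≤ (≤-reflexive (length-map cellOf (x ∷ xs))) u≤))
    fits : (3 + (length xs + length xs)) + (u * suc (room N + room N) + (3 + (length ys + length ys))) ≤ time N
    fits = +-mono-≤ (+-monoʳ-≤ 3 (+-mono-≤ (n≤1+n (length xs)) (n≤1+n (length xs))))
             (+-mono-≤ (*-monoˡ-≤ (suc (room N + room N)) u≤) (+-monoʳ-≤ 3 (+-mono-≤ ys≤ ys≤)))
  ... | final , runs , out≡ = final , runs , trans out≡ (cong (λ zs → readBinary zs 0)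
          (trans (map-∘ (y ∷ ys)) (cong (map out) (trans c≡ (cong (λ w → proj₂ (exec (suc (length xs)) P (f₀ , w)))
            (sym (map-∘ (x ∷ xs))))))))

-- Booleans

bool-ext : ∀ {a b : Bool} → (a ≡ true → b ≡ true) → (b ≡ true → a ≡ true) → a ≡ b
bool-ext {false} {false} f g = refl
bool-ext {false} {true}  f g = g refl
bool-ext {true}  {false} f g = sym (f refl)
bool-ext {true}  {true}  f g = refl

true≢false : true ≡ false → ⊥
true≢false ()

∧-true : ∀ {a b} → a ≡ true → b ≡ true → a ∧ b ≡ true
∧-true refl refl = refl

∧-true⁻ : ∀ {a b} → a ∧ b ≡ true → a ≡ true × b ≡ true
∧-true⁻ {true} {true} _ = refl , refl

∨-true⁻ : ∀ {a b} → a ∨ b ≡ true → a ≡ true ⊎ b ≡ true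
∨-true⁻ {true}  _ = inj₁ refl
∨-true⁻ {false} e = inj₂ e

≡ᵇ-true : ∀ {m n} → m ≡ n → (m ≡ᵇ n) ≡ true
≡ᵇ-true {m} {n} e = Equivalence.to T-≡ (≡⇒≡ᵇ m n e)

≡ᵇ-true⁻ : ∀ {m n} → (m ≡ᵇ n) ≡ true → m ≡ n
≡ᵇ-true⁻ {m} {n} e = ≡ᵇ⇒≡ m n (Equivalence.from T-≡ e)

<ᵇ-true : ∀ {m n} → m < n → (m <ᵇ n) ≡ true
<ᵇ-true lt = Equivalence.to T-≡ (<⇒<ᵇ lt)

<ᵇ-true⁻ : ∀ {m n} → (m <ᵇ n) ≡ true → m < n
<ᵇ-true⁻ {m} {n} e = <ᵇ⇒< m n (Equivalence.from T-≡ e)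

_=?_ : ∀ {n} → Fin n → Fin n → Bool
zero  =? zero  = true
zero  =? suc j = false
suc i =? zero  = false
suc i =? suc j = i =? j

=?-refl : ∀ {n} (i : Fin n) → (i =? i) ≡ true
=?-refl zero    = refl
=?-refl (suc i) = =?-refl i

=?-sound : ∀ {n} (i j : Fin n) → (i =? j) ≡ true → i ≡ j
=?-sound zero    zero    _ = refl
=?-sound (suc i) (suc j) e = cong suc (=?-sound i j e)

allF : ∀ n → (Fin n → Bool) → Bool
allF zero    f = true
allF (suc n) f = f zero ∧ allF n (λ i → f (suc i))

allF-true : ∀ n {f : Fin n → Bool} → (∀ i → f i ≡ true) → allF n f ≡ true
allF-true zero    h = refl
allF-true (suc n) h = ∧-true (h zero) (allF-true n (λ i → h (suc i)))

allF-true⁻ : ∀ n {f : Fin n → Bool} → allF n f ≡ true → ∀ i → f i ≡ true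
allF-true⁻ (suc n) e zero    = proj₁ (∧-true⁻ e)
allF-true⁻ (suc n) e (suc i) = allF-true⁻ n (proj₂ (∧-true⁻ e)) i

-- Random access by a sweep: `m` matches the single address `t`, so the disjunction over all cells
-- reads the bit stored there.
any-unique : ∀ {A : Set} {t : A} {m s q : A → Bool} {xs : List A} → t ∈ xs → m t ≡ true →
  (∀ a → a ∈ xs → m a ≡ true → a ≡ t) → (∀ a → q a ≡ m a ∧ s a) → any q xs ≡ s t
any-unique {A} {t} {m} {s} {q} {xs} t∈ mt uniq qms = bool-ext (λ e → to xs (λ _ a∈ → a∈) e) (λ e → back xs t∈ e)
  where
  to : ∀ ys → (∀ a → a ∈ ys → a ∈ xs) → any q ys ≡ true → s t ≡ true
  to (y ∷ ys) sub e with ∨-true⁻ {q y} e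
  ... | inj₂ e' = to ys (λ a a∈ → sub a (there a∈)) e'
  ... | inj₁ e' with ∧-true⁻ (trans (sym (qms y)) e')
  ...   | my , sy = subst (λ z → s z ≡ true) (uniq y (sub y (here refl)) my) sy
  back : ∀ ys → t ∈ ys → s t ≡ true → any q ys ≡ true
  back (y ∷ ys) (here refl) e rewrite qms t | mt | e = refl
  back (y ∷ ys) (there p)   e with q y
  ... | true  = refl
  ... | false = back ys p e

-- Words of bits indexed by a finite type

module Word {B : Set} (fin : Finite B) where

  -- Opaque from here on: cells are handled through `mk-‼` and `mk-cong`, never by unfolding the
  -- vector.
  abstract
    Word : Set
    Word = Vec Bool (size fin)

    finite-Word : Finite Word
    finite-Word = finite-Vec finite-Bool (size fin)

    _‼_ : Word → B → Bool
    w ‼ b = lookup w (enc fin b)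

    mk : (B → Bool) → Word
    mk f = tabulate (λ i → f (dec fin i))

    mk-‼ : ∀ f b → mk f ‼ b ≡ f b
    mk-‼ f b = trans (lookup∘tabulate (λ i → f (dec fin i)) (enc fin b)) (cong f (dec-enc fin b))

    mk-cong : ∀ {f g} → (∀ b → f b ≡ g b) → mk f ≡ mk g
    mk-cong h = tabulate-cong (λ i → h (dec fin i))

-- Sweeps over tuples

range : ℕ → ℕ → List ℕ
range x zero    = []
range x (suc n) = x ∷ range (suc x) n

range-∈ : ∀ x n {y} → x ≤ y → y < x + n → y ∈ range x n
range-∈ x zero    {y} le lt = ⊥-elim (<-irrefl refl (<-≤-trans lt (≤-trans (≤-reflexive (+-identityʳ x)) le)))
range-∈ x (suc n) {y} le lt with m≤n⇒m<n∨m≡n le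
... | inj₂ refl = here refl
... | inj₁ lt'  = there (range-∈ (suc x) n lt' (<-≤-trans lt (≤-reflexive (+-suc x n))))

range-< : ∀ x n → All (_< x + n) (range x n)
range-< x zero    = []
range-< x (suc n) = ≤-trans (s≤s (m≤m+n x n)) (≤-reflexive (sym (+-suc x n)))
                 ∷ All.map (λ lt → <-≤-trans lt (≤-reflexive (sym (+-suc x n)))) (range-< (suc x) n)

blocks : {A : Set} → (ℕ → List A) → List ℕ → List A
blocks f []       = []
blocks f (x ∷ xs) = f x ++ blocks f xs

blocks-∈ : ∀ {A : Set} (f : ℕ → List A) {x a} xs → x ∈ xs → a ∈ f x → a ∈ blocks f xs
blocks-∈ f (x ∷ xs) (here refl) a∈ = ∈-++⁺ˡ a∈
blocks-∈ f (x ∷ xs) (there p)   a∈ = ∈-++⁺ʳ (f x) (blocks-∈ f xs p a∈)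

blocks-All : ∀ {A : Set} {P : A → Set} {Q : ℕ → Set} (f : ℕ → List A) {xs} → All Q xs → (∀ x → Q x → All P (f x)) → All P (blocks f xs)
blocks-All f []       h = []
blocks-All f (q ∷ qs) h = AllP.++⁺ (h _ q) (blocks-All f qs h)

tuples : ℕ → ∀ n → List (Vec ℕ n)
tuples N zero    = [] ∷ []
tuples N (suc n) = blocks (λ x → map (x ∷_) (tuples N n)) (range 0 N)

tuples-∈ : ∀ N n (y : Vec ℕ n) → (∀ i → lookup y i < N) → y ∈ tuples N n
tuples-∈ N zero    []      h = here refl
tuples-∈ N (suc n) (x ∷ y) h = blocks-∈ _ (range 0 N) (range-∈ 0 N z≤n (h zero)) (∈-map⁺ (x ∷_) (tuples-∈ N n y (λ i → h (suc i))))

tuples-< : ∀ N n → All (λ y → ∀ i → lookup y i < N) (tuples N n)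
tuples-< N zero    = (λ ()) ∷ []
tuples-< N (suc n) = blocks-All _ (range-< 0 N)
  (λ x x< → AllP.map⁺ (All.map (λ { h zero → x< ; h (suc i) → h i }) (tuples-< N n)))

allZero : ∀ {n} → Vec ℕ n → Bool
allZero []      = true
allZero (x ∷ y) = (x ≡ᵇ 0) ∧ allZero y

-- In lexicographic order, these tuples open the blocks on which coordinate `i` is constant.
restZero : ∀ {n} → Fin n → Vec ℕ n → Bool
restZero zero    (x ∷ y) = allZero y
restZero (suc i) (x ∷ y) = restZero i y

range-suc-nonzero : ∀ x n → All (λ y → (y ≡ᵇ 0) ≡ false) (range (suc x) n)
range-suc-nonzero x zero    = []
range-suc-nonzero x (suc n) = refl ∷ range-suc-nonzero (suc x) n

-- Only the first tuple vanishes, so the start of a block can be recognised from the cell alone.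
tuples-first : ∀ N n → 1 ≤ N → Σ (Vec ℕ n) λ y → Σ (List (Vec ℕ n)) λ ys →
  tuples N n ≡ y ∷ ys × allZero y ≡ true × All (λ z → allZero z ≡ false) ys
tuples-first N zero pos = [] , [] , refl , refl , []
tuples-first (suc N) (suc n) pos with tuples-first (suc N) n pos
... | y , ys , e , az , nz = 0 ∷ y , map (0 ∷_) ys ++ blocks f (range 1 N)
    , cong (λ w → map (0 ∷_) w ++ blocks f (range 1 N)) e , az
    , AllP.++⁺ (AllP.map⁺ nz) (blocks-All f (range-suc-nonzero 0 N)
        (λ x x≢0 → AllP.map⁺ (All.universal (λ z → cong (_∧ allZero z) x≢0) (tuples (suc N) n))))
  where
  f : ℕ → List (Vec ℕ (suc n))
  f x = map (x ∷_) (tuples (suc N) n)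

mealy-++ : ∀ {A X Y : Set} (g : A → X → A × Y) a xs ys →
  mealy g a (xs ++ ys) ≡ (proj₁ (mealy g (proj₁ (mealy g a xs)) ys) , proj₂ (mealy g a xs) ++ proj₂ (mealy g (proj₁ (mealy g a xs)) ys))
mealy-++ g a []       ys = refl
mealy-++ g a (x ∷ xs) ys = cong (λ w → proj₁ w , proj₂ (g a x) ∷ proj₂ w) (mealy-++ g (proj₁ (g a x)) xs ys)

mealy-inv : ∀ {A X Y Z : Set} (g : A → X → A × Y) (π : A → Z) → (∀ a x → π (proj₁ (g a x)) ≡ π a) →
  ∀ a xs → π (proj₁ (mealy g a xs)) ≡ π a
mealy-inv g π h a []       = refl
mealy-inv g π h a (x ∷ xs) = trans (mealy-inv g π h (proj₁ (g a x)) xs) (h a x)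

-- A coordinate i of all tuples is compared with v; one pass in lexicographic order replaces the
-- outcome by the comparison with v + 1. At the start of each block of constant coordinate i
-- the new outcome is the old outcome of the preceding block.
module Shift {A Cell : Set} (old new : A → Bool) (g : A → Cell → A × Cell) (put : Cell → Bool → Cell) (v : ℕ) (N : ℕ) (pos : 1 ≤ N) where

  -- The conjunct `not (lookup y i ≡ᵇ 0)` deals with wrap-around: when coordinate `i` returns to 0,
  -- the preceding block belongs to another run and its outcome is irrelevant, while 0 is never a
  -- successor.
  fresh : ∀ {n} → Fin n → A → Vec ℕ n → Bool
  fresh i f y = if restZero i y then not (lookup y i ≡ᵇ 0) ∧ old f else new f

  record Shifts {n} (i : Fin n) (c : Vec ℕ n → Cell) : Set where
    field
      cell≡ : ∀ f y → proj₂ (g f (c y)) ≡ put (c y) (fresh i f y)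
      old≡  : ∀ f y → old (proj₁ (g f (c y))) ≡ (lookup y i ≡ᵇ v)
      new≡  : ∀ f y → new (proj₁ (g f (c y))) ≡ fresh i f y
  open Shifts

  Result : ∀ {n} → Fin n → (Vec ℕ n → Cell) → List (Vec ℕ n) → List Cell
  Result i c ys = map (λ y → put (c y) (lookup y i ≡ᵇ suc v)) ys

  -- Behind the first tuple of a block, the decision `w` taken there is handed on in `new`.
  inner : ∀ {n} (c : Vec ℕ (suc n) → Cell) → Shifts zero c → ∀ x w f ys → new f ≡ w → old f ≡ (x ≡ᵇ v) →
    All (λ z → allZero z ≡ false) ys →
    let r = mealy g f (map c (map (x ∷_) ys)) in
    proj₂ r ≡ map (λ y → put (c y) w) (map (x ∷_) ys) × old (proj₁ r) ≡ (x ≡ᵇ v)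
  inner c s x w f []       nf of [] = refl , of
  inner c s x w f (y ∷ ys) nf of (az ∷ nz) =
    cong₂ _∷_ (trans (cell≡ s f (x ∷ y)) (cong (put (c (x ∷ y))) fr)) (proj₁ ih) , proj₂ ih
    where
    fr : fresh zero f (x ∷ y) ≡ w
    fr = trans (cong (λ b → if b then not (x ≡ᵇ 0) ∧ old f else new f) az) nf
    ih = inner c s x w (proj₁ (g f (c (x ∷ y)))) ys (trans (new≡ s f (x ∷ y)) fr) (old≡ s f (x ∷ y)) nz

  fresh-first : ∀ x o → (x ≡ 0 ⊎ Σ ℕ λ x' → x ≡ suc x' × o ≡ (x' ≡ᵇ v)) → not (x ≡ᵇ 0) ∧ o ≡ (x ≡ᵇ suc v)
  fresh-first _ o (inj₁ refl)            = refl
  fresh-first _ o (inj₂ (x' , refl , e)) = e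

  block : ∀ {n} (c : Vec ℕ (suc n) → Cell) → Shifts zero c → ∀ x f → (x ≡ 0 ⊎ Σ ℕ λ x' → x ≡ suc x' × old f ≡ (x' ≡ᵇ v)) →
    let r = mealy g f (map c (map (x ∷_) (tuples N n))) in
    proj₂ r ≡ Result zero c (map (x ∷_) (tuples N n)) × old (proj₁ r) ≡ (x ≡ᵇ v)
  block {n} c s x f h with tuples-first N n pos
  ... | y , ys , e , az , nz rewrite e =
    trans (cong₂ _∷_ (trans (cell≡ s f (x ∷ y)) (cong (put (c (x ∷ y))) fr)) (proj₁ ih)) same , proj₂ ih
    where
    w = not (x ≡ᵇ 0) ∧ old f
    fr : fresh zero f (x ∷ y) ≡ w
    fr = cong (λ b → if b then not (x ≡ᵇ 0) ∧ old f else new f) az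
    ih = inner c s x w (proj₁ (g f (c (x ∷ y)))) ys (trans (new≡ s f (x ∷ y)) fr) (old≡ s f (x ∷ y)) nz
    w≡ : w ≡ (x ≡ᵇ suc v)
    w≡ = fresh-first x (old f) h
    same : map (λ z → put (c z) w) (map (x ∷_) (y ∷ ys)) ≡ Result zero c (map (x ∷_) (y ∷ ys))
    same = trans (sym (map-∘ (y ∷ ys))) (trans (map-cong (λ z → cong (put (c (x ∷ z))) w≡) (y ∷ ys)) (map-∘ (y ∷ ys)))

  outer : ∀ {n} (c : Vec ℕ (suc n) → Cell) → Shifts zero c → ∀ k x f → (x ≡ 0 ⊎ Σ ℕ λ x' → x ≡ suc x' × old f ≡ (x' ≡ᵇ v)) →
    let ys = blocks (λ x → map (x ∷_) (tuples N n)) (range x k) in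
    proj₂ (mealy g f (map c ys)) ≡ Result zero c ys
  outer c s zero    x f h = refl
  outer {n} c s (suc k) x f h = begin
    proj₂ (mealy g f (map c (b ++ bs)))      ≡⟨ cong (λ z → proj₂ (mealy g f z)) (map-++ c b bs) ⟩
    proj₂ (mealy g f (map c b ++ map c bs))  ≡⟨ cong proj₂ (mealy-++ g f (map c b) (map c bs)) ⟩
    proj₂ (mealy g f (map c b)) ++ proj₂ (mealy g (proj₁ (mealy g f (map c b))) (map c bs))
      ≡⟨ cong₂ _++_ (proj₁ (block c s x f h)) (outer c s k (suc x) _ (inj₂ (x , refl , proj₂ (block c s x f h)))) ⟩
    Result zero c b ++ Result zero c bs      ≡⟨ sym (map-++ _ b bs) ⟩
    Result zero c (b ++ bs)                  ∎
    where
    open ≡-Reasoning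
    b = map (x ∷_) (tuples N n)
    bs = blocks (λ x → map (x ∷_) (tuples N n)) (range (suc x) k)

  shift : ∀ {n} (i : Fin n) (c : Vec ℕ n → Cell) → Shifts i c → ∀ f →
    proj₂ (mealy g f (map c (tuples N n))) ≡ Result i c (tuples N n)
  shift zero c s f = outer c s N 0 f (inj₁ refl)
  shift {suc n} (suc i) c s f = go (range 0 N) f
    where
    open ≡-Reasoning
    sh : ∀ x → Shifts i (λ y → c (x ∷ y))
    sh x = record { cell≡ = λ f y → cell≡ s f (x ∷ y) ; old≡ = λ f y → old≡ s f (x ∷ y) ; new≡ = λ f y → new≡ s f (x ∷ y) }
    B : ℕ → List (Vec ℕ (suc n))
    B x = map (x ∷_) (tuples N n)
    one-block : ∀ x f → proj₂ (mealy g f (map c (B x))) ≡ Result (suc i) c (B x)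
    one-block x f = trans (cong (λ z → proj₂ (mealy g f z)) (sym (map-∘ (tuples N n))))
                          (trans (shift i (λ y → c (x ∷ y)) (sh x) f) (map-∘ (tuples N n)))
    go : ∀ xs f → proj₂ (mealy g f (map c (blocks B xs))) ≡ Result (suc i) c (blocks B xs)
    go []       f = refl
    go (x ∷ xs) f = begin
      proj₂ (mealy g f (map c (B x ++ blocks B xs)))      ≡⟨ cong (λ z → proj₂ (mealy g f z)) (map-++ c (B x) (blocks B xs)) ⟩
      proj₂ (mealy g f (map c (B x) ++ map c (blocks B xs)))  ≡⟨ cong proj₂ (mealy-++ g f (map c (B x)) (map c (blocks B xs))) ⟩
      proj₂ (mealy g f (map c (B x))) ++ proj₂ (mealy g (proj₁ (mealy g f (map c (B x)))) (map c (blocks B xs)))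
        ≡⟨ cong₂ _++_ (one-block x f) (go xs _) ⟩
      Result (suc i) c (B x) ++ Result (suc i) c (blocks B xs)  ≡⟨ sym (map-++ _ (B x) (blocks B xs)) ⟩
      Result (suc i) c (B x ++ blocks B xs)                     ∎

clamp : ℕ → Fin 5
clamp 0 = zero
clamp 1 = suc zero
clamp 2 = suc (suc zero)
clamp 3 = suc (suc (suc zero))
clamp _ = suc (suc (suc (suc zero)))

toℕ-clamp : ∀ {i} → i < 5 → toℕ (clamp i) ≡ i
toℕ-clamp {0} _ = refl
toℕ-clamp {1} _ = refl
toℕ-clamp {2} _ = refl
toℕ-clamp {3} _ = refl
toℕ-clamp {4} _ = refl
toℕ-clamp {suc (suc (suc (suc (suc i))))} (s≤s (s≤s (s≤s (s≤s (s≤s ())))))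

-- `res` is the value of the formula evaluated last, `old` and `new` serve the pass that increments
-- a variable, and `zs` tells which coordinates are 0 while the tuple cells are created. At the
-- start `old` also singles out the first input cell.
record Flags : Set where
  constructor flags
  field
    res old new : Bool
    zs          : Vec Bool 5
open Flags

finite-Flags : Finite Flags
finite-Flags = finite-retract
  (finite-× finite-Bool (finite-× finite-Bool (finite-× finite-Bool (finite-Vec finite-Bool 5))))
  (λ { (a , b , c , d) → flags a b c d }) (λ { (flags a b c d) → a , b , c , d }) (λ _ → refl)

-- base p is the cell of the p-th input symbol, mem x the cell of the tuple x.
data Addr : Set where
  base : ℕ → Addr
  mem  : Vec ℕ 5 → Addr

coord : Fin 5 → Addr → ℕ
coord r (base p) = p
coord r (mem x)  = lookup x r

isBase : Addr → Bool
isBase (base _) = true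
isBase (mem _)  = false

anyFrom : ℕ → ℕ → (ℕ → Bool) → Bool
anyFrom x zero    f = false
anyFrom x (suc n) f = f x ∨ anyFrom (suc x) n f

restTrue : ∀ {n} → Fin n → (Fin n → Bool) → Bool
restTrue {suc n} zero    f = allF n (λ i → f (suc i))
restTrue {suc n} (suc r) f = restTrue r (λ i → f (suc i))

allF-zero : ∀ {n} (y : Vec ℕ n) {f : Fin n → Bool} → (∀ i → f i ≡ (lookup y i ≡ᵇ 0)) → allF n f ≡ allZero y
allF-zero []      h = refl
allF-zero (x ∷ y) h = cong₂ _∧_ (h zero) (allF-zero y (λ i → h (suc i)))

restTrue-zero : ∀ {n} r (y : Vec ℕ n) {f : Fin n → Bool} → (∀ i → f i ≡ (lookup y i ≡ᵇ 0)) → restTrue r f ≡ restZero r y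
restTrue-zero zero    (x ∷ y) h = allF-zero y (λ i → h (suc i))
restTrue-zero (suc r) (x ∷ y) h = restTrue-zero r y (λ i → h (suc i))

-- Syntax, semantics and code of the first-order language

kind : Bool → Bool → Bool
kind k b = if k then b else not b

-- Kind `true` stands for relations on the input cells, which have one coordinate, kind `false` for
-- relations on tuples.
arity : Bool → ℕ
arity k = if k then 1 else 5

arity≤5 : ∀ k → arity k ≤ 5
arity≤5 true  = s≤s z≤n
arity≤5 false = ≤-refl

module Syntax (V' X : ℕ) where

  -- The first five variables name the coordinates of the element that an assignment is deciding.
  V : ℕ
  V = 5 + V'

  data Fm : Set where
    _≐_ _⋖_ : Fin V → Fin V → Fm
    _∋_     : Fin X → Vec (Fin V) 5 → Fm
    _∋ᵇ_    : Fin X → Fin V → Fm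
    ¬ᶠ_     : Fm → Fm
    _∧ᶠ_ _∨ᶠ_ : Fm → Fm → Fm
    ∃ᶠ      : Fin V → Fm → Fm

  infix 6 ¬ᶠ_
  infixr 5 _∧ᶠ_
  infixr 4 _∨ᶠ_
  infix 7 _≐_ _⋖_ _∋_ _∋ᵇ_

  -- `asg` replaces a whole relation at once, and its formula is read in the old store, so a
  -- relation may be redefined from itself; `rep` repeats N times.
  data Stm : Set where
    asg : Bool → Fin X → Fm → Stm
    _⨟_ : Stm → Stm → Stm
    rep : Stm → Stm

  infixr 3 _⨟_

  Store : Set
  Store = Fin X → Addr → Bool

  Env : Set
  Env = Fin V → ℕ

  _[_≔_] : Env → Fin V → ℕ → Env
  (ρ [ v ≔ x ]) i = if i =? v then x else ρ i

  sem : ℕ → Store → Env → Fm → Bool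
  sem N S ρ (v ≐ w)  = ρ w ≡ᵇ ρ v
  sem N S ρ (v ⋖ w)  = ρ w ≡ᵇ suc (ρ v)
  sem N S ρ (Y ∋ vs) = S Y (mem (Vec.map ρ vs))
  sem N S ρ (Y ∋ᵇ v) = S Y (base (ρ v))
  sem N S ρ (¬ᶠ φ)   = not (sem N S ρ φ)
  sem N S ρ (φ ∧ᶠ ψ) = sem N S ρ φ ∧ sem N S ρ ψ
  sem N S ρ (φ ∨ᶠ ψ) = sem N S ρ φ ∨ sem N S ρ ψ
  sem N S ρ (∃ᶠ v φ) = anyFrom 0 N (λ x → sem N S (ρ [ v ≔ x ]) φ)

  anyFrom-cong : ∀ x n {f g : ℕ → Bool} → (∀ y → f y ≡ g y) → anyFrom x n f ≡ anyFrom x n g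
  anyFrom-cong x zero    h = refl
  anyFrom-cong x (suc n) h = cong₂ _∨_ (h x) (anyFrom-cong (suc x) n h)

  sem-cong : ∀ N S {ρ σ} φ → (∀ v → ρ v ≡ σ v) → sem N S ρ φ ≡ sem N S σ φ
  sem-cong N S (v ≐ w)  h = cong₂ _≡ᵇ_ (h w) (h v)
  sem-cong N S (v ⋖ w)  h = cong₂ (λ a b → a ≡ᵇ suc b) (h w) (h v)
  sem-cong N S (Y ∋ vs) h = cong (λ x → S Y (mem x)) (Vec-map-cong h vs)
  sem-cong N S (Y ∋ᵇ v) h = cong (λ x → S Y (base x)) (h v)
  sem-cong N S (¬ᶠ φ)   h = cong not (sem-cong N S φ h)
  sem-cong N S (φ ∧ᶠ ψ) h = cong₂ _∧_ (sem-cong N S φ h) (sem-cong N S ψ h)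
  sem-cong N S (φ ∨ᶠ ψ) h = cong₂ _∨_ (sem-cong N S φ h) (sem-cong N S ψ h)
  sem-cong N S (∃ᶠ v φ) h = anyFrom-cong 0 N (λ x → sem-cong N S φ (λ i → cong (λ y → if i =? v then x else y) (h i)))

  envOf : ℕ → Addr → Env
  envOf j a v = if toℕ v <ᵇ j then coord (clamp (toℕ v)) a else 0

  -- Opaque, lest a store reached by many assignments unfold into nested formulas; `assign-≡` gives
  -- access.
  abstract
    assign : ℕ → Bool → Fin X → Fm → Store → Store
    assign N k Y φ S Z a = if (Z =? Y) ∧ kind k (isBase a) then sem N S (envOf (arity k) a) φ else S Z a

    assign-≡ : ∀ N k Y φ S Z a →
      assign N k Y φ S Z a ≡ (if (Z =? Y) ∧ kind k (isBase a) then sem N S (envOf (arity k) a) φ else S Z a)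
    assign-≡ N k Y φ S Z a = refl

  semS : ℕ → Stm → Store → Store
  semS N (asg k Y φ) S = assign N k Y φ S
  semS N (s ⨟ t)     S = semS N t (semS N s S)
  semS N (rep s)     S = iterate N (semS N s) S

  -- Binders must have increasing indices: a variable that is not in scope holds 0, and is reset to 0.
  scoped : ℕ → Fm → Bool
  scoped k (v ≐ w)  = true
  scoped k (v ⋖ w)  = true
  scoped k (Y ∋ vs) = true
  scoped k (Y ∋ᵇ v) = true
  scoped k (¬ᶠ φ)   = scoped k φ
  scoped k (φ ∧ᶠ ψ) = scoped k φ ∧ scoped k ψ
  scoped k (φ ∨ᶠ ψ) = scoped k φ ∧ scoped k ψ
  scoped k (∃ᶠ v φ) = (k ≤ᵇ toℕ v) ∧ scoped (suc (toℕ v)) φ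

  scopedS : Stm → Bool
  scopedS (asg k Y φ) = scoped (arity k) φ
  scopedS (s ⨟ t)     = scopedS s ∧ scopedS t
  scopedS (rep s)     = scopedS s

  -- All that a cell knows about its address is whether it is an input cell, which coordinates are 0
  -- and which agree with the value of a variable. Variable `zero` is a scratch register for
  -- successors, relation `zero` the buffer of an assignment.
  data Bit : Set where
    base : Bit
    zer  : Fin 5 → Bit
    mask : Fin (suc V) → Fin 5 → Bit
    rel  : Fin (suc X) → Bit

  finite-Bit : Finite Bit
  finite-Bit = finite-retract
    (finite-⊎ finite-⊤ (finite-⊎ (finite-Fin 5) (finite-⊎ (finite-× (finite-Fin (suc V)) (finite-Fin 5)) (finite-Fin (suc X)))))
    (λ { (inj₁ _) → base ; (inj₂ (inj₁ r)) → zer r ; (inj₂ (inj₂ (inj₁ (v , r)))) → mask v r ; (inj₂ (inj₂ (inj₂ Y))) → rel Y })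
    (λ { base → inj₁ tt ; (zer r) → inj₂ (inj₁ r) ; (mask v r) → inj₂ (inj₂ (inj₁ (v , r))) ; (rel Y) → inj₂ (inj₂ (inj₂ Y)) })
    (λ { base → refl ; (zer r) → refl ; (mask v r) → refl ; (rel Y) → refl })

  open Word finite-Bit public

  Code : Set
  Code = Prog Flags Word

  local : (Flags → (Bit → Bool) → Bit → Bool) → Code
  local k = sweep (λ f c → f , mk (k f (c ‼_)))

  setRes : (Bool → Bool) → Code
  setRes h = update (λ f → flags (h (res f)) (old f) (new f) (zs f))

  skip : Code
  skip = update (λ f → f)

  test : ((Bit → Bool) → Bool) → Code
  test q = setRes (λ _ → false)
         ▸ sweep (λ f c → flags (res f ∨ q (c ‼_)) (old f) (new f) (zs f) , c)

  zeroK : Fin (suc V) → Flags → (Bit → Bool) → Bit → Bool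
  zeroK v f c (mask w r) = if w =? v then c (zer r) else c (mask w r)
  zeroK v f c b          = c b

  zeroVar : Fin (suc V) → Code
  zeroVar v = local (zeroK v)

  copyK : Fin (suc V) → Flags → (Bit → Bool) → Bit → Bool
  copyK v f c (mask zero r) = c (mask v r)
  copyK v f c b             = c b

  putMask : Fin (suc V) → Fin 5 → Word → Bool → Word
  putMask v r c n = mk λ { (mask w s) → if (s =? r) ∧ (w =? v) then n else (c ‼ mask w s) ; b → c ‼ b }

  -- A mask moves one place along axis `r`, in the manner of `Shift`; every input cell is a block of
  -- its own.
  incStep : Fin (suc V) → Fin 5 → Flags → Word → Flags × Word
  incStep v r f c = flags (res f) (c ‼ mask v r) n (zs f) , putMask v r c n
    where
    n : Bool
    n = if (c ‼ base) ∨ restTrue r (λ i → c ‼ zer i) then not (c ‼ zer r) ∧ old f else new f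

  incAxis : Fin (suc V) → Fin 5 → Code
  incAxis v r = sweep (incStep v r)

  incVar : Fin (suc V) → Code
  incVar v = incAxis v (clamp 0) ▸ incAxis v (clamp 1) ▸ incAxis v (clamp 2) ▸ incAxis v (clamp 3) ▸ incAxis v (clamp 4)

  eqQ : Fin (suc V) → Fin (suc V) → (Bit → Bool) → Bool
  eqQ v w c = (c base ∧ c (mask v zero)) ∧ c (mask w zero)

  relQ : Fin X → Vec (Fin V) 5 → (Bit → Bool) → Bool
  relQ Y vs c = (not (c base) ∧ allF 5 (λ r → c (mask (suc (lookup vs r)) r))) ∧ c (rel (suc Y))

  baseQ : Fin X → Fin V → (Bit → Bool) → Bool
  baseQ Y v c = (c base ∧ c (mask (suc v) zero)) ∧ c (rel (suc Y))

  eval : Fm → Code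
  eval (v ≐ w)  = test (eqQ (suc w) (suc v))
  eval (v ⋖ w)  = local (copyK (suc v)) ▸ incVar zero ▸ test (eqQ (suc w) zero) ▸ zeroVar zero
  eval (Y ∋ vs) = test (relQ Y vs)
  eval (Y ∋ᵇ v) = test (baseQ Y v)
  eval (¬ᶠ φ)   = eval φ ▸ setRes not
  eval (φ ∧ᶠ ψ) = eval φ ▸ branch res (eval ψ) skip
  eval (φ ∨ᶠ ψ) = eval φ ▸ branch res skip (eval ψ)
  -- The search halts the variable at the first witness, idles for the remaining rounds and finally
  -- returns the variable to 0.
  eval (∃ᶠ v φ) = setRes (λ _ → false)
    ▸ loop (branch res skip (eval φ ▸ branch res skip (incVar (suc v)))) ▸ zeroVar (suc v)

  axisVar : Fin 5 → Fin V
  axisVar r = r ↑ˡ V'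

  writeK : Bool → Flags → (Bit → Bool) → Bit → Bool
  writeK k f c (rel zero) =
    if kind k (c base) ∧ allF 5 (λ r → not (toℕ r <ᵇ arity k) ∨ c (mask (suc (axisVar r)) r)) then res f else c (rel zero)
  writeK k f c b = c b

  -- Results are collected in the buffer and copied only at the end; until then the formula still
  -- sees the old relation.
  commitK : Bool → Fin X → Flags → (Bit → Bool) → Bit → Bool
  commitK k Y f c (rel (suc Z)) = if (Z =? Y) ∧ kind k (c base) then c (rel zero) else c (rel (suc Z))
  commitK k Y f c b             = c b

  -- One loop per axis variable, the formula at the bottom: it is evaluated once for each element,
  -- whose cell `writeK` finds by its masks.
  nest : Bool → Fm → ℕ → ℕ → Code
  nest k φ i zero    = eval φ ▸ local (writeK k)
  nest k φ i (suc m) = loop (nest k φ (suc i) m ▸ incVar (suc (axisVar (clamp i)))) ▸ zeroVar (suc (axisVar (clamp i)))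

  codeS : Stm → Code
  codeS (asg k Y φ) = nest k φ 0 (arity k) ▸ local (commitK k Y)
  codeS (s ⨟ t)     = codeS s ▸ codeS t
  codeS (rep s)     = loop (codeS s)

  -- A variable has one value per axis, because `incAxis` advances the axes separately. Between
  -- operations the five values agree, as in `lift`.
  Masks : Set
  Masks = Fin (suc V) → Fin 5 → ℕ

  content : (Addr → Bool) → Store → Masks → Addr → Bit → Bool
  content t S μ a base          = isBase a
  content t S μ a (zer r)       = coord r a ≡ᵇ 0
  content t S μ a (mask v r)    = coord r a ≡ᵇ μ v r
  content t S μ a (rel zero)    = t a
  content t S μ a (rel (suc Y)) = S Y a

  cellAt : (Addr → Bool) → Store → Masks → Addr → Word
  cellAt t S μ a = mk (content t S μ a)

  lift : Env → Masks
  lift ρ zero    r = 0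
  lift ρ (suc v) r = ρ v

  module Correct (N : ℕ) (pos : 1 ≤ N) where

    addrs : List Addr
    addrs = map base (range 0 N) ++ map mem (tuples N 5)

    InRange : Addr → Set
    InRange a = ∀ r → coord r a < N

    addrs-InRange : All InRange addrs
    addrs-InRange = AllP.++⁺ (AllP.map⁺ (All.map (λ lt r → lt) (range-< 0 N))) (AllP.map⁺ (All.map (λ h r → h r) (tuples-< N 5)))

    base-∈ : ∀ {p} → p < N → base p ∈ addrs
    base-∈ lt = ∈-++⁺ˡ (∈-map⁺ base (range-∈ 0 N z≤n lt))

    mem-∈ : ∀ {x} → (∀ r → lookup x r < N) → mem x ∈ addrs
    mem-∈ {x} h = ∈-++⁺ʳ (map base (range 0 N)) (∈-map⁺ mem (tuples-∈ N 5 x h))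

    tape : (Addr → Bool) → Store → Masks → List Word
    tape t S μ = map (cellAt t S μ) addrs

    tape-cong : ∀ {t t' S S' μ μ'} → (∀ a → InRange a → ∀ b → content t S μ a b ≡ content t' S' μ' a b) → tape t S μ ≡ tape t' S' μ'
    tape-cong h = map-cong-local (All.map (λ {a} r → mk-cong (h a r)) addrs-InRange)

    tape-cong-μ : ∀ {t S μ μ'} → (∀ v r → μ v r ≡ μ' v r) → tape t S μ ≡ tape t S μ'
    tape-cong-μ {t} {S} {μ} {μ'} h = tape-cong {t} {t} {S} {S} (λ { a _ base → refl ; a _ (zer r) → refl ; a _ (mask v r) → cong (coord r a ≡ᵇ_) (h v r)
                                 ; a _ (rel zero) → refl ; a _ (rel (suc Y)) → refl })

    record Runs (p : Code) (f : Flags) (τ τ' : List Word) (P : Flags → Set) : Set where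
      constructor runs
      field
        final : Flags
        exec≡ : exec N p (f , τ) ≡ (final , τ')
        post  : P final

    mealy-dep : ∀ {A B C : Set} (f : A) (h : A → B → C) xs → mealy (λ a x → a , h a x) f xs ≡ (f , map (h f) xs)
    mealy-dep f h []       = refl
    mealy-dep f h (x ∷ xs) = cong (λ w → proj₁ w , h f x ∷ proj₂ w) (mealy-dep f h xs)

    exec-local : ∀ {t t' S S' μ μ'} k f →
      (∀ a → InRange a → ∀ b → k f (cellAt t S μ a ‼_) b ≡ content t' S' μ' a b) →
      Runs (local k) f (tape t S μ) (tape t' S' μ') (_≡ f)
    exec-local {t} {t'} {S} {S'} {μ} {μ'} k f h = runs f eq refl
      where
      eq : exec N (local k) (f , tape t S μ) ≡ (f , tape t' S' μ')
      eq = trans (mealy-dep f (λ f c → mk (k f (c ‼_))) (tape t S μ))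
        (cong (f ,_) (trans (sym (map-∘ addrs)) (map-cong-local (All.map (λ {a} r → mk-cong (h a r)) addrs-InRange))))

    exec-test : ∀ {t S μ} q f (q' : Addr → Bool) → (∀ a → q (cellAt t S μ a ‼_) ≡ q' a) →
      Runs (test q) f (tape t S μ) (tape t S μ) (λ f' → res f' ≡ any q' addrs)
    exec-test {t} {S} {μ} q f q' h = let (f' , e , r) = go addrs (flags false (old f) (new f) (zs f)) in runs f' e r
      where
      g : Flags → Word → Flags × Word
      g f c = flags (res f ∨ q (c ‼_)) (old f) (new f) (zs f) , c
      go : ∀ as f → Σ Flags λ f' → mealy g f (map (cellAt t S μ) as) ≡ (f' , map (cellAt t S μ) as) × res f' ≡ res f ∨ any q' as
      go []       f = f , refl , sym (∨-identityʳ (res f))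
      go (a ∷ as) f with go as (proj₁ (g f (cellAt t S μ a)))
      ... | f' , e , r = f' , cong (λ w → proj₁ w , cellAt t S μ a ∷ proj₂ w) e
          , trans r (trans (∨-assoc (res f) _ _) (cong (λ b → res f ∨ (b ∨ any q' as)) (h a)))

    setμ : Fin (suc V) → ℕ → Masks → Masks
    setμ v x μ w r = if w =? v then x else μ w r

    exec-zeroVar : ∀ {t S μ} v f → Runs (zeroVar v) f (tape t S μ) (tape t S (setμ v 0 μ)) (_≡ f)
    exec-zeroVar {t} {S} {μ} v f = exec-local {t} {t} {S} {S} {μ} {setμ v 0 μ} (zeroK v) f ok
      where
      ok : ∀ a → InRange a → ∀ b → zeroK v f (cellAt t S μ a ‼_) b ≡ content t S (setμ v 0 μ) a b
      ok a _ base    = mk-‼ (content t S μ a) base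
      ok a _ (zer r) = mk-‼ (content t S μ a) (zer r)
      ok a _ (mask w r) with w =? v
      ... | true  = mk-‼ (content t S μ a) (zer r)
      ... | false = mk-‼ (content t S μ a) (mask w r)
      ok a _ (rel zero)    = mk-‼ (content t S μ a) (rel zero)
      ok a _ (rel (suc Y)) = mk-‼ (content t S μ a) (rel (suc Y))

    copyμ : Fin (suc V) → Masks → Masks
    copyμ v μ zero    r = μ v r
    copyμ v μ (suc w) r = μ (suc w) r

    exec-copy : ∀ {t S μ} v f → Runs (local (copyK v)) f (tape t S μ) (tape t S (copyμ v μ)) (_≡ f)
    exec-copy {t} {S} {μ} v f = exec-local {t} {t} {S} {S} {μ} {copyμ v μ} (copyK v) f ok
      where
      ok : ∀ a → InRange a → ∀ b → copyK v f (cellAt t S μ a ‼_) b ≡ content t S (copyμ v μ) a b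
      ok a _ base             = mk-‼ (content t S μ a) base
      ok a _ (zer r)          = mk-‼ (content t S μ a) (zer r)
      ok a _ (mask zero r)    = mk-‼ (content t S μ a) (mask v r)
      ok a _ (mask (suc w) r) = mk-‼ (content t S μ a) (mask (suc w) r)
      ok a _ (rel zero)       = mk-‼ (content t S μ a) (rel zero)
      ok a _ (rel (suc Y))    = mk-‼ (content t S μ a) (rel (suc Y))

    bump : Fin (suc V) → Fin 5 → Masks → Masks
    bump v r μ w s = if (s =? r) ∧ (w =? v) then suc (μ w s) else μ w s

    map-singletons : ∀ {A : Set} (c : Vec ℕ 1 → A) xs → map c (blocks (λ x → map (x ∷_) ([] ∷ [])) xs) ≡ map (λ x → c (x ∷ [])) xs
    map-singletons c []       = refl
    map-singletons c (x ∷ xs) = cong (c (x ∷ []) ∷_) (map-singletons c xs)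

    -- Input cells are treated as 1-tuples. The flags they leave behind do no harm to the tuples:
    -- the first tuple is zero, so its new bit is `false` whatever `old` is.
    exec-incAxis : ∀ {t S μ} v r f →
      Runs (incAxis v r) f (tape t S μ) (tape t S (bump v r μ)) (λ f' → res f' ≡ res f)
    exec-incAxis {t} {S} {μ} v r f = runs (proj₁ (mealy g f (tape t S μ))) (cong (proj₁ (mealy g f (tape t S μ)) ,_) eq)
                                          (mealy-inv g res (λ _ _ → refl) f (tape t S μ))
      where
      open Shift old new (incStep v r) (putMask v r) (μ v r) N pos
      open ≡-Reasoning
      g = incStep v r
      C = cellAt t S μ
      start : ∀ a → Bool
      start a = (C a ‼ base) ∨ restTrue r (λ i → C a ‼ zer i)
      shiftsBase : Shifts {1} zero (λ y → C (base (Vec.head y)))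
      shiftsBase = record
        { cell≡ = λ { f (p ∷ []) → cong (putMask v r (C (base p))) (fr f p) }
        ; old≡  = λ { f (p ∷ []) → mk-‼ (content t S μ (base p)) (mask v r) }
        ; new≡  = λ { f (p ∷ []) → fr f p } }
        where
        fr : ∀ f p → (if start (base p) then not (C (base p) ‼ zer r) ∧ old f else new f) ≡ fresh zero f (p ∷ [])
        fr f p rewrite mk-‼ (content t S μ (base p)) base | mk-‼ (content t S μ (base p)) (zer r) = refl
      shiftsMem : Shifts {5} r (λ y → C (mem y))
      shiftsMem = record
        { cell≡ = λ f y → cong (putMask v r (C (mem y))) (fr f y)
        ; old≡  = λ f y → mk-‼ (content t S μ (mem y)) (mask v r)
        ; new≡  = fr }
        where
        fr : ∀ f y → (if start (mem y) then not (C (mem y) ‼ zer r) ∧ old f else new f) ≡ fresh r f y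
        fr f y rewrite mk-‼ (content t S μ (mem y)) base | mk-‼ (content t S μ (mem y)) (zer r)
                     | restTrue-zero r y (λ i → mk-‼ (content t S μ (mem y)) (zer i)) = refl
      put≡ : ∀ a → putMask v r (C a) (coord r a ≡ᵇ suc (μ v r)) ≡ cellAt t S (bump v r μ) a
      put≡ a = mk-cong λ { base → mk-‼ (content t S μ a) base ; (zer s) → mk-‼ (content t S μ a) (zer s)
                         ; (rel zero) → mk-‼ (content t S μ a) (rel zero) ; (rel (suc Y)) → mk-‼ (content t S μ a) (rel (suc Y))
                         ; (mask w s) → aux w s }
        where
        aux : ∀ w s → (if (s =? r) ∧ (w =? v) then (coord r a ≡ᵇ suc (μ v r)) else (C a ‼ mask w s)) ≡ (coord s a ≡ᵇ bump v r μ w s)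
        aux w s with s =? r in e₁ | w =? v in e₂
        ... | true  | true rewrite =?-sound s r e₁ | =?-sound w v e₂ = refl
        ... | true  | false = mk-‼ (content t S μ a) (mask w s)
        ... | false | true  = mk-‼ (content t S μ a) (mask w s)
        ... | false | false = mk-‼ (content t S μ a) (mask w s)
      bs = range 0 N
      ts = tuples N 5
      basePart : ∀ f → proj₂ (mealy g f (map C (map base bs))) ≡ map (cellAt t S (bump v r μ)) (map base bs)
      basePart f = begin
        proj₂ (mealy g f (map C (map base bs)))  ≡⟨ cong (λ z → proj₂ (mealy g f z)) (trans (sym (map-∘ bs)) (sym (map-singletons _ bs))) ⟩
        proj₂ (mealy g f (map (λ y → C (base (Vec.head y))) (tuples N 1)))  ≡⟨ shift zero _ shiftsBase f ⟩
        map (λ y → putMask v r (C (base (Vec.head y))) (lookup y zero ≡ᵇ suc (μ v r))) (tuples N 1)  ≡⟨ map-singletons _ bs ⟩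
        map (λ p → putMask v r (C (base p)) (p ≡ᵇ suc (μ v r))) bs  ≡⟨ map-cong (λ p → put≡ (base p)) bs ⟩
        map (λ p → cellAt t S (bump v r μ) (base p)) bs  ≡⟨ map-∘ bs ⟩
        map (cellAt t S (bump v r μ)) (map base bs)  ∎
      memPart : ∀ f → proj₂ (mealy g f (map C (map mem ts))) ≡ map (cellAt t S (bump v r μ)) (map mem ts)
      memPart f = begin
        proj₂ (mealy g f (map C (map mem ts)))  ≡⟨ cong (λ z → proj₂ (mealy g f z)) (sym (map-∘ ts)) ⟩
        proj₂ (mealy g f (map (λ y → C (mem y)) ts))  ≡⟨ shift r _ shiftsMem f ⟩
        map (λ y → putMask v r (C (mem y)) (lookup y r ≡ᵇ suc (μ v r))) ts  ≡⟨ map-cong (λ y → put≡ (mem y)) ts ⟩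
        map (λ y → cellAt t S (bump v r μ) (mem y)) ts  ≡⟨ map-∘ ts ⟩
        map (cellAt t S (bump v r μ)) (map mem ts)  ∎
      eq : proj₂ (mealy g f (tape t S μ)) ≡ tape t S (bump v r μ)
      eq = begin
        proj₂ (mealy g f (map C (map base bs ++ map mem ts)))  ≡⟨ cong (λ z → proj₂ (mealy g f z)) (map-++ C (map base bs) (map mem ts)) ⟩
        proj₂ (mealy g f (map C (map base bs) ++ map C (map mem ts)))  ≡⟨ cong proj₂ (mealy-++ g f (map C (map base bs)) _) ⟩
        proj₂ (mealy g f (map C (map base bs))) ++ proj₂ (mealy g (proj₁ (mealy g f (map C (map base bs)))) (map C (map mem ts)))
          ≡⟨ cong₂ _++_ (basePart f) (memPart _) ⟩
        map (cellAt t S (bump v r μ)) (map base bs) ++ map (cellAt t S (bump v r μ)) (map mem ts)  ≡⟨ sym (map-++ _ (map base bs) _) ⟩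
        tape t S (bump v r μ)  ∎

-- Correctness of the evaluation of formulas

module Eval (V' X N : ℕ) (pos : 1 ≤ N) where

  open Syntax V' X
  open Correct N pos
  open Runs

  runs-▸ : ∀ {p q f τ₁ τ₂ τ₃ P Q} → Runs p f τ₁ τ₂ P → (∀ f' → P f' → Runs q f' τ₂ τ₃ Q) → Runs (p ▸ q) f τ₁ τ₃ Q
  runs-▸ {q = q} r k = let r' = k (final r) (post r) in
    runs (final r') (trans (cong (exec N q) (exec≡ r)) (exec≡ r')) (post r')

  runs-to : ∀ {p f τ τ₁ τ₂ P} → τ₁ ≡ τ₂ → Runs p f τ τ₁ P → Runs p f τ τ₂ P
  runs-to refl r = r

  runs-post : ∀ {p f τ τ' P Q} → (∀ {f'} → P f' → Q f') → Runs p f τ τ' P → Runs p f τ τ' Q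
  runs-post h (runs f' e p) = runs f' e (h p)

  runs-skip : ∀ {f τ} → Runs skip f τ τ (_≡ f)
  runs-skip = runs _ refl refl

  runs-setRes : ∀ {f τ} h → Runs (setRes h) f τ τ (λ f' → res f' ≡ h (res f))
  runs-setRes h = runs _ refl refl

  runs-branch : ∀ {p q f τ τ' P} → (res f ≡ true → Runs p f τ τ' P) → (res f ≡ false → Runs q f τ τ' P) →
    Runs (branch res p q) f τ τ' P
  runs-branch {f = flags true _ _ _}  h k = let r = h refl in runs (final r) (exec≡ r) (post r)
  runs-branch {f = flags false _ _ _} h k = let r = k refl in runs (final r) (exec≡ r) (post r)

  record Iterates (n : ℕ) (p : Code) (f : Flags) (τ τ' : List Word) (P : Flags → Set) : Set where
    constructor iterates
    field
      final : Flags
      iter≡ : iterate n (exec N p) (f , τ) ≡ (final , τ')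
      post  : P final

  runs-loop : ∀ {p f τ τ' P} → Iterates N p f τ τ' P → Runs (loop p) f τ τ' P
  runs-loop (iterates f' e q) = runs f' e q

  iterates-zero : ∀ {p f τ P} → P f → Iterates 0 p f τ τ P
  iterates-zero q = iterates _ refl q

  iterates-suc : ∀ {n p f τ₁ τ₂ τ₃ P Q} → Runs p f τ₁ τ₂ P → (∀ f' → P f' → Iterates n p f' τ₂ τ₃ Q) → Iterates (suc n) p f τ₁ τ₃ Q
  iterates-suc {n} {p} r k = let i = k (final r) (post r) in
    iterates (Iterates.final i) (trans (cong (iterate n (exec N p)) (exec≡ r)) (Iterates.iter≡ i)) (Iterates.post i)

  increment : Fin (suc V) → Masks → Masks
  increment v μ w r = if w =? v then suc (μ w r) else μ w r

  exec-incVar : ∀ {t S μ} v f → Runs (incVar v) f (tape t S μ) (tape t S (increment v μ)) (λ f' → res f' ≡ res f)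
  exec-incVar {t} {S} {μ} v f = runs-to {p = incVar v} (tape-cong-μ {t} {S} pointwise)
    (runs-▸ (exec-incAxis v (clamp 0) f) λ f₁ e₁ →
     runs-▸ (exec-incAxis v (clamp 1) f₁) λ f₂ e₂ →
     runs-▸ (exec-incAxis v (clamp 2) f₂) λ f₃ e₃ →
     runs-▸ (exec-incAxis v (clamp 3) f₃) λ f₄ e₄ →
     runs-post (λ e₅ → trans e₅ (trans e₄ (trans e₃ (trans e₂ e₁)))) (exec-incAxis v (clamp 4) f₄))
    where
    pointwise : ∀ w r → bump v (clamp 4) (bump v (clamp 3) (bump v (clamp 2) (bump v (clamp 1) (bump v (clamp 0) μ)))) w r ≡ increment v μ w r
    pointwise w zero                         = refl
    pointwise w (suc zero)                   = refl
    pointwise w (suc (suc zero))             = refl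
    pointwise w (suc (suc (suc zero)))       = refl
    pointwise w (suc (suc (suc (suc zero)))) = refl

  lift-set : ∀ ρ v x w r → setμ (suc v) x (lift ρ) w r ≡ lift (ρ [ v ≔ x ]) w r
  lift-set ρ v x zero    r = refl
  lift-set ρ v x (suc w) r = refl

  τ : (Addr → Bool) → Store → Env → List Word
  τ t S ρ = tape t S (lift ρ)

  τ-cong : ∀ {t S ρ σ} → (∀ v → ρ v ≡ σ v) → τ t S ρ ≡ τ t S σ
  τ-cong {t} {S} h = tape-cong-μ {t} {S} λ { zero r → refl ; (suc v) r → h v }

  zero-env : ∀ {t S ρ} v f → Runs (zeroVar (suc v)) f (τ t S ρ) (τ t S (ρ [ v ≔ 0 ])) (_≡ f)
  zero-env {t} {S} {ρ} v f = runs-to (tape-cong-μ {t} {S} (lift-set ρ v 0)) (exec-zeroVar {t} {S} (suc v) f)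

  inc-env : ∀ {t S ρ} v x f → Runs (incVar (suc v)) f (τ t S (ρ [ v ≔ x ])) (τ t S (ρ [ v ≔ suc x ])) (λ f' → res f' ≡ res f)
  inc-env {t} {S} {ρ} v x f = runs-to {p = incVar (suc v)} (tape-cong-μ {t} {S} pointwise) (exec-incVar {t} {S} (suc v) f)
    where
    pointwise : ∀ w r → increment (suc v) (lift (ρ [ v ≔ x ])) w r ≡ lift (ρ [ v ≔ suc x ]) w r
    pointwise zero    r = refl
    pointwise (suc w) r with w =? v
    ... | true  = refl
    ... | false = refl

  set-set : ∀ ρ v x → ρ v ≡ 0 → ∀ w → ((ρ [ v ≔ x ]) [ v ≔ 0 ]) w ≡ ρ w
  set-set ρ v x z w with w =? v in e
  ... | true rewrite =?-sound w v e = sym z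
  ... | false = refl

  set-0 : ∀ ρ v → ρ v ≡ 0 → ∀ w → ρ w ≡ (ρ [ v ≔ 0 ]) w
  set-0 ρ v z w with w =? v in e
  ... | true rewrite =?-sound w v e = z
  ... | false = refl

  -- Variables out of scope hold 0: a search relies on this at its start and restores it at its end.
  record Fits (k : ℕ) (ρ : Env) : Set where
    constructor fits
    field
      bounded : ∀ v → ρ v < N
      unset   : ∀ v → k ≤ toℕ v → ρ v ≡ 0
  open Fits

  fits-set : ∀ {k ρ} v x → k ≤ toℕ v → x < N → Fits k ρ → Fits (suc (toℕ v)) (ρ [ v ≔ x ])
  fits-set {k} {ρ} v x k≤v x< F = fits b u
    where
    b : ∀ w → (ρ [ v ≔ x ]) w < N
    b w with w =? v
    ... | true  = x<
    ... | false = bounded F w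
    u : ∀ w → suc (toℕ v) ≤ toℕ w → (ρ [ v ≔ x ]) w ≡ 0
    u w lt with w =? v in e
    ... | true rewrite =?-sound w v e = ⊥-elim (<-irrefl refl lt)
    ... | false = unset F w (≤-trans k≤v (<⇒≤ lt))

  content-lookup : ∀ t S μ a b → cellAt t S μ a ‼ b ≡ content t S μ a b
  content-lookup t S μ a b = mk-‼ (content t S μ a) b

  exec-eq : ∀ {t S μ} v w f x → x < N → (∀ r → μ v r ≡ x) →
    Runs (test (eqQ v w)) f (tape t S μ) (tape t S μ) (λ f' → res f' ≡ (x ≡ᵇ μ w zero))
  exec-eq {t} {S} {μ} v w f x x< h = runs-post
    (λ r → trans r (any-unique {t = base x} {m = λ a → isBase a ∧ (coord zero a ≡ᵇ μ v zero)}
            {s = λ a → coord zero a ≡ᵇ μ w zero} (base-∈ x<) (≡ᵇ-true (sym (h zero)))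
            (λ { (base p) _ e → cong base (trans (≡ᵇ-true⁻ e) (h zero)) }) (λ _ → refl)))
    (exec-test {t} {S} {μ} (eqQ v w) f (λ a → (isBase a ∧ (coord zero a ≡ᵇ μ v zero)) ∧ (coord zero a ≡ᵇ μ w zero))
       (λ a → cong₂ _∧_ (cong₂ _∧_ (L a base) (L a (mask v zero))) (L a (mask w zero))))
    where L = content-lookup t S μ

  Vec-ext : ∀ {n} {x y : Vec ℕ n} → (∀ i → lookup x i ≡ lookup y i) → x ≡ y
  Vec-ext {x = []}    {[]}    h = refl
  Vec-ext {x = a ∷ x} {b ∷ y} h = cong₂ _∷_ (h zero) (Vec-ext (λ i → h (suc i)))

  allF-cong : ∀ n {f g : Fin n → Bool} → (∀ i → f i ≡ g i) → allF n f ≡ allF n g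
  allF-cong zero    h = refl
  allF-cong (suc n) h = cong₂ _∧_ (h zero) (allF-cong n (λ i → h (suc i)))

  eval-correct : ∀ {t S} φ k ρ f → T (scoped k φ) → Fits k ρ →
    Runs (eval φ) f (τ t S ρ) (τ t S ρ) (λ f' → res f' ≡ sem N S ρ φ)

  search : Fm → Fin V → Code
  search φ v = branch res skip (eval φ ▸ branch res skip (incVar (suc v)))

  -- Where a search leaves the variable. Without a witness it stops at `x + n`, which in `exists` is
  -- N, a value that matches no cell until it is reset.
  firstFrom : ℕ → ℕ → (ℕ → Bool) → ℕ
  firstFrom x zero    p = x
  firstFrom x (suc n) p = if p x then x else firstFrom (suc x) n p

  exists : ∀ {t S} φ k v ρ → T (scoped (suc (toℕ v)) φ) → k ≤ toℕ v → Fits k ρ → ∀ n x f → x + n ≡ N → res f ≡ false →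
    let p = λ x → sem N S (ρ [ v ≔ x ]) φ in
    Iterates n (search φ v) f (τ t S (ρ [ v ≔ x ])) (τ t S (ρ [ v ≔ firstFrom x n p ])) (λ f' → res f' ≡ anyFrom x n p)

  eval-correct {t} {S} (v ≐ w) k ρ f _ F = exec-eq {t} {S} {lift ρ} (suc w) (suc v) f (ρ w) (bounded F w) (λ _ → refl)
  eval-correct {t} {S} (v ⋖ w) k ρ f _ F =
    runs-▸ (exec-copy {t} {S} (suc v) f) λ f₁ _ →
    runs-▸ (exec-incVar {t} {S} zero f₁) λ f₂ _ →
    runs-▸ (exec-eq {t} {S} (suc w) zero f₂ (ρ w) (bounded F w) (λ _ → refl)) λ f₃ e →
    runs-post (λ { refl → e }) (runs-to (tape-cong-μ {t} {S} (λ { zero r → refl ; (suc _) r → refl })) (exec-zeroVar {t} {S} zero f₃))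
  eval-correct {t} {S} (Y ∋ vs) k ρ f _ F = runs-post
    (λ r → trans r (any-unique {t = mem (Vec.map ρ vs)}
            {m = λ a → not (isBase a) ∧ allF 5 (λ r → coord r a ≡ᵇ ρ (lookup vs r))} {s = S Y}
            (mem-∈ (λ r → ≤-trans (≤-reflexive (cong suc (lookup-map r ρ vs))) (bounded F (lookup vs r))))
            (allF-true 5 (λ r → ≡ᵇ-true (lookup-map r ρ vs)))
            (λ { (mem x) _ e → cong mem (Vec-ext (λ r → trans (≡ᵇ-true⁻ (allF-true⁻ 5 {λ r → lookup x r ≡ᵇ ρ (lookup vs r)} e r)) (sym (lookup-map r ρ vs)))) }) (λ _ → refl)))
    (exec-test {t} {S} {lift ρ} (relQ Y vs) f (λ a → (not (isBase a) ∧ allF 5 (λ r → coord r a ≡ᵇ ρ (lookup vs r))) ∧ S Y a)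
        (λ a → cong₂ _∧_ (cong₂ _∧_ (cong not (L a base)) (allF-cong 5 (λ r → L a (mask (suc (lookup vs r)) r)))) (L a (rel (suc Y)))))
    where L = content-lookup t S (lift ρ)
  eval-correct {t} {S} (Y ∋ᵇ v) k ρ f _ F = runs-post
    (λ r → trans r (any-unique {t = base (ρ v)} {m = λ a → isBase a ∧ (coord zero a ≡ᵇ ρ v)} {s = S Y}
            (base-∈ (bounded F v)) (≡ᵇ-true {ρ v} refl) (λ { (base p) _ e → cong base (≡ᵇ-true⁻ e) }) (λ _ → refl)))
    (exec-test {t} {S} {lift ρ} (baseQ Y v) f (λ a → (isBase a ∧ (coord zero a ≡ᵇ ρ v)) ∧ S Y a)
        (λ a → cong₂ _∧_ (cong₂ _∧_ (L a base) (L a (mask (suc v) zero))) (L a (rel (suc Y)))))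
    where L = content-lookup t S (lift ρ)
  eval-correct (¬ᶠ φ) k ρ f sc F = runs-▸ (eval-correct φ k ρ f sc F) λ f₁ e →
    runs-post (λ e' → trans e' (cong not e)) (runs-setRes not)
  eval-correct (φ ∧ᶠ ψ) k ρ f sc F = runs-▸ (eval-correct φ k ρ f (proj₁ sc') F) λ f₁ e → runs-branch
    (λ t → runs-post (λ e' → trans e' (cong (_∧ _) (trans (sym t) e))) (eval-correct ψ k ρ f₁ (proj₂ sc') F))
    (λ t → runs-post (λ { refl → trans t (cong (_∧ _) (trans (sym t) e)) }) runs-skip)
    where
    sc' : T (scoped k φ) × T (scoped k ψ)
    sc' = Equivalence.to T-∧ sc
  eval-correct (φ ∨ᶠ ψ) k ρ f sc F = runs-▸ (eval-correct φ k ρ f (proj₁ sc') F) λ f₁ e → runs-branch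
    (λ t → runs-post (λ { refl → trans t (cong (_∨ _) (trans (sym t) e)) }) runs-skip)
    (λ t → runs-post (λ e' → trans e' (cong (_∨ _) (trans (sym t) e))) (eval-correct ψ k ρ f₁ (proj₂ sc') F))
    where
    sc' : T (scoped k φ) × T (scoped k ψ)
    sc' = Equivalence.to T-∧ sc
  eval-correct {t} {S} (∃ᶠ v φ) k ρ f sc F =
    runs-▸ (runs-setRes (λ _ → false)) λ f₁ e₁ →
    runs-▸ (runs-loop (found f₁ e₁)) λ f₂ e₂ →
    runs-post (λ { refl → e₂ }) (runs-to (τ-cong {t} {S} (set-set ρ v y ρv)) (zero-env {t} {S} {ρ [ v ≔ y ]} v f₂))
    where
    sc' : T (k ≤ᵇ toℕ v) × T (scoped (suc (toℕ v)) φ)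
    sc' = Equivalence.to T-∧ sc
    k≤v : k ≤ toℕ v
    k≤v = ≤ᵇ⇒≤ k (toℕ v) (proj₁ sc')
    ρv : ρ v ≡ 0
    ρv = unset F v k≤v
    y = firstFrom 0 N (λ x → sem N S (ρ [ v ≔ x ]) φ)
    found : ∀ f₁ → res f₁ ≡ false → Iterates N (search φ v) f₁ (τ t S ρ) (τ t S (ρ [ v ≔ y ])) (λ f' → res f' ≡ sem N S ρ (∃ᶠ v φ))
    found f₁ e₁ = subst (λ z → Iterates N (search φ v) f₁ z (τ t S (ρ [ v ≔ y ])) (λ f' → res f' ≡ sem N S ρ (∃ᶠ v φ)))
      (sym (τ-cong {t} {S} (set-0 ρ v ρv))) (exists {t} {S} φ k v ρ (proj₂ sc') k≤v F N 0 f₁ refl e₁)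

  stays : ∀ {φ v τ₀} n f → res f ≡ true → Iterates n (search φ v) f τ₀ τ₀ (λ f' → res f' ≡ true)
  stays zero    f e = iterates-zero e
  stays (suc n) f e = iterates-suc
    (runs-branch {P = λ f' → res f' ≡ true} (λ t → runs-post (λ { refl → e }) runs-skip) (λ t → ⊥-elim (true≢false (trans (sym e) t))))
    (λ f' e' → stays n f' e')

  exists {t} {S} φ k v ρ sc k≤ F zero    x f _ rf = iterates-zero rf
  exists {t} {S} φ k v ρ sc k≤ F (suc n) x f xn rf = go (p x) (eval-correct {t} {S} φ (suc (toℕ v)) (ρ [ v ≔ x ]) f sc
             (fits-set v x k≤ (≤-trans (m≤m+n (suc x) n) (≤-reflexive (trans (sym (+-suc x n)) xn))) F))
    where
    p : ℕ → Bool
    p x = sem N S (ρ [ v ≔ x ]) φ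
    advance-search : ∀ {x' P} → Runs (eval φ ▸ branch res skip (incVar (suc v))) f (τ t S (ρ [ v ≔ x ])) (τ t S (ρ [ v ≔ x' ])) P →
           Runs (search φ v) f (τ t S (ρ [ v ≔ x ])) (τ t S (ρ [ v ≔ x' ])) P
    advance-search r = runs-branch (λ t → ⊥-elim (true≢false (trans (sym t) rf))) (λ _ → r)
    go : ∀ b → Runs (eval φ) f (τ t S (ρ [ v ≔ x ])) (τ t S (ρ [ v ≔ x ])) (λ f' → res f' ≡ b) →
      Iterates (suc n) (search φ v) f (τ t S (ρ [ v ≔ x ])) (τ t S (ρ [ v ≔ (if b then x else firstFrom (suc x) n p) ]))
               (λ f' → res f' ≡ b ∨ anyFrom (suc x) n p)
    go true r = iterates-suc {P = λ f' → res f' ≡ true} (advance-search (runs-▸ r λ f₁ e →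
                    runs-branch (λ _ → runs-post (λ { refl → e }) runs-skip) (λ e' → ⊥-elim (true≢false (trans (sym e) e')))))
                    (λ f₁ e → stays n f₁ e)
    go false r = iterates-suc {P = λ f' → res f' ≡ false} (advance-search (runs-▸ r λ f₁ e →
                    runs-branch (λ e' → ⊥-elim (true≢false (trans (sym e') e))) (λ _ → runs-post (λ e' → trans e' e) (inc-env {t} {S} {ρ} v x f₁))))
                    (λ f₁ e → exists {t} {S} φ k v ρ sc k≤ F n (suc x) f₁ (trans (sym (+-suc x n)) xn) e)

-- Correctness of assignments and repetitions

if-cong : ∀ {A : Set} {b b' : Bool} {x y x' y' : A} → b ≡ b' → (b' ≡ true → x ≡ x') → y ≡ y' →
  (if b then x else y) ≡ (if b' then x' else y')
if-cong {b' = true}  refl h k = h refl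
if-cong {b' = false} refl h k = k

guard : ∀ {b e} → (b ≡ true → e ≡ true) → not b ∨ e ≡ true
guard {true}  h = h refl
guard {false} h = refl

guard⁻ : ∀ {b e} → not b ∨ e ≡ true → b ≡ true → e ≡ true
guard⁻ {true} e refl = e

<ᵇ-suc : ∀ c x → (c <ᵇ suc x) ≡ (c <ᵇ x) ∨ (c ≡ᵇ x)
<ᵇ-suc zero    zero    = refl
<ᵇ-suc zero    (suc x) = refl
<ᵇ-suc (suc c) zero    = refl
<ᵇ-suc (suc c) (suc x) = <ᵇ-suc c x

module Statements (V' X N : ℕ) (pos : 1 ≤ N) where

  open Syntax V' X
  open Correct N pos
  open Runs
  open Eval V' X N pos
  open Fits

  τ-cong-t : ∀ {t t' S S' ρ} → (∀ a → InRange a → t a ≡ t' a) → (∀ Y a → InRange a → S Y a ≡ S' Y a) → τ t S ρ ≡ τ t' S' ρ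
  τ-cong-t {t} {t'} {S} {S'} {ρ} h h' = tape-cong {t} {t'} {S} {S'} {lift ρ} {lift ρ}
    λ { a i base → refl ; a i (zer r) → refl ; a i (mask v r) → refl ; a i (rel zero) → h a i ; a i (rel (suc Y)) → h' Y a i }

  set-same : ∀ ρ v x → (ρ [ v ≔ x ]) v ≡ x
  set-same ρ v x rewrite =?-refl v = refl

  set-other : ∀ ρ v x w → w ≢ v → (ρ [ v ≔ x ]) w ≡ ρ w
  set-other ρ v x w ne with w =? v in e
  ... | true  = ⊥-elim (ne (=?-sound w v e))
  ... | false = refl

  -- The cells that the loops over the axes from `i` on will write: the outer loop variables have
  -- already fixed the first `i` coordinates.
  Wr : Bool → ℕ → Env → Addr → Bool
  Wr k i ρ a = kind k (isBase a) ∧ allF 5 (λ r → not (toℕ r <ᵇ i) ∨ (coord r a ≡ᵇ ρ (axisVar r)))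

  Wr-zero : ∀ k ρ a → Wr k 0 ρ a ≡ kind k (isBase a)
  Wr-zero k ρ a = ∧-identityʳ _

  Wr-at : ∀ {k i ρ a} → Wr k i ρ a ≡ true → ∀ r → toℕ r < i → coord r a ≡ ρ (axisVar r)
  Wr-at {k} {i} {ρ} {a} e r lt = ≡ᵇ-true⁻ (guard⁻ {toℕ r <ᵇ i} (allF-true⁻ 5 {λ r → not (toℕ r <ᵇ i) ∨ (coord r a ≡ᵇ ρ (axisVar r))} (proj₂ (∧-true⁻ {kind k (isBase a)} e)) r) (<ᵇ-true lt))

  Wr-mk : ∀ {k i ρ a} → kind k (isBase a) ≡ true → (∀ r → toℕ r < i → coord r a ≡ ρ (axisVar r)) → Wr k i ρ a ≡ true
  Wr-mk {k} {i} e h = ∧-true e (allF-true 5 (λ r → guard {toℕ r <ᵇ i} (λ lt → ≡ᵇ-true (h r (<ᵇ-true⁻ lt)))))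

  Wr-step : ∀ k i ρ x a → i < 5 → Wr k (suc i) (ρ [ axisVar (clamp i) ≔ x ]) a ≡ Wr k i ρ a ∧ (coord (clamp i) a ≡ᵇ x)
  Wr-step k i ρ x a i<5 = bool-ext
    (λ e → ∧-true (Wr-mk {k} {i} {ρ} {a} (proj₁ (∧-true⁻ e))
                    (λ r lt → trans (Wr-at {k} {suc i} {ρ₁} {a} e r (m≤n⇒m≤1+n lt)) (other r lt)))
                  (≡ᵇ-true (trans (Wr-at {k} {suc i} {ρ₁} {a} e (clamp i) (≤-reflexive (cong suc ci))) (set-same ρ (axisVar (clamp i)) x))))
    (λ e → let (w , c) = ∧-true⁻ e in Wr-mk {k} {suc i} {ρ₁} {a} (proj₁ (∧-true⁻ w)) (λ r lt → both w (≡ᵇ-true⁻ c) r (m≤n⇒m<n∨m≡n (≤-pred lt))))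
    where
    ρ₁ = ρ [ axisVar (clamp i) ≔ x ]
    ci : toℕ (clamp i) ≡ i
    ci = toℕ-clamp i<5
    other : ∀ r → toℕ r < i → ρ₁ (axisVar r) ≡ ρ (axisVar r)
    other r lt = set-other ρ (axisVar (clamp i)) x (axisVar r)
      (λ e → <⇒≢ lt (trans (cong toℕ (↑ˡ-injective V' r (clamp i) e)) ci))
    both : Wr k i ρ a ≡ true → coord (clamp i) a ≡ x → ∀ r → toℕ r < i ⊎ toℕ r ≡ i → coord r a ≡ ρ₁ (axisVar r)
    both w c r (inj₁ lt) = trans (Wr-at {k} {i} {ρ} {a} w r lt) (sym (other r lt))
    both w c r (inj₂ e) with toℕ-injective {i = r} {clamp i} (trans e (sym ci))
    ... | refl = trans c (sym (set-same ρ (axisVar (clamp i)) x))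

  -- At the cell being written the loop variables equal the coordinates and all other variables are
  -- 0, so the value computed is the one prescribed by `assign`.
  env≡ : ∀ {k ρ a} → Wr k (arity k) ρ a ≡ true → Fits (arity k) ρ → ∀ v → ρ v ≡ envOf (arity k) a v
  env≡ {k} {ρ} {a} w F v with toℕ v <ᵇ arity k in e
  ... | false = unset F v (≮⇒≥ (λ lt → true≢false (trans (sym (<ᵇ-true lt)) e)))
  ... | true  = trans (cong ρ (sym v≡)) (sym (Wr-at {k} {arity k} {ρ} {a} w (clamp (toℕ v)) (≤-trans (≤-reflexive (cong suc cv)) lt)))
    where
    lt : toℕ v < arity k
    lt = <ᵇ-true⁻ e
    cv : toℕ (clamp (toℕ v)) ≡ toℕ v
    cv = toℕ-clamp (≤-trans lt (arity≤5 k))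
    v≡ : axisVar (clamp (toℕ v)) ≡ v
    v≡ = toℕ-injective (trans (toℕ-↑ˡ (clamp (toℕ v)) V') cv)

  val : Bool → Fm → Store → Addr → Bool
  val k φ S a = sem N S (envOf (arity k) a) φ

  after : Bool → Fm → Store → ℕ → Env → (Addr → Bool) → Addr → Bool
  after k φ S i ρ t a = if Wr k i ρ a then val k φ S a else t a

  any-flags : Flags → Set
  any-flags _ = ⊤

  write-correct : ∀ {t S} k φ ρ f → Fits (arity k) ρ → res f ≡ sem N S ρ φ →
    Runs (local (writeK k)) f (τ t S ρ) (τ (after k φ S (arity k) ρ t) S ρ) (_≡ f)
  write-correct {t} {S} k φ ρ f F e = exec-local {t} {after k φ S (arity k) ρ t} {S} {S} {lift ρ} {lift ρ} (writeK k) f ok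
    where
    L = content-lookup t S (lift ρ)
    ok : ∀ a → InRange a → ∀ b → writeK k f (cellAt t S (lift ρ) a ‼_) b ≡ content (after k φ S (arity k) ρ t) S (lift ρ) a b
    ok a i base          = L a base
    ok a i (zer r)       = L a (zer r)
    ok a i (mask v r)    = L a (mask v r)
    ok a i (rel (suc Y)) = L a (rel (suc Y))
    ok a i (rel zero)    = if-cong
      (cong₂ _∧_ (cong (kind k) (L a base)) (allF-cong 5 (λ r → cong (not (toℕ r <ᵇ arity k) ∨_) (L a (mask (suc (axisVar r)) r)))))
      (λ w → trans e (sem-cong N S φ (env≡ {k} {ρ} {a} w F))) (L a (rel zero))

  -- Induction on the number `m` of axes still open. The invariant of the outermost of these loops
  -- is `tx x`: after `x` rounds the buffer is filled where that coordinate lies below `x`.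
  nest-correct : ∀ {S} k φ → T (scoped (arity k) φ) → ∀ m i → i + m ≡ arity k → ∀ t ρ f → Fits i ρ →
    Runs (nest k φ i m) f (τ t S ρ) (τ (after k φ S i ρ t) S ρ) any-flags
  nest-correct {S} k φ sc zero i im t ρ f F = body (trans (sym (+-identityʳ i)) im) F
    where
    body : i ≡ arity k → Fits i ρ → Runs (nest k φ i zero) f (τ t S ρ) (τ (after k φ S i ρ t) S ρ) any-flags
    body refl F = runs-▸ (eval-correct {t} {S} φ (arity k) ρ f sc F) λ f₁ e →
      runs-post (λ _ → tt) (write-correct {t} {S} k φ ρ f₁ F e)
  nest-correct {S} k φ sc (suc m) i im t ρ f F =
    runs-▸ (runs-loop start) λ f₁ _ →
    runs-post (λ _ → tt) (runs-to finish (zero-env {tx N} {S} {ρ [ v ≔ N ]} v f₁))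
    where
    i< : i < arity k
    i< = ≤-trans (m≤m+n (suc i) m) (≤-reflexive (trans (sym (+-suc i m)) im))
    i<5 : i < 5
    i<5 = ≤-trans i< (arity≤5 k)
    v : Fin V
    v = axisVar (clamp i)
    vi : toℕ v ≡ i
    vi = trans (toℕ-↑ˡ (clamp i) V') (toℕ-clamp i<5)
    ρv : ρ v ≡ 0
    ρv = unset F v (≤-reflexive (sym vi))
    tx : ℕ → Addr → Bool
    tx x a = if Wr k i ρ a ∧ (coord (clamp i) a <ᵇ x) then val k φ S a else t a
    cases : ∀ {A : Set} w l e {p q : A} → (if w ∧ e then p else (if w ∧ l then p else q)) ≡ (if w ∧ (l ∨ e) then p else q)
    cases false l     e     = refl
    cases true  true  true  = refl
    cases true  true  false = refl
    cases true  false true  = refl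
    cases true  false false = refl
    tx-suc : ∀ x a → after k φ S (suc i) (ρ [ v ≔ x ]) (tx x) a ≡ tx (suc x) a
    tx-suc x a = trans (cong (λ b → if b then val k φ S a else tx x a) (Wr-step k i ρ x a i<5))
      (trans (cases (Wr k i ρ a) (coord (clamp i) a <ᵇ x) (coord (clamp i) a ≡ᵇ x))
             (cong (λ b → if Wr k i ρ a ∧ b then val k φ S a else t a) (sym (<ᵇ-suc (coord (clamp i) a) x))))
    turn′ : ∀ x f → x < N → Runs (nest k φ (suc i) m ▸ incVar (suc v)) f (τ (tx x) S (ρ [ v ≔ x ])) (τ (tx (suc x)) S (ρ [ v ≔ suc x ])) any-flags
    turn′ x f x< = runs-▸
      (runs-to (τ-cong-t {ρ = ρ [ v ≔ x ]} (λ a _ → tx-suc x a) (λ _ _ _ → refl))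
        (nest-correct {S} k φ sc m (suc i) (trans (sym (+-suc i m)) im) (tx x) (ρ [ v ≔ x ]) f
           (subst (λ j → Fits (suc j) (ρ [ v ≔ x ])) vi (fits-set v x (≤-reflexive (sym vi)) x< F))))
      λ f₁ _ → runs-post (λ _ → tt) (inc-env {tx (suc x)} {S} {ρ} v x f₁)
    rounds : ∀ n x f → x + n ≡ N → Iterates n (nest k φ (suc i) m ▸ incVar (suc v)) f (τ (tx x) S (ρ [ v ≔ x ])) (τ (tx N) S (ρ [ v ≔ N ])) any-flags
    rounds zero    x f xn = subst (λ y → Iterates 0 (nest k φ (suc i) m ▸ incVar (suc v)) f (τ (tx x) S (ρ [ v ≔ x ])) (τ (tx y) S (ρ [ v ≔ y ])) any-flags)
                              (trans (sym (+-identityʳ x)) xn) (iterates-zero tt)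
    rounds (suc n) x f xn = iterates-suc (turn′ x f (≤-trans (m≤m+n (suc x) n) (≤-reflexive (trans (sym (+-suc x n)) xn))))
                              λ f₁ _ → rounds n (suc x) f₁ (trans (sym (+-suc x n)) xn)
    start : Iterates N (nest k φ (suc i) m ▸ incVar (suc v)) f (τ t S ρ) (τ (tx N) S (ρ [ v ≔ N ])) any-flags
    start = subst (λ z → Iterates N (nest k φ (suc i) m ▸ incVar (suc v)) f z (τ (tx N) S (ρ [ v ≔ N ])) any-flags)
      (sym (trans (τ-cong {t} {S} (set-0 ρ v ρv)) (τ-cong-t {ρ = ρ [ v ≔ 0 ]} (λ a _ → sym (cong (λ b → if b then val k φ S a else t a) (∧-zeroʳ (Wr k i ρ a)))) (λ _ _ _ → refl))))
      (rounds N 0 f refl)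
    finish : τ (tx N) S ((ρ [ v ≔ N ]) [ v ≔ 0 ]) ≡ τ (after k φ S i ρ t) S ρ
    finish = trans (τ-cong {tx N} {S} (set-set ρ v N ρv)) (τ-cong-t {ρ = ρ} (λ a r → cong (λ b → if b then val k φ S a else t a)
      (trans (cong (Wr k i ρ a ∧_) (<ᵇ-true (r (clamp i)))) (∧-identityʳ _))) (λ _ _ _ → refl))

  ρ₀ : Env
  ρ₀ _ = 0

  commit-correct : ∀ {t S} k Y f → Runs (local (commitK k Y)) f (τ t S ρ₀)
    (τ t (λ Z a → if (Z =? Y) ∧ kind k (isBase a) then t a else S Z a) ρ₀) (_≡ f)
  commit-correct {t} {S} k Y f = exec-local {t} {t} {S} {S'} {lift ρ₀} {lift ρ₀} (commitK k Y) f ok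
    where
    L = content-lookup t S (lift ρ₀)
    S' : Store
    S' Z a = if (Z =? Y) ∧ kind k (isBase a) then t a else S Z a
    ok : ∀ a → InRange a → ∀ b → commitK k Y f (cellAt t S (lift ρ₀) a ‼_) b ≡ content t S' (lift ρ₀) a b
    ok a i base          = L a base
    ok a i (zer r)       = L a (zer r)
    ok a i (mask v r)    = L a (mask v r)
    ok a i (rel zero)    = L a (rel zero)
    ok a i (rel (suc Z)) = if-cong (cong (λ b → (Z =? Y) ∧ kind k b) (L a base)) (λ _ → L a (rel zero)) (L a (rel (suc Z)))

  -- The buffer ends with some content `t'` that is overwritten before it is read again, so it is
  -- only asserted to exist.
  stm-correct : ∀ s → T (scopedS s) → ∀ t S → Σ (Addr → Bool) λ t' →
    ∀ f → Runs (codeS s) f (τ t S ρ₀) (τ t' (semS N s S) ρ₀) any-flags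

  rep-correct : ∀ s → T (scopedS s) → ∀ n t S → Σ (Addr → Bool) λ t' →
    ∀ f → Iterates n (codeS s) f (τ t S ρ₀) (τ t' (iterate n (semS N s) S) ρ₀) any-flags

  stm-correct (asg k Y φ) sc t S = t' , λ f →
    runs-▸ (nest-correct {S} k φ sc (arity k) 0 refl t ρ₀ f (fits (λ _ → pos) (λ _ _ → refl))) λ f₁ _ →
    runs-post (λ _ → tt) (runs-to (τ-cong-t {ρ = ρ₀} (λ _ _ → refl) (λ Z a _ → same Z a)) (commit-correct {t'} {S} k Y f₁))
    where
    t' : Addr → Bool
    t' = after k φ S 0 ρ₀ t
    same : ∀ Z a → (if (Z =? Y) ∧ kind k (isBase a) then t' a else S Z a) ≡ semS N (asg k Y φ) S Z a
    same Z a = trans (if-cong {b' = (Z =? Y) ∧ kind k (isBase a)} refl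
      (λ e → cong (λ b → if b then val k φ S a else t a) (trans (Wr-zero k ρ₀ a) (proj₂ (∧-true⁻ {Z =? Y} e)))) refl)
      (sym (assign-≡ N k Y φ S Z a))
  stm-correct (s ⨟ u) sc t S = proj₁ second , λ f → runs-▸ (proj₂ first f) λ f₁ _ → proj₂ second f₁
    where
    sc' : T (scopedS s) × T (scopedS u)
    sc' = Equivalence.to T-∧ sc
    first = stm-correct s (proj₁ sc') t S
    second = stm-correct u (proj₂ sc') (proj₁ first) (semS N s S)
  stm-correct (rep s) sc t S = proj₁ (rep-correct s sc N t S) , λ f → runs-loop (proj₂ (rep-correct s sc N t S) f)

  rep-correct s sc zero    t S = t , λ f → iterates-zero tt
  rep-correct s sc (suc n) t S = proj₁ later , λ f → iterates-suc (proj₂ first f) λ f₁ _ → proj₂ later f₁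
    where
    first = stm-correct s sc t S
    later = rep-correct s sc n (proj₁ first) (semS N s S)

-- Setting up the tape and reading off the result

nth : ∀ {A : Set} → A → List A → ℕ → A
nth d []       _       = d
nth d (x ∷ xs) zero    = x
nth d (x ∷ xs) (suc i) = nth d xs i

nthᵛ : ∀ {n} → Vec ℕ n → ℕ → ℕ
nthᵛ []      _       = 0
nthᵛ (x ∷ y) zero    = x
nthᵛ (x ∷ y) (suc i) = nthᵛ y i

nthᵛ-lookup : ∀ {n} (y : Vec ℕ n) r → nthᵛ y (toℕ r) ≡ lookup y r
nthᵛ-lookup (x ∷ y) zero    = refl
nthᵛ-lookup (x ∷ y) (suc r) = nthᵛ-lookup y r

∸-step : ∀ {i r} → i < r → r ∸ i ≡ suc (r ∸ suc i)
∸-step {zero}  {suc r} _        = refl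
∸-step {suc i} {suc r} (s≤s lt) = ∸-step lt

module Assemble (V' X : ℕ) (s : Syntax.Stm V' X) (ok : T (Syntax.scopedS V' X s))
  (initRel : Fin X → Fin 4 → Bool) (outRel : Fin X) where

  open Syntax V' X

  inputBits : Fin 4 → Bit → Bool
  inputBits a base          = true
  inputBits a (rel (suc Y)) = initRel Y a
  inputBits a _             = false

  inputCell : Fin 4 → Word
  inputCell a = mk (inputBits a)

  -- All variables start at 0, so a mask is set exactly where the coordinate is 0. Among the input
  -- cells this is the first one only.
  markBits : Bool → Word → Bit → Bool
  markBits o c (zer r)    = o
  markBits o c (mask v r) = o
  markBits o c b          = c ‼ b

  markStep : Flags → Word → Flags × Word
  markStep f c = flags (res f) false (new f) (zs f) , mk (markBits (old f) c)

  newBits : (ℕ → Bool) → Bit → Bool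
  newBits g base       = false
  newBits g (zer r)    = g (toℕ r)
  newBits g (mask v r) = g (toℕ r)
  newBits g (rel Y)    = false

  newCell : (ℕ → Bool) → Word
  newCell g = mk (newBits g)

  newCell-cong : ∀ {g h} → (∀ r → r < 5 → g r ≡ h r) → newCell g ≡ newCell h
  newCell-cong e = mk-cong λ { base → refl ; (zer r) → e (toℕ r) (toℕ<n r) ; (mask v r) → e (toℕ r) (toℕ<n r) ; (rel Y) → refl }

  setZ : ℕ → Bool → Flags → Flags
  setZ i b f = flags (res f) (old f) (new f) (setTrack i b (zs f))

  -- Coordinate `i` is 0 in the first round of its loop and never afterwards; `zs` records this, and
  -- a new cell has to know nothing else about its address.
  create : ℕ → ℕ → Code
  create i zero    = append (λ f → newCell (λ r → getTrack r (zs f)))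
  create i (suc m) = update (setZ i true) ▸ loop (create (suc i) m ▸ update (setZ i false))

  code : Code
  code = update (λ f → flags (res f) true (new f) (zs f)) ▸ sweep markStep ▸ create 0 5 ▸ codeS s

  start : Flags
  start = flags false false false (Vec.replicate 5 false)

  -- The input cells spell a number of N bits; the tuple cells print the separator, at which the
  -- reading of that number stops.
  outSym : Word → Fin 4
  outSym c = if c ‼ base then (if c ‼ rel (suc outRel) then suc (suc zero) else suc zero) else suc (suc (suc zero))

  initial-store : List (Fin 3) → Store
  initial-store xs Y (base p) = initRel Y (suc (nth zero xs p))
  initial-store xs Y (mem _)  = false

  module _ (N : ℕ) where

    -- The zero pattern of a full tuple whose first `i` coordinates are known only through the flags
    -- and whose remaining ones are `y`.
    ext : ∀ {m} → ℕ → Vec Bool 5 → Vec ℕ m → ℕ → Bool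
    ext i z y r = if r <ᵇ i then getTrack r z else (nthᵛ y (r ∸ i) ≡ᵇ 0)

    Agree : ℕ → Vec Bool 5 → Vec Bool 5 → Set
    Agree i z z' = ∀ r → r < i → getTrack r z ≡ getTrack r z'

    record Creates (i m n : ℕ) (p : Code) (f : Flags) (xs : List Word) (ys : List Word) : Set where
      constructor creates
      field
        final  : Flags
        iter≡  : iterate n (exec N p) (f , xs) ≡ (final , xs ++ ys)
        agrees : Agree i (zs final) (zs f)
    open Creates

    suc<ᵇ : ∀ r i → r < i → (r <ᵇ suc i) ≡ true
    suc<ᵇ r i lt = <ᵇ-true (m≤n⇒m≤1+n lt)

    ≮ᵇ : ∀ {r i} → i ≤ r → (r <ᵇ i) ≡ false
    ≮ᵇ {r} {i} le with r <ᵇ i in e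
    ... | true  = ⊥-elim (<⇒≱ (<ᵇ-true⁻ e) le)
    ... | false = refl

    ext-cons : ∀ {m} i z z₀ x (y : Vec ℕ m) → i < 5 → getTrack i z ≡ (x ≡ᵇ 0) → Agree i z z₀ → ∀ r → ext (suc i) z y r ≡ ext i z₀ (x ∷ y) r
    ext-cons i z z₀ x y i<5 gi ag r with <-cmp r i
    ... | tri< lt _ _ rewrite suc<ᵇ r i lt | <ᵇ-true lt = ag r lt
    ... | tri≈ _ refl _ rewrite <ᵇ-true (n<1+n r) | ≮ᵇ {r} ≤-refl | n∸n≡0 r = gi
    ... | tri> _ _ gt rewrite ≮ᵇ gt | ≮ᵇ (<⇒≤ gt) | ∸-step gt = refl

    create-correct : ∀ m i f xs → i + m ≡ 5 →
      Creates i m 1 (create i m) f xs (map (λ y → newCell (ext i (zs f) y)) (tuples N m))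
    create-correct zero i f xs im = creates f (cong (λ c → f , xs ++ c ∷ [])
        (newCell-cong (λ r lt → sym (cong (λ b → if b then getTrack r (zs f) else (0 ≡ᵇ 0)) (<ᵇ-true (≤-trans lt (≤-reflexive (trans (sym im) (+-identityʳ i)))))))))
        (λ r lt → refl)
    create-correct (suc m) i f xs im = creates (final all) (iter≡ all) (λ r lt → trans (agrees all r lt) (get-set-≢ r i true (zs f) (<⇒≢ lt)))
      where
      i<5 : i < 5
      i<5 = ≤-trans (m≤m+n (suc i) m) (≤-reflexive (trans (sym (+-suc i m)) im))
      body : Code
      body = create (suc i) m ▸ update (setZ i false)
      B : ℕ → List Word
      B x = map (λ y → newCell (ext i (zs f) y)) (map (x ∷_) (tuples N m))
      rounds : ∀ n x f₁ xs → getTrack i (zs f₁) ≡ (x ≡ᵇ 0) → Agree i (zs f₁) (zs f) →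
        Creates i m n body f₁ xs (map (λ y → newCell (ext i (zs f) y)) (blocks (λ x → map (x ∷_) (tuples N m)) (range x n)))
      rounds zero    x f₁ xs g ag = creates f₁ (cong (f₁ ,_) (sym (++-identityʳ xs))) (λ _ _ → refl)
      rounds (suc n) x f₁ xs g ag = creates (final later)
        (trans (cong (λ w → iterate n (exec N body) (setZ i false (proj₁ w) , proj₂ w)) (iter≡ now))
          (trans (cong (λ w → iterate n (exec N body) (f₂ , xs ++ w)) B≡) (trans (iter≡ later)
            (cong (final later ,_) (trans (++-assoc xs (B x) _) (cong (xs ++_) (sym (map-++ _ (map (x ∷_) (tuples N m)) _))))))))
        (λ r lt → trans (agrees later r lt) (ag₂ r lt))
        where
        now = create-correct m (suc i) f₁ xs (trans (sym (+-suc i m)) im)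
        f₂ = setZ i false (final now)
        ag₂ : Agree i (zs f₂) (zs f₁)
        ag₂ r lt = trans (get-set-≢ r i false (zs (final now)) (<⇒≢ lt)) (agrees now r (m≤n⇒m≤1+n lt))
        B≡ : map (λ y → newCell (ext (suc i) (zs f₁) y)) (tuples N m) ≡ B x
        B≡ = trans (map-cong (λ y → newCell-cong (λ r _ → ext-cons i (zs f₁) (zs f) x y i<5 g ag r)) (tuples N m)) (map-∘ (tuples N m))
        later = rounds n (suc x) f₂ (xs ++ B x) (get-set i false (zs (final now)) i<5) (λ r lt → trans (ag₂ r lt) (ag r lt))
      all = rounds N 0 (setZ i true f) xs (get-set i true (zs f) i<5) (λ r lt → get-set-≢ r i true (zs f) (<⇒≢ lt))

  readBinary-stop : ∀ {A : Set} (g : A → Bool) xs ys acc → All (_≡ suc (suc (suc zero))) ys →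
    let bit = λ a → if g a then suc (suc zero) else suc zero in
    readBinary (map bit xs ++ ys) acc ≡ readBinary (map bit xs) acc
  readBinary-stop g []       []       acc _          = refl
  readBinary-stop g []       (y ∷ ys) acc (refl ∷ _) = refl
  readBinary-stop g (x ∷ xs) ys acc h with g x
  ... | true  = readBinary-stop g xs ys _ h
  ... | false = readBinary-stop g xs ys _ h

  module _ (xs : List (Fin 3)) (N : ℕ) (len : length xs ≡ N) (pos : 1 ≤ N) where

    S₀ : Store
    S₀ = initial-store xs

    open Correct N pos
    open Eval V' X N pos
    open Statements V' X N pos

    t₀ : Addr → Bool
    t₀ _ = false

    C₀ : Addr → Word
    C₀ = cellAt t₀ S₀ (lift ρ₀)

    mark-correct : ∀ ys p f → old f ≡ (p ≡ᵇ 0) → (∀ i → nth zero xs (p + i) ≡ nth zero ys i) →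
      proj₂ (mealy markStep f (map (λ a → inputCell (suc a)) ys)) ≡ map (λ q → C₀ (base q)) (range p (length ys))
    mark-correct []       p f o h = refl
    mark-correct (y ∷ ys) p f o h = cong₂ _∷_ (mk-cong cell)
      (mark-correct ys (suc p) _ refl (λ i → trans (cong (nth zero xs) (sym (+-suc p i))) (h (suc i))))
      where
      L = mk-‼ (inputBits (suc y))
      cell : ∀ b → markBits (old f) (inputCell (suc y)) b ≡ content t₀ S₀ (lift ρ₀) (base p) b
      cell base             = L base
      cell (zer r)          = o
      cell (mask zero r)    = o
      cell (mask (suc v) r) = o
      cell (rel zero)       = L (rel zero)
      cell (rel (suc Y))    = trans (L (rel (suc Y))) (cong (λ a → initRel Y (suc a)) (sym (trans (cong (nth zero xs) (sym (+-identityʳ p))) (h 0))))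

    input-cells : List Word
    input-cells = map (λ a → inputCell (suc a)) xs

    prelude-correct : Σ Flags λ f → exec N code (start , input-cells) ≡ exec N (codeS s) (f , τ t₀ S₀ ρ₀)
    prelude-correct = final made , cong (exec N (codeS s)) (trans
      (cong (λ w → exec N (create 0 5) (f₁ , w)) (trans (mark-correct xs 0 _ refl (λ _ → refl)) (cong (λ n → map (λ q → C₀ (base q)) (range 0 n)) len)))
      (trans (iter≡ made) (cong (final made ,_) tape≡)))
      where
      open Creates
      f₁ = proj₁ (mealy markStep (flags false true false (Vec.replicate 5 false)) input-cells)
      bases = map (λ q → C₀ (base q)) (range 0 N)
      made = create-correct N 5 0 f₁ bases refl
      cell : ∀ y b → newBits (λ r → nthᵛ y r ≡ᵇ 0) b ≡ content t₀ S₀ (lift ρ₀) (mem y) b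
      cell y base             = refl
      cell y (zer r)          = cong (_≡ᵇ 0) (nthᵛ-lookup y r)
      cell y (mask zero r)    = cong (_≡ᵇ 0) (nthᵛ-lookup y r)
      cell y (mask (suc v) r) = cong (_≡ᵇ 0) (nthᵛ-lookup y r)
      cell y (rel zero)       = refl
      cell y (rel (suc Y))    = refl
      tape≡ : bases ++ map (λ y → newCell (ext N 0 (zs f₁) y)) (tuples N 5) ≡ τ t₀ S₀ ρ₀
      tape≡ = sym (trans (map-++ C₀ (map base (range 0 N)) (map mem (tuples N 5)))
        (cong₂ _++_ (sym (map-∘ (range 0 N))) (trans (sym (map-∘ (tuples N 5))) (map-cong (λ y → sym (mk-cong (cell y))) (tuples N 5)))))

    code-output : readBinary (map outSym (proj₂ (exec N code (start , input-cells)))) 0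
      ≡ readBinary (map (λ p → if semS N s S₀ outRel (base p) then suc (suc zero) else suc zero) (range 0 N)) 0
    code-output = trans (cong (λ w → readBinary (map outSym (proj₂ w)) 0) (trans (proj₂ prelude-correct) (Runs.exec≡ done)))
      (trans (cong (λ w → readBinary w 0) out≡) (readBinary-stop (λ p → S₁ outRel (base p)) (range 0 N) _ 0
        (AllP.map⁺ (AllP.map⁺ (AllP.map⁺ (All.universal (λ y → cong (λ b → if b then (if C₁ (mem y) ‼ rel (suc outRel) then suc (suc zero) else suc zero) else suc (suc (suc zero)))
          (content-lookup t₁ S₁ (lift ρ₀) (mem y) base)) (tuples N 5)))))))
      where
      t₁ = proj₁ (stm-correct s ok t₀ S₀)
      done = proj₂ (stm-correct s ok t₀ S₀) (proj₁ prelude-correct)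
      S₁ = semS N s S₀
      C₁ = cellAt t₁ S₁ (lift ρ₀)
      sym≡ : ∀ p → outSym (C₁ (base p)) ≡ (if S₁ outRel (base p) then suc (suc zero) else suc zero)
      sym≡ p = trans (cong (λ b → if b then (if C₁ (base p) ‼ rel (suc outRel) then suc (suc zero) else suc zero) else suc (suc (suc zero)))
                        (content-lookup t₁ S₁ (lift ρ₀) (base p) base))
                     (cong (λ b → if b then suc (suc zero) else suc zero) (content-lookup t₁ S₁ (lift ρ₀) (base p) (rel (suc outRel))))
      out≡ : map outSym (τ t₁ S₁ ρ₀) ≡ map (λ p → if S₁ outRel (base p) then suc (suc zero) else suc zero) (range 0 N)
                                       ++ map outSym (map C₁ (map mem (tuples N 5)))
      out≡ = trans (cong (map outSym) (map-++ C₁ (map base (range 0 N)) (map mem (tuples N 5))))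
        (trans (map-++ outSym (map C₁ (map base (range 0 N))) _)
          (cong (_++ map outSym (map C₁ (map mem (tuples N 5)))) (trans (cong (map outSym) (sym (map-∘ (range 0 N)))) (trans (sym (map-∘ (range 0 N))) (map-cong sym≡ (range 0 N))))))

¬true⇒false : ∀ {b} → ¬ (b ≡ true) → b ≡ false
¬true⇒false {true}  h = ⊥-elim (h refl)
¬true⇒false {false} h = refl

-- Sums and counting

Σ< : ℕ → (ℕ → ℕ) → ℕ
Σ< zero    f = 0
Σ< (suc n) f = Σ< n f + f n

Σ-cong : ∀ n {f g} → (∀ i → i < n → f i ≡ g i) → Σ< n f ≡ Σ< n g
Σ-cong zero    h = refl
Σ-cong (suc n) h = cong₂ _+_ (Σ-cong n (λ i lt → h i (m≤n⇒m≤1+n lt))) (h n ≤-refl)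

Σ-mono : ∀ n {f g} → (∀ i → i < n → f i ≤ g i) → Σ< n f ≤ Σ< n g
Σ-mono zero    h = z≤n
Σ-mono (suc n) h = +-mono-≤ (Σ-mono n (λ i lt → h i (m≤n⇒m≤1+n lt))) (h n ≤-refl)

Σ-mono-< : ∀ n {f g} → (∀ i → i < n → f i ≤ g i) → ∀ {x} → x < n → f x < g x → Σ< n f < Σ< n g
Σ-mono-< (suc n) h {x} x< lt with m≤n⇒m<n∨m≡n (≤-pred x<)
... | inj₁ x<n = +-mono-<-≤ (Σ-mono-< n (λ i lt → h i (m≤n⇒m≤1+n lt)) x<n lt) (h n ≤-refl)
... | inj₂ refl = +-mono-≤-< (Σ-mono n (λ i lt → h i (m≤n⇒m≤1+n lt))) lt

Σ-+ : ∀ n f g → Σ< n (λ i → f i + g i) ≡ Σ< n f + Σ< n g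
Σ-+ zero    f g = refl
Σ-+ (suc n) f g = trans (cong (_+ (f n + g n)) (Σ-+ n f g)) (+-interchange (Σ< n f) (Σ< n g) (f n) (g n))

Σ-zero : ∀ n → Σ< n (λ _ → 0) ≡ 0
Σ-zero zero    = refl
Σ-zero (suc n) = trans (+-identityʳ _) (Σ-zero n)

Σ-swap : ∀ n m (f : ℕ → ℕ → ℕ) → Σ< n (λ i → Σ< m (f i)) ≡ Σ< m (λ j → Σ< n (λ i → f i j))
Σ-swap zero    m f = sym (Σ-zero m)
Σ-swap (suc n) m f = trans (cong (_+ Σ< m (f n)) (Σ-swap n m f)) (sym (Σ-+ m (λ j → Σ< n (λ i → f i j)) (f n)))

Σ-≥ : ∀ n (f : ℕ → ℕ) {x} → x < n → f x ≤ Σ< n f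
Σ-≥ (suc n) f {x} lt with m≤n⇒m<n∨m≡n (≤-pred lt)
... | inj₁ x<n  = ≤-trans (Σ-≥ n f x<n) (m≤m+n _ (f n))
... | inj₂ refl = m≤n+m (f n) (Σ< n f)

Σ-single : ∀ n (f : ℕ → ℕ) {x} → x < n → (∀ i → i < n → i ≢ x → f i ≡ 0) → Σ< n f ≡ f x
Σ-single (suc n) f {x} lt h with m≤n⇒m<n∨m≡n (≤-pred lt)
... | inj₁ x<n  = trans (cong₂ _+_ (Σ-single n f x<n (λ i l → h i (m≤n⇒m≤1+n l))) (h n ≤-refl (λ e → <⇒≢ x<n (sym e)))) (+-identityʳ _)
... | inj₂ refl = cong (_+ f n) (trans (Σ-cong n (λ i l → h i (m≤n⇒m≤1+n l) (<⇒≢ l))) (Σ-zero n))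

ind : Bool → ℕ
ind b = if b then 1 else 0

ind-≤1 : ∀ b → ind b ≤ 1
ind-≤1 true  = ≤-refl
ind-≤1 false = z≤n

ind-mono : ∀ {a b} → (a ≡ true → b ≡ true) → ind a ≤ ind b
ind-mono {false}         h = z≤n
ind-mono {true}  {true}  h = ≤-refl
ind-mono {true}  {false} h = ⊥-elim (true≢false (sym (h refl)))

cnt : ℕ → (ℕ → Bool) → ℕ
cnt N P = Σ< N (λ i → ind (P i))

cnt-< : ∀ N {P Q : ℕ → Bool} → (∀ i → i < N → P i ≡ true → Q i ≡ true) → ∀ {x} → x < N → P x ≡ false → Q x ≡ true → cnt N P < cnt N Q
cnt-< N {P} {Q} h {x} x< px qx = Σ-mono-< N (λ i lt → ind-mono (h i lt)) x< (subst₂ (λ a b → ind a < ind b) (sym px) (sym qx) ≤-refl)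

cnt-pos : ∀ N {P : ℕ → Bool} {x} → x < N → P x ≡ true → 1 ≤ cnt N P
cnt-pos N {P} {x} lt e = ≤-trans (≤-reflexive (sym (cong ind e))) (Σ-≥ N (λ i → ind (P i)) lt)

cnt-≤-length : ∀ N (P : ℕ → Bool) → cnt N P ≤ N
cnt-≤-length zero    P = z≤n
cnt-≤-length (suc N) P = ≤-trans (+-mono-≤ (cnt-≤-length N P) (ind-≤1 (P N))) (≤-reflexive (+-comm N 1))

cnt-≤ : ∀ N {n} {P : ℕ → Bool} → (∀ i → i < N → P i ≡ true → i < n) → cnt N P ≤ n
cnt-≤ zero    h = z≤n
cnt-≤ (suc N) {n} {P} h with P N in e
... | false = ≤-trans (≤-reflexive (+-identityʳ _)) (cnt-≤ N (λ i i< → h i (m≤n⇒m≤1+n i<)))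
... | true  = ≤-trans (≤-reflexive (+-comm _ 1)) (≤-trans (s≤s (cnt-≤-length N P)) (h N ≤-refl e))

-- Otherwise `Q` would be contained in `P`, properly because of `x`, and would be the smaller set.
exchange : ∀ N {P Q : ℕ → Bool} → cnt N P ≤ cnt N Q → ∀ {x} → x < N → P x ≡ true → Q x ≡ false →
  ∃ λ y → y < N × (Q y ≡ true × P y ≡ false)
exchange N {P} {Q} le {x} x< px qx with anyUpTo? (λ y → (Q y ≟ᵇ true) ×-dec (P y ≟ᵇ false)) N
... | yes r = r
... | no none = ⊥-elim (<⇒≱ (cnt-< N (λ i lt qi → sub i lt qi) x< qx px) le)
  where
  sub : ∀ i → i < N → Q i ≡ true → P i ≡ true
  sub i lt qi with P i in e
  ... | true  = refl
  ... | false = ⊥-elim (none (i , lt , qi , e))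

argmax : ∀ N (P : ℕ → Bool) (f : ℕ → ℕ) {x} → x < N → P x ≡ true →
  ∃ λ z → z < N × P z ≡ true × (∀ y → y < N → P y ≡ true → f y ≤ f z)
argmax (suc N) P f {x} x< px with anyUpTo? (λ y → P y ≟ᵇ true) N
... | no none = N , ≤-refl , subst (λ y → P y ≡ true) (only x x< px) px , (λ y lt py → ≤-reflexive (cong f (only y lt py)))
  where
  only : ∀ y → y < suc N → P y ≡ true → y ≡ N
  only y lt py with m≤n⇒m<n∨m≡n (≤-pred lt)
  ... | inj₁ y< = ⊥-elim (none (y , y< , py))
  ... | inj₂ e  = e
... | yes (y₀ , y₀< , py₀) with argmax N P f y₀< py₀
...   | z , z< , pz , best with P N in eN | ≤-total (f z) (f N)
...     | false | _ = z , m≤n⇒m≤1+n z< , pz , ub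
  where
  ub : ∀ y → y < suc N → P y ≡ true → f y ≤ f z
  ub y lt py with m≤n⇒m<n∨m≡n (≤-pred lt)
  ... | inj₁ y<   = best y y< py
  ... | inj₂ refl = ⊥-elim (true≢false (trans (sym py) eN))
...     | true  | inj₂ le = z , m≤n⇒m≤1+n z< , pz , ub
  where
  ub : ∀ y → y < suc N → P y ≡ true → f y ≤ f z
  ub y lt py with m≤n⇒m<n∨m≡n (≤-pred lt)
  ... | inj₁ y<   = best y y< py
  ... | inj₂ refl = le
...     | true  | inj₁ ge = N , ≤-refl , eN , ub
  where
  ub : ∀ y → y < suc N → P y ≡ true → f y ≤ f N
  ub y lt py with m≤n⇒m<n∨m≡n (≤-pred lt)
  ... | inj₁ y<   = ≤-trans (best y y< py) ge
  ... | inj₂ refl = ≤-refl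

least : ∀ N (P : ℕ → Bool) {x} → x < N → P x ≡ true → ∃ λ u → u < N × P u ≡ true × (∀ y → y < N → P y ≡ true → u ≤ y)
least N P {x} x< px with argmax N P (λ y → N ∸ y) x< px
... | u , u< , pu , best = u , u< , pu , λ y y< py → ≮⇒≥ (λ lt → <⇒≱ (∸-monoʳ-< lt (<⇒≤ u<)) (best y y< py))

-- Cographs on the natural numbers

P4Free : (ℕ → ℕ → Bool) → Set
P4Free E = ∀ a b c d → E a b ≡ true → E b c ≡ true → E c d ≡ true → E a c ≡ false → E b d ≡ false → E a d ≡ false → ⊥

Symmetric : (ℕ → ℕ → Bool) → Set
Symmetric E = ∀ a b → E a b ≡ E b a

co : (ℕ → ℕ → Bool) → ℕ → ℕ → Bool
co E a b = not (E a b)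

co-symmetric : ∀ {E} → Symmetric E → Symmetric (co E)
co-symmetric s a b = cong not (s a b)

-- The path on four vertices is self-complementary: the complement of the path `a b c d` is the path
-- `c a d b`.
co-P4Free : ∀ {E} → Symmetric E → P4Free E → P4Free (co E)
co-P4Free s p a b c d ab bc cd ac bd ad =
  p c a d b (trans (s c a) (not-injective ac)) (not-injective ad) (trans (s d b) (not-injective bd))
    (not-injective cd) (not-injective ab) (trans (s c b) (not-injective bc))

Reach₂ : ℕ → (ℕ → ℕ → Bool) → (ℕ → Bool) → ℕ → ℕ → Set
Reach₂ N E X u x = u ≡ x ⊎ E u x ≡ true ⊎ ∃ λ y → y < N × (X y ≡ true × E u y ≡ true × E y x ≡ true)

reach₂? : ∀ N E X u x → Dec (Reach₂ N E X u x)
reach₂? N E X u x = (u ≟ x) ⊎-dec ((E u x ≟ᵇ true) ⊎-dec anyUpTo? (λ y → (X y ≟ᵇ true) ×-dec ((E u y ≟ᵇ true) ×-dec (E y x ≟ᵇ true))) N)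

-- In a P₄-free graph every vertex of a component is within distance two.
reach₂-closed : ∀ {N E X u x y} → Symmetric E → P4Free E → x < N → X x ≡ true → Reach₂ N E X u x → E x y ≡ true → Reach₂ N E X u y
reach₂-closed s p x< Xx (inj₁ refl) e = inj₂ (inj₁ e)
reach₂-closed s p x< Xx (inj₂ (inj₁ ux)) e = inj₂ (inj₂ (_ , x< , Xx , ux , e))
reach₂-closed {N} {E} {X} {u} {x} {y} s p x< Xx (inj₂ (inj₂ (z , z< , Xz , uz , zx))) e
  with E u y in uy | E z y in zy | E u x in ux
... | true  | _     | _     = inj₂ (inj₁ refl)
... | false | true  | _     = inj₂ (inj₂ (z , z< , Xz , uz , zy))
... | false | false | true  = inj₂ (inj₂ (x , x< , Xx , ux , e))
... | false | false | false = ⊥-elim (p u z x y uz zx e ux zy uy)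

-- A P₄-free graph with two vertices is not both connected and co-connected: take a neighbour z of u
-- with the most neighbours among the non-neighbours of u.
not-both : ∀ {N E X u w} → Symmetric E → P4Free E → E u u ≡ false → u < N → w < N → X u ≡ true → X w ≡ true → u ≢ w →
  (∀ x → x < N → X x ≡ true → Reach₂ N E X u x) → (∀ x → x < N → X x ≡ true → Reach₂ N (co E) X u x) → ⊥
not-both {N} {E} {X} {u} {w} s p uu u< w< Xu Xw u≢w reach coreach = final (argmax N Nb deg (proj₁ (proj₂ nonempty)) (proj₂ (proj₂ nonempty)))
  where
  Nb : ℕ → Bool
  Nb x = X x ∧ E u x
  Far : ℕ → ℕ → Bool
  Far z m = (X m ∧ E z m) ∧ not (E u m)
  deg : ℕ → ℕ
  deg z = cnt N (Far z)
  nonempty : ∃ λ z → z < N × Nb z ≡ true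
  nonempty with reach w w< Xw
  ... | inj₁ e = ⊥-elim (u≢w e)
  ... | inj₂ (inj₁ e) = w , w< , ∧-true Xw e
  ... | inj₂ (inj₂ (z , z< , Xz , uz , _)) = z , z< , ∧-true Xz uz
  final : (∃ λ z → z < N × Nb z ≡ true × (∀ y → y < N → Nb y ≡ true → deg y ≤ deg z)) → ⊥
  final (z , z< , nz , best) with ∧-true⁻ nz
  ... | Xz , uz with coreach z z< Xz
  ...   | inj₁ refl = true≢false (trans (sym uz) uu)
  ...   | inj₂ (inj₁ e) = true≢false (trans (sym uz) (not-injective e))
  ...   | inj₂ (inj₂ (m , m< , Xm , um , mz)) with reach m m< Xm
  ...     | inj₁ refl = true≢false (trans (sym uz) (not-injective mz))
  ...     | inj₂ (inj₁ e) = true≢false (trans (sym e) (not-injective um))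
  ...     | inj₂ (inj₂ (z' , z'< , Xz' , uz' , z'm))
    -- `m` is a neighbour of `z'` and not of `z`. As `z'` has no more far neighbours than `z`, some
    -- far neighbour `m'` of `z` is missed by `z'`.
    with exchange N {Far z'} {Far z} (best z' z'< (∧-true Xz' uz')) m<
           (∧-true (∧-true Xm z'm) um) (trans (cong (λ b → (X m ∧ b) ∧ not (E u m)) (trans (s z m) (not-injective mz))) (cases (X m) (not (E u m))))
    where
    cases : ∀ a b → (a ∧ false) ∧ b ≡ false
    cases true  b = refl
    cases false b = refl
  ...       | m' , m'< , far , near with ∧-true⁻ far
  ...         | far' , um' with ∧-true⁻ far'
  ...           | Xm' , zm' = path (E z z') (E m m') refl refl
    where
    uf : E u m ≡ false
    uf = not-injective um
    uf' : E u m' ≡ false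
    uf' = not-injective um'
    zm : E z m ≡ false
    zm = trans (s z m) (not-injective mz)
    z'm' : E z' m' ≡ false
    z'm' = ¬true⇒false (λ e → true≢false (trans (sym (∧-true (∧-true Xm' e) um')) near))
    -- The induced paths are `m' z u z'` if `z` and `z'` are not adjacent, otherwise `m' z z' m` or
    -- `u z' m m'`, according to whether `m` and `m'` are adjacent.
    path : ∀ a b → E z z' ≡ a → E m m' ≡ b → ⊥
    path false _     zz _  = p m' z u z' (trans (s m' z) zm') (trans (s z u) uz) uz' (trans (s m' u) uf') zz (trans (s m' z') z'm')
    path true  false zz mm = p m' z z' m (trans (s m' z) zm') zz z'm (trans (s m' z') z'm') zm (trans (s m' m) mm)
    path true  true  zz mm = p u z' m m' uz' z'm mm uf z'm' uf'

infix 0 _⟺_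
_⟺_ : Set → Set → Set
A ⟺ B = (A → B) × (B → A)

Same : Set → Set → Set
Same P Q = (P × Q) ⊎ (¬ P × ¬ Q)

same-refl : ∀ {P} → Dec P → Same P P
same-refl (yes p) = inj₁ (p , p)
same-refl (no np) = inj₂ (np , np)

same-sym : ∀ {P Q} → Same P Q → Same Q P
same-sym (inj₁ (p , q)) = inj₁ (q , p)
same-sym (inj₂ (p , q)) = inj₂ (q , p)

same-trans : ∀ {P Q R} → Same P Q → Same Q R → Same P R
same-trans (inj₁ (p , _)) (inj₁ (_ , r)) = inj₁ (p , r)
same-trans (inj₂ (p , _)) (inj₂ (_ , r)) = inj₂ (p , r)
same-trans (inj₁ (_ , q)) (inj₂ (nq , _)) = ⊥-elim (nq q)
same-trans (inj₂ (_ , nq)) (inj₁ (q , _)) = ⊥-elim (nq q)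

-- C k is the partition at level k of a top-down decomposition: a class with least element u is
-- split into the component of u (or, if it is connected, the co-component of u) and the rest.
module Side (N : ℕ) (A : ℕ → ℕ → Bool) (C : ℕ → ℕ → ℕ → Bool) where

  Connected : ℕ → ℕ → Set
  Connected k u = ∀ {y} → y < N → C k u y ≡ true → Reach₂ N A (C k u) u y

  Side : ℕ → ℕ → ℕ → Set
  Side k u x = (Connected k u × Reach₂ N (co A) (C k u) u x) ⊎ (¬ Connected k u × Reach₂ N A (C k u) u x)

  Least : ℕ → ℕ → ℕ → Set
  Least k v u = ∀ y → y < N → C k v y ≡ true → u ≤ y

  Refine : ℕ → ℕ → ℕ → Set
  Refine k v x = C k v x ≡ true × ∃ λ u → u < N × (C k v u ≡ true × Least k v u × Same (Side k u v) (Side k u x))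

module Classes (N n : ℕ) (n<N : n < N) (A : ℕ → ℕ → Bool) (A-sym : Symmetric A) (A-irr : ∀ a → A a a ≡ false)
  (A-P4 : P4Free A) (C : ℕ → ℕ → ℕ → Bool)
  (C-zero : ∀ {v x} → v < N → x < N → C 0 v x ≡ true ⟺ (v < n × x < n))
  (C-suc : ∀ {k v x} → suc k < N → v < N → x < N → C (suc k) v x ≡ true ⟺ Side.Refine N A C k v x) where

  open Side N A C public

  connected? : ∀ k u → Dec (Connected k u)
  connected? k u = map′ (λ h {y} y< c → h y< c) (λ h {y} y< c → h y< c) (allUpTo? (λ y → imp (C k u y ≟ᵇ true) (reach₂? N A (C k u) u y)) N)
    where
    imp : ∀ {P Q : Set} → Dec P → Dec Q → Dec (P → Q)
    imp (no np) _       = yes (λ p → ⊥-elim (np p))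
    imp (yes p) (yes q) = yes (λ _ → q)
    imp (yes p) (no nq) = no (λ h → nq (h p))

  side? : ∀ k u x → Dec (Side k u x)
  side? k u x = (connected? k u ×-dec reach₂? N (co A) (C k u) u x) ⊎-dec (¬? (connected? k u) ×-dec reach₂? N A (C k u) u x)

  side-refl : ∀ k u → Side k u u
  side-refl k u with connected? k u
  ... | yes c = inj₁ (c , inj₁ refl)
  ... | no nc = inj₂ (nc , inj₁ refl)

  <n⇒<N : ∀ {x} → x < n → x < N
  <n⇒<N lt = <-trans lt n<N

  -- A partial equivalence: numbers from `n` up to N are not vertices and belong to no class.
  record Equiv (k : ℕ) : Set where
    field
      dom : ∀ {v x} → v < N → x < N → C k v x ≡ true → v < n × x < n
      rfl : ∀ {v} → v < n → C k v v ≡ true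
      sy  : ∀ {v x} → v < N → x < N → C k v x ≡ true → C k x v ≡ true
      tr  : ∀ {v x y} → v < N → x < N → y < N → C k v x ≡ true → C k x y ≡ true → C k v y ≡ true
  open Equiv

  module Level {k : ℕ} (sk<N : suc k < N) (E : Equiv k) where

    pivot : ∀ {v} → v < n → ∃ λ u → u < N × C k v u ≡ true × Least k v u
    pivot v<n = least N (C k _) (<n⇒<N v<n) (rfl E v<n)

    -- The least element depends on the class alone, so `x` and `y` are compared with the same pivot
    -- `u` as `v` is.
    parts : ∀ {v u x y} → v < N → u < N → C k v u ≡ true → Least k v u → x < N → y < N → C k v x ≡ true → C k v y ≡ true →
      C (suc k) x y ≡ true ⟺ Same (Side k u x) (Side k u y)
    parts {v} {u} {x} {y} v< u< vu lu x< y< vx vy = to , from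
      where
      xv = sy E v< x< vx
      xu : C k x u ≡ true
      xu = tr E x< v< u< xv vu
      to : C (suc k) x y ≡ true → Same (Side k u x) (Side k u y)
      to e with proj₁ (C-suc sk<N x< y<) e
      ... | _ , u' , u'< , xu' , lu' , same with ≤-antisym (lu u' u'< (tr E v< x< u'< vx xu')) (lu' u u< xu)
      ...   | refl = same
      from : Same (Side k u x) (Side k u y) → C (suc k) x y ≡ true
      from same = proj₂ (C-suc sk<N x< y<) (tr E x< v< y< xv vy , u , u< , xu , (λ z z< xz → lu z z< (tr E v< x< z< vx xz)) , same)

    coarser : ∀ {v x} → v < N → x < N → C (suc k) v x ≡ true → C k v x ≡ true
    coarser v< x< e = proj₁ (proj₁ (C-suc sk<N v< x<) e)

    next : Equiv (suc k)
    next = record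
      { dom = λ v< x< e → dom E v< x< (coarser v< x< e)
      ; rfl = λ {v} v<n → let (u , u< , vu , lu) = pivot v<n ; v< = <n⇒<N v<n in
                proj₂ (parts v< u< vu lu v< v< (rfl E v<n) (rfl E v<n)) (same-refl (side? k u v))
      ; sy  = λ v< x< e → let vx = coarser v< x< e ; v<n = proj₁ (dom E v< x< vx) ; (u , u< , vu , lu) = pivot v<n in
                proj₂ (parts v< u< vu lu x< v< vx (rfl E v<n)) (same-sym (proj₁ (parts v< u< vu lu v< x< (rfl E v<n) vx) e))
      ; tr  = λ v< x< y< e f → let vx = coarser v< x< e ; v<n = proj₁ (dom E v< x< vx) ; (u , u< , vu , lu) = pivot v<n
                                   vy = tr E v< x< y< vx (coarser x< y< f) in
                proj₂ (parts v< u< vu lu v< y< (rfl E v<n) vy)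
                  (same-trans (proj₁ (parts v< u< vu lu v< x< (rfl E v<n) vx) e) (proj₁ (parts v< u< vu lu x< y< vx vy) f)) }

    module _ {v : ℕ} (v<n : v < n) where

      private
        v< = <n⇒<N v<n
        u = proj₁ (pivot v<n)
        u< = proj₁ (proj₂ (pivot v<n))
        vu = proj₁ (proj₂ (proj₂ (pivot v<n)))
        lu = proj₂ (proj₂ (proj₂ (pivot v<n)))
        uv = sy E v< u< vu
        inU : ∀ {x} → x < N → C k v x ≡ true → C k u x ≡ true
        inU x< vx = tr E u< v< x< uv vx

      two : ∀ {a b x} → a < N → b < N → x < N → C k v a ≡ true → C k v b ≡ true → C k v x ≡ true →
        ¬ (C (suc k) a b ≡ true) → C (suc k) a x ≡ true ⊎ C (suc k) b x ≡ true
      two {a} {b} {x} a< b< x< va vb vx ab with side? k u a | side? k u b | side? k u x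
      ... | yes p | yes q | _     = ⊥-elim (ab (proj₂ (parts v< u< vu lu a< b< va vb) (inj₁ (p , q))))
      ... | no p  | no q  | _     = ⊥-elim (ab (proj₂ (parts v< u< vu lu a< b< va vb) (inj₂ (p , q))))
      ... | yes p | no q  | yes r = inj₁ (proj₂ (parts v< u< vu lu a< x< va vx) (inj₁ (p , r)))
      ... | yes p | no q  | no r  = inj₂ (proj₂ (parts v< u< vu lu b< x< vb vx) (inj₂ (q , r)))
      ... | no p  | yes q | yes r = inj₂ (proj₂ (parts v< u< vu lu b< x< vb vx) (inj₁ (q , r)))
      ... | no p  | yes q | no r  = inj₁ (proj₂ (parts v< u< vu lu a< x< va vx) (inj₂ (p , r)))

      private
        -- A side is closed under adjacency, or under non-adjacency if the class is connected; a
        -- vertex outside it thus determines the value of `A`.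
        across : ∀ {a b} → a < N → b < N → C k v a ≡ true → C k v b ≡ true → Side k u a → ¬ Side k u b →
          (Connected k u → A a b ≡ true) × (¬ Connected k u → A a b ≡ false)
        across {a} {b} a< b< va vb sa nsb = conn sa , disc sa
          where
          conn : Side k u a → Connected k u → A a b ≡ true
          conn (inj₂ (nc , _)) c = ⊥-elim (nc c)
          conn (inj₁ (_ , r)) c with A a b in ab
          ... | true  = refl
          ... | false = ⊥-elim (nsb (inj₁ (c , reach₂-closed (co-symmetric {A} A-sym) (co-P4Free A-sym A-P4) a< (inU a< va) r (cong not ab))))
          disc : Side k u a → ¬ Connected k u → A a b ≡ false
          disc (inj₁ (c , _)) nc = ⊥-elim (nc c)
          disc (inj₂ (_ , r)) nc with A a b in ab
          ... | false = refl
          ... | true  = ⊥-elim (nsb (inj₂ (nc , reach₂-closed A-sym A-P4 a< (inU a< va) r ab)))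

      -- If the class is connected, both parts are unions of co-components and all edges run between
      -- them; otherwise they are unions of components and none does.
      homogeneous : ∃ λ t → ∀ {a b} → a < N → b < N → C k v a ≡ true → C k v b ≡ true → ¬ (C (suc k) a b ≡ true) → A a b ≡ t
      homogeneous with connected? k u
      ... | yes c = true , λ {a} {b} a< b< va vb ab → type a< b< va vb ab (side? k u a) (side? k u b)
        where
        type : ∀ {a b} → a < N → b < N → C k v a ≡ true → C k v b ≡ true → ¬ (C (suc k) a b ≡ true) → Dec (Side k u a) → Dec (Side k u b) → A a b ≡ true
        type a< b< va vb ab (yes p) (yes q) = ⊥-elim (ab (proj₂ (parts v< u< vu lu a< b< va vb) (inj₁ (p , q))))
        type a< b< va vb ab (no p)  (no q)  = ⊥-elim (ab (proj₂ (parts v< u< vu lu a< b< va vb) (inj₂ (p , q))))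
        type a< b< va vb ab (yes p) (no q)  = proj₁ (across a< b< va vb p q) c
        type a< b< va vb ab (no p)  (yes q) = trans (A-sym _ _) (proj₁ (across b< a< vb va q p) c)
      ... | no nc = false , λ {a} {b} a< b< va vb ab → type a< b< va vb ab (side? k u a) (side? k u b)
        where
        type : ∀ {a b} → a < N → b < N → C k v a ≡ true → C k v b ≡ true → ¬ (C (suc k) a b ≡ true) → Dec (Side k u a) → Dec (Side k u b) → A a b ≡ false
        type a< b< va vb ab (yes p) (yes q) = ⊥-elim (ab (proj₂ (parts v< u< vu lu a< b< va vb) (inj₁ (p , q))))
        type a< b< va vb ab (no p)  (no q)  = ⊥-elim (ab (proj₂ (parts v< u< vu lu a< b< va vb) (inj₂ (p , q))))
        type a< b< va vb ab (yes p) (no q)  = proj₂ (across a< b< va vb p q) nc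
        type a< b< va vb ab (no p)  (yes q) = trans (A-sym _ _) (proj₂ (across b< a< vb va q p) nc)

      -- All vertices lie on the side of `u`. A disconnected class would then be a single component,
      -- which is absurd; a connected one would be co-connected as well, which `not-both` rules out
      -- for two vertices.
      unsplit : (∀ {a b} → a < N → b < N → C k v a ≡ true → C k v b ≡ true → C (suc k) a b ≡ true) →
        ∀ {x} → x < N → C k v x ≡ true → x ≡ u
      unsplit whole {x} x< vx with u ≟ x
      ... | yes e = sym e
      ... | no u≢x = ⊥-elim (case (connected? k u))
        where
        all-side : ∀ {y} → y < N → C k v y ≡ true → Side k u y
        all-side {y} y< vy with proj₁ (parts v< u< vu lu u< y< vu vy) (whole u< y< vu vy)
        ... | inj₁ (_ , s)  = s
        ... | inj₂ (ns , _) = ⊥-elim (ns (side-refl k u))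
        inV : ∀ {y} → y < N → C k u y ≡ true → C k v y ≡ true
        inV y< uy = tr E v< u< y< vu uy
        case : Dec (Connected k u) → ⊥
        case (yes c) = not-both A-sym A-P4 (A-irr u) u< x< (inU u< vu) (inU x< vx) u≢x (λ y y< uy → c y< uy) co-all
          where
          co-all : ∀ y → y < N → C k u y ≡ true → Reach₂ N (co A) (C k u) u y
          co-all y y< uy with all-side y< (inV y< uy)
          ... | inj₁ (_ , r)  = r
          ... | inj₂ (nc , _) = ⊥-elim (nc c)
        case (no nc) = nc (λ {y} y< uy → all-reach y< uy)
          where
          all-reach : ∀ {y} → y < N → C k u y ≡ true → Reach₂ N A (C k u) u y
          all-reach y< uy with all-side y< (inV y< uy)
          ... | inj₁ (c , _) = ⊥-elim (nc c)
          ... | inj₂ (_ , r) = r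

  split? : ∀ k v → Dec (∃ λ a → a < N × ∃ λ b → b < N × (C k v a ≡ true × C k v b ≡ true × ¬ (C (suc k) a b ≡ true)))
  split? k v = anyUpTo? (λ a → anyUpTo? (λ b → (C k v a ≟ᵇ true) ×-dec ((C k v b ≟ᵇ true) ×-dec ¬? (C (suc k) a b ≟ᵇ true))) N) N

  equiv : ∀ k → k < N → Equiv k
  equiv zero    k< = record
    { dom = λ v< x< e → proj₁ (C-zero v< x<) e
    ; rfl = λ v<n → proj₂ (C-zero (<n⇒<N v<n) (<n⇒<N v<n)) (v<n , v<n)
    ; sy  = λ v< x< e → let (a , b) = proj₁ (C-zero v< x<) e in proj₂ (C-zero x< v<) (b , a)
    ; tr  = λ v< x< y< e f → proj₂ (C-zero v< y<) (proj₁ (proj₁ (C-zero v< x<) e) , proj₂ (proj₁ (C-zero x< y<) f)) }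
  equiv (suc k) k< = Level.next k< (equiv k (<-trans (n<1+n k) k<))

  Trivial : ℕ → ℕ → Set
  Trivial k v = ∀ {x} → x < N → C k v x ≡ true → x ≡ v

  -- As long as a class is no singleton, each level takes away at least one vertex.
  small : ∀ k {v} → k < N → v < n → Trivial k v ⊎ cnt N (C k v) + k ≤ n
  small zero {v} k< v<n = inj₂ (≤-trans (≤-reflexive (+-identityʳ _)) (cnt-≤ N (λ i i< c → proj₂ (proj₁ (C-zero (<n⇒<N v<n) i<) c))))
  small (suc k) {v} k< v<n with small k (<-trans (n<1+n k) k<) v<n
  ... | inj₁ t = inj₁ (λ x< c → t x< (Level.coarser k< (equiv k (<-trans (n<1+n k) k<)) (<n⇒<N v<n) x< c))
  ... | inj₂ le with split? k v
  ...   | no none = inj₁ trivial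
    where
    open Level k< (equiv k (<-trans (n<1+n k) k<))
    Ek = equiv k (<-trans (n<1+n k) k<)
    whole : ∀ {a b} → a < N → b < N → C k v a ≡ true → C k v b ≡ true → C (suc k) a b ≡ true
    whole {a} {b} a< b< va vb with C (suc k) a b in e
    ... | true  = refl
    ... | false = ⊥-elim (none (a , a< , b , b< , va , vb , (λ t → true≢false (trans (sym t) e))))
    trivial : Trivial (suc k) v
    trivial x< c = trans (unsplit v<n whole x< (coarser (<n⇒<N v<n) x< c)) (sym (unsplit v<n whole (<n⇒<N v<n) (rfl Ek v<n)))
  ...   | yes (a , a< , b , b< , va , vb , ab) = inj₂ (≤-trans (≤-reflexive (+-suc _ k)) (≤-trans (+-monoˡ-≤ k smaller) le))
    where
    Ek = equiv k (<-trans (n<1+n k) k<)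
    open Level k< Ek
    Es = equiv (suc k) k<
    v< = <n⇒<N v<n
    missing : ∃ λ x → x < N × C k v x ≡ true × C (suc k) v x ≡ false
    missing with C (suc k) v a in va' | C (suc k) v b in vb'
    ... | false | _     = a , a< , va , va'
    ... | true  | false = b , b< , vb , vb'
    ... | true  | true  = ⊥-elim (ab (tr Es a< v< b< (sy Es v< a< va') vb'))
    smaller : cnt N (C (suc k) v) < cnt N (C k v)
    smaller = let (x , x< , vx , vx') = missing in cnt-< N (λ i i< c → coarser v< i< c) x< vx' vx

  -- Levels are numbers below N. A class with two vertices occurs early enough for the next level to
  -- exist.
  deeper : ∀ {k v a b} → k < N → v < n → a < N → b < N → C k v a ≡ true → C k v b ≡ true → a ≢ b → suc k < N
  deeper {k} {v} {a} {b} k< v<n a< b< va vb a≢b with small k k< v<n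
  ... | inj₁ t = ⊥-elim (a≢b (trans (t a< va) (sym (t b< vb))))
  ... | inj₂ le = ≤-trans (s≤s (≤-trans (+-monoˡ-≤ k (cnt-pos N (<n⇒<N v<n) (rfl (equiv k k<) v<n))) le)) n<N

-- Independent sets of the product as Boolean matrices

module Alpha (N : ℕ) (A B : ℕ → ℕ → Bool) where

  Within : (ℕ → ℕ → Bool) → (ℕ → Bool) → (ℕ → Bool) → Set
  Within W P Q = ∀ {i j} → i < N → j < N → W i j ≡ true → P i ≡ true × Q j ≡ true

  Indep : (ℕ → ℕ → Bool) → Set
  Indep W = ∀ {i j i' j'} → i < N → j < N → i' < N → j' < N → W i j ≡ true → W i' j' ≡ true → A i i' ≡ true → B j j' ≡ true → ⊥

  area : (ℕ → ℕ → Bool) → ℕ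
  area W = Σ< N (λ i → Σ< N (λ j → ind (W i j)))

  Attained Bounded isα : (ℕ → Bool) → (ℕ → Bool) → ℕ → Set
  Attained P Q k = Σ (ℕ → ℕ → Bool) λ W → Within W P Q × Indep W × area W ≡ k
  Bounded P Q k  = ∀ W → Within W P Q → Indep W → area W ≤ k
  isα P Q k      = Attained P Q k × Bounded P Q k

  isα-unique : ∀ {P Q a b} → isα P Q a → isα P Q b → a ≡ b
  isα-unique ((W , w , i , refl) , ub) ((W' , w' , i' , refl) , ub') = ≤-antisym (ub' W w i) (ub W' w' i')

  area-mono : ∀ {W W'} → (∀ {i j} → i < N → j < N → W i j ≡ true → W' i j ≡ true) → area W ≤ area W'
  area-mono h = Σ-mono N (λ i i< → Σ-mono N (λ j j< → ind-mono (h i< j<)))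

  area-+ : ∀ {W U U'} → (∀ {i j} → i < N → j < N → ind (W i j) ≡ ind (U i j) + ind (U' i j)) → area W ≡ area U + area U'
  area-+ {W} {U} {U'} h = trans (Σ-cong N (λ i i< → trans (Σ-cong N (λ j j< → h i< j<)) (Σ-+ N (λ j → ind (U i j)) (λ j → ind (U' i j)))))
                                (Σ-+ N (λ i → Σ< N (λ j → ind (U i j))) (λ i → Σ< N (λ j → ind (U' i j))))

  attained-mono : ∀ {P Q P' Q' k} → (∀ {i} → i < N → P i ≡ true → P' i ≡ true) → (∀ {j} → j < N → Q j ≡ true → Q' j ≡ true) →
    Attained P Q k → Attained P' Q' k
  attained-mono hp hq (W , w , i , e) = W , (λ i< j< c → hp i< (proj₁ (w i< j< c)) , hq j< (proj₂ (w i< j< c))) , i , e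

  attained-⊔ : ∀ {P Q a b} → Attained P Q a → Attained P Q b → Attained P Q (a ⊔ b)
  attained-⊔ {P} {Q} {a} {b} x y with ⊔-sel a b
  ... | inj₁ e = subst (Attained P Q) (sym e) x
  ... | inj₂ e = subst (Attained P Q) (sym e) y

  record Splits (P P₁ P₂ : ℕ → Bool) : Set where
    field
      cover    : ∀ {i} → i < N → P i ≡ true → P₁ i ≡ true ⊎ P₂ i ≡ true
      sub₁     : ∀ {i} → i < N → P₁ i ≡ true → P i ≡ true
      sub₂     : ∀ {i} → i < N → P₂ i ≡ true → P i ≡ true
      disjoint : ∀ {i} → i < N → P₁ i ≡ true → P₂ i ≡ true → ⊥
  open Splits

  -- With no edge between the slabs `P₁ × Q` and `P₂ × Q`, independent sets are disjoint unions of
  -- independent sets of the slabs. Both directions are assumed since `A` and `B` are arbitrary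
  -- relations here.
  isα-sum : ∀ {P P₁ P₂ Q a b} → Splits P P₁ P₂ →
    (∀ {i i' j j'} → i < N → i' < N → j < N → j' < N → P₁ i ≡ true → P₂ i' ≡ true → Q j ≡ true → Q j' ≡ true → A i i' ≡ true → B j j' ≡ true → ⊥) →
    (∀ {i i' j j'} → i < N → i' < N → j < N → j' < N → P₂ i ≡ true → P₁ i' ≡ true → Q j ≡ true → Q j' ≡ true → A i i' ≡ true → B j j' ≡ true → ⊥) →
    isα P₁ Q a → isα P₂ Q b → isα P Q (a + b)
  isα-sum {P} {P₁} {P₂} {Q} {a} {b} s c c' ((W₁ , w₁ , i₁ , e₁) , ub₁) ((W₂ , w₂ , i₂ , e₂) , ub₂) = (W , within , indep , trans (area-+ split) (cong₂ _+_ e₁ e₂)) , ub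
    where
    W : ℕ → ℕ → Bool
    W i j = W₁ i j ∨ W₂ i j
    within : Within W P Q
    within {i} {j} i< j< e with ∨-true⁻ {W₁ i j} e
    ... | inj₁ x = sub₁ s i< (proj₁ (w₁ i< j< x)) , proj₂ (w₁ i< j< x)
    ... | inj₂ x = sub₂ s i< (proj₁ (w₂ i< j< x)) , proj₂ (w₂ i< j< x)
    indep : Indep W
    indep {i} {j} {i'} {j'} i< j< i'< j'< e e' ea eb with ∨-true⁻ {W₁ i j} e | ∨-true⁻ {W₁ i' j'} e'
    ... | inj₁ x | inj₁ y = i₁ i< j< i'< j'< x y ea eb
    ... | inj₂ x | inj₂ y = i₂ i< j< i'< j'< x y ea eb
    ... | inj₁ x | inj₂ y = c i< i'< j< j'< (proj₁ (w₁ i< j< x)) (proj₁ (w₂ i'< j'< y)) (proj₂ (w₁ i< j< x)) (proj₂ (w₂ i'< j'< y)) ea eb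
    ... | inj₂ x | inj₁ y = c' i< i'< j< j'< (proj₁ (w₂ i< j< x)) (proj₁ (w₁ i'< j'< y)) (proj₂ (w₂ i< j< x)) (proj₂ (w₁ i'< j'< y)) ea eb
    split : ∀ {i j} → i < N → j < N → ind (W i j) ≡ ind (W₁ i j) + ind (W₂ i j)
    split {i} {j} i< j< with W₁ i j in x | W₂ i j in y
    ... | true  | true  = ⊥-elim (disjoint s i< (proj₁ (w₁ i< j< x)) (proj₁ (w₂ i< j< y)))
    ... | true  | false = refl
    ... | false | _     = refl
    ub : Bounded P Q (a + b)
    ub U w ind-U = ≤-trans (≤-reflexive (area-+ {U} {λ i j → U i j ∧ P₁ i} {λ i j → U i j ∧ P₂ i} parts))
      (+-mono-≤ (ub₁ _ (λ i< j< e → proj₂ (∧-true⁻ e) , proj₂ (w i< j< (proj₁ (∧-true⁻ e))))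
                       (λ i< j< i'< j'< e e' → ind-U i< j< i'< j'< (proj₁ (∧-true⁻ e)) (proj₁ (∧-true⁻ e'))))
                (ub₂ _ (λ i< j< e → proj₂ (∧-true⁻ e) , proj₂ (w i< j< (proj₁ (∧-true⁻ e))))
                       (λ i< j< i'< j'< e e' → ind-U i< j< i'< j'< (proj₁ (∧-true⁻ e)) (proj₁ (∧-true⁻ e')))))
      where
      parts : ∀ {i j} → i < N → j < N → ind (U i j) ≡ ind (U i j ∧ P₁ i) + ind (U i j ∧ P₂ i)
      parts {i} {j} i< j< with U i j in u | P₁ i in p | P₂ i in q
      ... | false | _     | _     = refl
      ... | true  | true  | true  = ⊥-elim (disjoint s i< p q)
      ... | true  | true  | false = refl
      ... | true  | false | true  = refl
      ... | true  | false | false with cover s i< (proj₁ (w i< j< u))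
      ...   | inj₁ p' = ⊥-elim (true≢false (trans (sym p') p))
      ...   | inj₂ q' = ⊥-elim (true≢false (trans (sym q') q))

  meets? : ∀ (W : ℕ → ℕ → Bool) (P Q : ℕ → Bool) → Dec (∃ λ i → i < N × ∃ λ j → j < N × (W i j ≡ true × P i ≡ true × Q j ≡ true))
  meets? W P Q = anyUpTo? (λ i → anyUpTo? (λ j → (W i j ≟ᵇ true) ×-dec ((P i ≟ᵇ true) ×-dec (Q j ≟ᵇ true))) N) N

  -- The blocks met by an independent set pairwise share a row or a column.
  isα-max : ∀ {P P₁ P₂ Q Q₁ Q₂ a₁ a₂ b₁ b₂} → Splits P P₁ P₂ → Splits Q Q₁ Q₂ →
    (∀ {i i'} → i < N → i' < N → P₁ i ≡ true → P₂ i' ≡ true → A i i' ≡ true) →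
    (∀ {j j'} → j < N → j' < N → Q₁ j ≡ true → Q₂ j' ≡ true → B j j' ≡ true) →
    (∀ {j j'} → j < N → j' < N → Q₂ j ≡ true → Q₁ j' ≡ true → B j j' ≡ true) →
    isα P₁ Q a₁ → isα P₂ Q a₂ → isα P Q₁ b₁ → isα P Q₂ b₂ → isα P Q ((a₁ ⊔ a₂) ⊔ (b₁ ⊔ b₂))
  isα-max {P} {P₁} {P₂} {Q} {Q₁} {Q₂} {a₁} {a₂} {b₁} {b₂} s t jA jB jB' (wa₁ , ua₁) (wa₂ , ua₂) (wb₁ , ub₁) (wb₂ , ub₂) =
    attained-⊔ (attained-⊔ (attained-mono (sub₁ s) (λ _ q → q) wa₁) (attained-mono (sub₂ s) (λ _ q → q) wa₂))
               (attained-⊔ (attained-mono (λ _ p → p) (sub₁ t) wb₁) (attained-mono (λ _ p → p) (sub₂ t) wb₂)) , ub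
    where
    ub : Bounded P Q ((a₁ ⊔ a₂) ⊔ (b₁ ⊔ b₂))
    ub W w indep = go (meets? W P₁ Q₁) (meets? W P₂ Q₂) (meets? W P₁ Q₂) (meets? W P₂ Q₁)
      where
      M = (a₁ ⊔ a₂) ⊔ (b₁ ⊔ b₂)
      Meets : (ℕ → Bool) → (ℕ → Bool) → Set
      Meets P Q = ∃ λ i → i < N × ∃ λ j → j < N × (W i j ≡ true × P i ≡ true × Q j ≡ true)
      useP₂ : ¬ Meets P₁ Q₁ → ¬ Meets P₁ Q₂ → area W ≤ M
      useP₂ n m = ≤-trans (ua₂ W inside indep) (≤-trans (m≤n⊔m a₁ a₂) (m≤m⊔n _ _))
        where
        inside : Within W P₂ Q
        inside i< j< e with w i< j< e
        ... | p , q with cover s i< p | cover t j< q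
        ...   | inj₂ p₂ | _ = p₂ , q
        ...   | inj₁ p₁ | inj₁ q₁ = ⊥-elim (n (_ , i< , _ , j< , e , p₁ , q₁))
        ...   | inj₁ p₁ | inj₂ q₂ = ⊥-elim (m (_ , i< , _ , j< , e , p₁ , q₂))
      useP₁ : ¬ Meets P₂ Q₁ → ¬ Meets P₂ Q₂ → area W ≤ M
      useP₁ n m = ≤-trans (ua₁ W inside indep) (≤-trans (m≤m⊔n a₁ a₂) (m≤m⊔n _ _))
        where
        inside : Within W P₁ Q
        inside i< j< e with w i< j< e
        ... | p , q with cover s i< p | cover t j< q
        ...   | inj₁ p₁ | _ = p₁ , q
        ...   | inj₂ p₂ | inj₁ q₁ = ⊥-elim (n (_ , i< , _ , j< , e , p₂ , q₁))
        ...   | inj₂ p₂ | inj₂ q₂ = ⊥-elim (m (_ , i< , _ , j< , e , p₂ , q₂))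
      useQ₂ : ¬ Meets P₁ Q₁ → ¬ Meets P₂ Q₁ → area W ≤ M
      useQ₂ n m = ≤-trans (ub₂ W inside indep) (≤-trans (m≤n⊔m b₁ b₂) (m≤n⊔m (a₁ ⊔ a₂) _))
        where
        inside : Within W P Q₂
        inside i< j< e with w i< j< e
        ... | p , q with cover s i< p | cover t j< q
        ...   | _ | inj₂ q₂ = p , q₂
        ...   | inj₁ p₁ | inj₁ q₁ = ⊥-elim (n (_ , i< , _ , j< , e , p₁ , q₁))
        ...   | inj₂ p₂ | inj₁ q₁ = ⊥-elim (m (_ , i< , _ , j< , e , p₂ , q₁))
      useQ₁ : ¬ Meets P₁ Q₂ → ¬ Meets P₂ Q₂ → area W ≤ M
      useQ₁ n m = ≤-trans (ub₁ W inside indep) (≤-trans (m≤m⊔n b₁ b₂) (m≤n⊔m (a₁ ⊔ a₂) _))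
        where
        inside : Within W P Q₁
        inside i< j< e with w i< j< e
        ... | p , q with cover s i< p | cover t j< q
        ...   | _ | inj₁ q₁ = p , q₁
        ...   | inj₁ p₁ | inj₂ q₂ = ⊥-elim (n (_ , i< , _ , j< , e , p₁ , q₂))
        ...   | inj₂ p₂ | inj₂ q₂ = ⊥-elim (m (_ , i< , _ , j< , e , p₂ , q₂))
      go : Dec (Meets P₁ Q₁) → Dec (Meets P₂ Q₂) → Dec (Meets P₁ Q₂) → Dec (Meets P₂ Q₁) → area W ≤ M
      go (yes (i , i< , j , j< , e , p , q)) (yes (i' , i'< , j' , j'< , e' , p' , q')) _ _ =
        ⊥-elim (indep i< j< i'< j'< e e' (jA i< i'< p p') (jB j< j'< q q'))
      go _ _ (yes (i , i< , j , j< , e , p , q)) (yes (i' , i'< , j' , j'< , e' , p' , q')) =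
        ⊥-elim (indep i< j< i'< j'< e e' (jA i< i'< p p') (jB' j< j'< q q'))
      go (no n₁₁) _ (no n₁₂) _ = useP₂ n₁₁ n₁₂
      go (no n₁₁) _ _ (no n₂₁) = useQ₂ n₁₁ n₂₁
      go _ (no n₂₂) (no n₁₂) _ = useQ₁ n₁₂ n₂₂
      go _ (no n₂₂) _ (no n₂₁) = useP₁ n₂₁ n₂₂

  isα-singletons : ∀ {P Q v w} → v < N → w < N → P v ≡ true → Q w ≡ true → A v v ≡ false →
    (∀ {i} → i < N → P i ≡ true → i ≡ v) → (∀ {j} → j < N → Q j ≡ true → j ≡ w) → isα P Q 1
  isα-singletons {P} {Q} {v} {w} v< w< Pv Qw Avv hP hQ =
    (U , (λ _ _ e → ∧-true⁻ e) , indep , area≡) , λ W w _ → ≤-trans (area-mono (λ i< j< e → ∧-true (proj₁ (w i< j< e)) (proj₂ (w i< j< e)))) (≤-reflexive area≡)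
    where
    U : ℕ → ℕ → Bool
    U i j = P i ∧ Q j
    indep : Indep U
    indep i< j< i'< j'< e e' ea _ = true≢false (trans (sym ea) (trans (cong₂ A (hP i< (proj₁ (∧-true⁻ e))) (hP i'< (proj₁ (∧-true⁻ e')))) Avv))
    off : ∀ {b} → ¬ (b ≡ true) → ind b ≡ 0
    off h = cong ind (¬true⇒false h)
    area≡ : area U ≡ 1
    area≡ = trans (Σ-single N _ v< (λ i i< i≢v → trans (Σ-cong N (λ j _ → off (λ e → i≢v (hP i< (proj₁ (∧-true⁻ e)))))) (Σ-zero N)))
      (trans (Σ-single N _ w< (λ j j< j≢w → off (λ e → j≢w (hQ j< (proj₂ (∧-true⁻ e)))))) (cong ind (∧-true Pv Qw)))

-- Transposition makes the lemmas on splitting the first factor available for the second.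
isα-swap : ∀ {N A B P Q k} → Alpha.isα N A B P Q k → Alpha.isα N B A Q P k
isα-swap {N} {A} {B} ((W , w , i , e) , ub) =
  ((λ j i → W i j) , (λ j< i< c → let (p , q) = w i< j< c in q , p) , (λ j< i< j'< i'< c c' eb ea → i i< j< i'< j'< c c' ea eb)
    , trans (Σ-swap N N (λ j i → ind (W i j))) e)
  , λ U u iu → ≤-trans (≤-reflexive (Σ-swap N N (λ j i → ind (U j i)))) (ub (λ i j → U j i)
      (λ i< j< c → let (q , p) = u j< i< c in p , q) (λ i< j< i'< j'< c c' ea eb → iu j< i< j'< i'< c c' eb ea))

-- Splits of classes and the recursion for the independence number

record Decomposition (N n : ℕ) (A : ℕ → ℕ → Bool) (C : ℕ → ℕ → ℕ → Bool) : Set where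
  field
    n<N    : n < N
    A-sym  : Symmetric A
    A-irr  : ∀ a → A a a ≡ false
    A-P4   : P4Free A
    C-zero : ∀ {v x} → v < N → x < N → C 0 v x ≡ true ⟺ (v < n × x < n)
    C-suc  : ∀ {k v x} → suc k < N → v < N → x < N → C (suc k) v x ≡ true ⟺ Side.Refine N A C k v x

module Splitting {N n : ℕ} {A : ℕ → ℕ → Bool} {C : ℕ → ℕ → ℕ → Bool} (D : Decomposition N n A C) where

  open Decomposition D public
  open Classes N n n<N A A-sym A-irr A-P4 C C-zero C-suc public
  open Equiv

  -- `a` and `b` represent the two parts. The bound on `suc k` is part of the data because nothing
  -- is known about partitions at levels from N on.
  record Split (k v a b : ℕ) : Set where
    constructor split
    field
      sk<  : suc k < N
      a<   : a < N
      b<   : b < N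
      va   : C k v a ≡ true
      vb   : C k v b ≡ true
      a≁b  : ¬ (C (suc k) a b ≡ true)
  open Split public

  NoSplit : ℕ → ℕ → Set
  NoSplit k v = ∀ {a b} → ¬ Split k v a b

  splits? : ∀ k v → (∃ λ a → ∃ λ b → Split k v a b) ⊎ NoSplit k v
  splits? k v with suc k <? N
  ... | no nk = inj₂ (λ s → nk (sk< s))
  ... | yes sk with split? k v
  ...   | yes (a , a< , b , b< , va , vb , ab) = inj₁ (a , b , split sk a< b< va vb ab)
  ...   | no none = inj₂ (λ s → none (_ , a< s , _ , b< s , va s , vb s , a≁b s))

  module _ {k v : ℕ} (k< : k < N) (v<n : v < n) where

    private
      E = equiv k k<
      v< = <n⇒<N v<n

    self : C k v v ≡ true
    self = rfl E v<n

    -- The absence of a split might be due to the missing next level; by `deeper`, two different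
    -- vertices would force that level to exist.
    trivial : NoSplit k v → ∀ {x y} → x < N → y < N → C k v x ≡ true → C k v y ≡ true → x ≡ y
    trivial ns {x} {y} x< y< vx vy with x ≟ y
    ... | yes e = e
    ... | no x≢y = trans (U x< vx) (sym (U y< vy))
      where
      sk = deeper k< v<n x< y< vx vy x≢y
      whole : ∀ {a b} → a < N → b < N → C k v a ≡ true → C k v b ≡ true → C (suc k) a b ≡ true
      whole {a} {b} a< b< va vb with C (suc k) a b in e
      ... | true  = refl
      ... | false = ⊥-elim (ns (split sk a< b< va vb (λ t → true≢false (trans (sym t) e))))
      U : ∀ {z} → z < N → C k v z ≡ true → z ≡ _
      U = Level.unsplit sk E v<n whole

    module _ {a b : ℕ} (s : Split k v a b) where

      open Level (sk< s) E using (coarser)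
      private
        E' = equiv (suc k) (sk< s)

      flip-split : Split k v b a
      flip-split = split (sk< s) (b< s) (a< s) (vb s) (va s) (λ e → a≁b s (sy E' (b< s) (a< s) e))

      a<n : a < n
      a<n = proj₂ (dom E v< (a< s) (va s))

      below : ∀ {x} → x < N → C (suc k) a x ≡ true → C k v x ≡ true
      below x< ax = tr E v< (a< s) x< (va s) (coarser (a< s) x< ax)

      apart : ∀ {x y} → x < N → y < N → C (suc k) a x ≡ true → C (suc k) b y ≡ true → ¬ (C (suc k) x y ≡ true)
      apart x< y< ax by xy = a≁b s (tr E' (a< s) y< (b< s) (tr E' (a< s) x< y< ax xy) (sy E' (b< s) y< by))

      smaller : cnt N (C (suc k) a) < cnt N (C k v)
      smaller = cnt-< N (λ _ x< ax → below x< ax) (b< s) (¬true⇒false (a≁b s)) (vb s)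

    module _ {a b : ℕ} (s : Split k v a b) where

      open Level (sk< s) E using (two; homogeneous)

      splits : ∀ {B} → Alpha.Splits N A B (C k v) (C (suc k) a) (C (suc k) b)
      splits = record
        { cover    = λ i< vi → two v<n (a< s) (b< s) i< (va s) (vb s) vi (a≁b s)
        ; sub₁     = below s
        ; sub₂     = below (flip-split s)
        ; disjoint = λ i< ai bi → apart s i< i< ai bi (rfl (equiv (suc k) (sk< s)) (proj₂ (dom E v< i< (below s i< ai)))) }

      -- This allows a formula to test one pair of representatives instead of two classes.
      uniform : ∀ {x y} → x < N → y < N → C (suc k) a x ≡ true → C (suc k) b y ≡ true → A x y ≡ A a b
      uniform x< y< ax by = let (t , h) = homogeneous v<n in
        trans (h x< y< (below s x< ax) (below (flip-split s) y< by) (apart s x< y< ax by))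
              (sym (h (a< s) (b< s) (va s) (vb s) (a≁b s)))

-- Addition, a number a being represented by the characteristic function of {t : t < a}.
Sum : ℕ → (ℕ → Bool) → (ℕ → Bool) → ℕ → Set
Sum N F G t = F t ≡ true ⊎ G t ≡ true ⊎
  ∃ λ p → p < N × ∃ λ q → q < N × ∃ λ s → s < N × (F p ≡ true × G q ≡ true × p + q ≡ s × t ≡ suc s)

-- The largest members are `a - 1` and `b - 1`, while the largest member of the sum is `a + b - 1`:
-- hence the successor in `Sum`.
sum-length : ∀ {N F G a b} → (∀ {t} → t < N → F t ≡ true ⟺ t < a) → (∀ {t} → t < N → G t ≡ true ⟺ t < b) →
  ∀ {t} → t < N → Sum N F G t ⟺ t < a + b
sum-length {N} {F} {G} {a} {b} hF hG {t} t< = to , from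
  where
  to : Sum N F G t → t < a + b
  to (inj₁ e) = ≤-trans (proj₁ (hF t<) e) (m≤m+n a b)
  to (inj₂ (inj₁ e)) = ≤-trans (proj₁ (hG t<) e) (m≤n+m b a)
  to (inj₂ (inj₂ (p , p< , q , q< , s , s< , fp , gq , refl , refl))) =
    ≤-trans (≤-reflexive (cong suc (sym (+-suc p q)))) (+-mono-≤ (proj₁ (hF p<) fp) (proj₁ (hG q<) gq))
  from : t < a + b → Sum N F G t
  from lt with t <? a | t <? b
  ... | yes l | _     = inj₁ (proj₂ (hF t<) l)
  ... | no _  | yes l = inj₂ (inj₁ (proj₂ (hG t<) l))
  ... | no ¬a | no ¬b = middle a (≮⇒≥ ¬a) (m+n∸n≡m t a) refl
    where
    middle : ∀ a' → a ≤ t → t + a ∸ a ≡ t → a ≡ a' → Sum N F G t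
    middle zero     a≤t _ refl = ⊥-elim (¬b lt)
    -- With `a = suc p`, the witnesses are the largest member `p` of `F` and `t ∸ a` in `G`.
    middle (suc p) a≤t _ refl = inj₂ (inj₂ (p , <-trans a≤t t< , t ∸ suc p , ≤-<-trans (m∸n≤m t (suc p)) t< , p + (t ∸ suc p) , s<
        , proj₂ (hF (<-trans a≤t t<)) ≤-refl , proj₂ (hG (≤-<-trans (m∸n≤m t (suc p)) t<)) q<b , refl , sym total))
      where
      total : suc (p + (t ∸ suc p)) ≡ t
      total = m+[n∸m]≡n a≤t
      s< : p + (t ∸ suc p) < N
      s< = ≤-trans (≤-reflexive total) (<⇒≤ t<)
      q<b : t ∸ suc p < b
      q<b = +-cancelˡ-< (suc p) (t ∸ suc p) b (≤-trans (≤-reflexive (cong suc total)) lt)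

module Table {N n m : ℕ} {A B : ℕ → ℕ → Bool} {C D : ℕ → ℕ → ℕ → Bool}
  (dG : Decomposition N n A C) (dH : Decomposition N m B D) where

  private
    module G = Splitting dG
    module H = Splitting dH
  open Alpha N A B

  module _ (T : ℕ → ℕ → ℕ → ℕ → ℕ → Bool) (k v l w t : ℕ) where

    -- `Rule₁` and `Rule₂` add over a split without edges between its parts, or over any split if
    -- the other class is a single vertex. `Rule₃` is the base case of value 1, whose unary form
    -- contains just 0. `Rule₄` is for two joins; it consults only `a` and `c`, since exchanging the
    -- names of the parts supplies `b` and `d`.
    Rule₁ Rule₂ Rule₃ Rule₄ Rules : Set
    Rule₁ = ∃ λ a → ∃ λ b → G.Split k v a b × (A a b ≡ false ⊎ H.NoSplit l w) × Sum N (T (suc k) a l w) (T (suc k) b l w) t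
    Rule₂ = ∃ λ c → ∃ λ d → H.Split l w c d × (B c d ≡ false ⊎ G.NoSplit k v) × Sum N (T k v (suc l) c) (T k v (suc l) d) t
    Rule₃ = G.NoSplit k v × H.NoSplit l w × t ≡ 0
    Rule₄ = ∃ λ a → ∃ λ b → G.Split k v a b × A a b ≡ true × ∃ λ c → ∃ λ d → H.Split l w c d × B c d ≡ true
            × (T (suc k) a l w t ≡ true ⊎ T k v (suc l) c t ≡ true)
    Rules = Rule₁ ⊎ Rule₂ ⊎ Rule₃ ⊎ Rule₄

  Spec : (ℕ → ℕ → ℕ → ℕ → ℕ → Bool) → ℕ → ℕ → ℕ → ℕ → Set
  Spec T k v l w = ∃ λ a → isα (C k v) (D l w) a × (∀ {t} → t < N → T k v l w t ≡ true ⟺ t < a)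

  module Step (T : ℕ → ℕ → ℕ → ℕ → ℕ → Bool) {k v l w : ℕ} (k< : k < N) (v<n : v < n) (l< : l < N) (w<m : w < m)
    (ihG : ∀ {a b} → G.Split k v a b → Spec T (suc k) a l w) (ihH : ∀ {c d} → H.Split l w c d → Spec T k v (suc l) c) where

    rule₁ : ∀ {a b} → G.Split k v a b → A a b ≡ false ⊎ H.NoSplit l w →
      ∃ λ α → isα (C k v) (D l w) α × (∀ {t} → t < N → Sum N (T (suc k) a l w) (T (suc k) b l w) t ⟺ t < α)
    rule₁ {a} {b} s cond with ihG s | ihG (G.flip-split k< v<n s)
    ... | x , αx , hx | y , αy , hy = x + y , isα-sum (G.splits k< v<n s) free free' αx αy , sum-length hx hy
      where
      clash : ∀ {i i' j j'} → i < N → i' < N → j < N → j' < N → C (suc k) a i ≡ true → C (suc k) b i' ≡ true →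
        D l w j ≡ true → D l w j' ≡ true → A i i' ≡ true → B j j' ≡ true → A a b ≡ false ⊎ H.NoSplit l w → ⊥
      clash i< i'< j< j'< ai bi' qj qj' ea eb (inj₁ no-edge) = true≢false (trans (sym ea) (trans (G.uniform k< v<n s i< i'< ai bi') no-edge))
      clash i< i'< j< j'< ai bi' qj qj' ea eb (inj₂ ns) with H.trivial l< w<m ns j< j'< qj qj'
      ... | refl = true≢false (trans (sym eb) (H.A-irr _))
      free : ∀ {i i' j j'} → i < N → i' < N → j < N → j' < N → C (suc k) a i ≡ true → C (suc k) b i' ≡ true →
        D l w j ≡ true → D l w j' ≡ true → A i i' ≡ true → B j j' ≡ true → ⊥
      free i< i'< j< j'< ai bi' qj qj' ea eb = clash i< i'< j< j'< ai bi' qj qj' ea eb cond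
      free' : ∀ {i i' j j'} → i < N → i' < N → j < N → j' < N → C (suc k) b i ≡ true → C (suc k) a i' ≡ true →
        D l w j ≡ true → D l w j' ≡ true → A i i' ≡ true → B j j' ≡ true → ⊥
      free' i< i'< j< j'< bi ai' qj qj' ea eb = clash i'< i< j'< j< ai' bi qj' qj (trans (G.A-sym _ _) ea) (trans (H.A-sym _ _) eb) cond

    rule₂ : ∀ {c d} → H.Split l w c d → B c d ≡ false ⊎ G.NoSplit k v →
      ∃ λ α → isα (C k v) (D l w) α × (∀ {t} → t < N → Sum N (T k v (suc l) c) (T k v (suc l) d) t ⟺ t < α)
    rule₂ {c} {d} s cond with ihH s | ihH (H.flip-split l< w<m s)
    ... | x , αx , hx | y , αy , hy = x + y
        , isα-swap (Alpha.isα-sum N B A (H.splits l< w<m s) free free' (isα-swap αx) (isα-swap αy)) , sum-length hx hy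
      where
      clash : ∀ {j j' i i'} → j < N → j' < N → i < N → i' < N → D (suc l) c j ≡ true → D (suc l) d j' ≡ true →
        C k v i ≡ true → C k v i' ≡ true → B j j' ≡ true → A i i' ≡ true → B c d ≡ false ⊎ G.NoSplit k v → ⊥
      clash j< j'< i< i'< cj dj' pi pi' eb ea (inj₁ no-edge) = true≢false (trans (sym eb) (trans (H.uniform l< w<m s j< j'< cj dj') no-edge))
      clash j< j'< i< i'< cj dj' pi pi' eb ea (inj₂ ns) with G.trivial k< v<n ns i< i'< pi pi'
      ... | refl = true≢false (trans (sym ea) (G.A-irr _))
      free : ∀ {j j' i i'} → j < N → j' < N → i < N → i' < N → D (suc l) c j ≡ true → D (suc l) d j' ≡ true →
        C k v i ≡ true → C k v i' ≡ true → B j j' ≡ true → A i i' ≡ true → ⊥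
      free j< j'< i< i'< cj dj' pi pi' eb ea = clash j< j'< i< i'< cj dj' pi pi' eb ea cond
      free' : ∀ {j j' i i'} → j < N → j' < N → i < N → i' < N → D (suc l) d j ≡ true → D (suc l) c j' ≡ true →
        C k v i ≡ true → C k v i' ≡ true → B j j' ≡ true → A i i' ≡ true → ⊥
      free' j< j'< i< i'< dj cj' pi pi' eb ea = clash j'< j< i'< i< cj' dj pi' pi (trans (H.A-sym _ _) eb) (trans (G.A-sym _ _) ea) cond

    rule₃ : G.NoSplit k v → H.NoSplit l w → isα (C k v) (D l w) 1
    rule₃ ns ns' = isα-singletons v< w< (G.self k< v<n) (H.self l< w<m) (G.A-irr v)
      (λ i< c → G.trivial k< v<n ns i< v< c (G.self k< v<n)) (λ j< c → H.trivial l< w<m ns' j< w< c (H.self l< w<m))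
      where
      v< = G.<n⇒<N v<n
      w< = H.<n⇒<N w<m

    pick-⊔ : ∀ {t a b} → t < a ⊔ b → t < a ⊎ t < b
    pick-⊔ {t} {a} {b} lt with ⊔-sel a b
    ... | inj₁ e = inj₁ (subst (t <_) e lt)
    ... | inj₂ e = inj₂ (subst (t <_) e lt)

    -- The maximum may be attained at `b` or `d`. The converse direction then has to rename the
    -- parts, so it ends in the existential `Rule₄` instead of the given representatives.
    rule₄ : ∀ {a b c d} → G.Split k v a b → A a b ≡ true → H.Split l w c d → B c d ≡ true →
      ∃ λ α → isα (C k v) (D l w) α × (∀ {t} → t < N →
        (T (suc k) a l w t ≡ true ⊎ T k v (suc l) c t ≡ true → t < α) × (t < α → Rule₄ T k v l w t))
    rule₄ {a} {b} {c} {d} s ab s' cd with ihG s | ihG (G.flip-split k< v<n s) | ihH s' | ihH (H.flip-split l< w<m s')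
    ... | x , αx , hx | y , αy , hy | p , αp , hp | q , αq , hq = (x ⊔ y) ⊔ (p ⊔ q)
        , isα-max (G.splits k< v<n s) (H-splits) (λ i< i'< ai bi' → trans (G.uniform k< v<n s i< i'< ai bi') ab)
            (λ j< j'< cj dj' → trans (H.uniform l< w<m s' j< j'< cj dj') cd)
            (λ j< j'< dj cj' → trans (H.A-sym _ _) (trans (H.uniform l< w<m s' j'< j< cj' dj) cd)) αx αy αp αq
        , λ t< → to t< , from t<
      where
      open Alpha.Splits
      H-splits : Splits (D l w) (D (suc l) c) (D (suc l) d)
      H-splits = let h = H.splits l< w<m s' {A} in
        record { cover = cover h ; sub₁ = sub₁ h ; sub₂ = sub₂ h ; disjoint = disjoint h }
      to : ∀ {t} → t < N → T (suc k) a l w t ≡ true ⊎ T k v (suc l) c t ≡ true → t < (x ⊔ y) ⊔ (p ⊔ q)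
      to t< (inj₁ e) = ≤-trans (proj₁ (hx t<) e) (≤-trans (m≤m⊔n x y) (m≤m⊔n _ _))
      to t< (inj₂ e) = ≤-trans (proj₁ (hp t<) e) (≤-trans (m≤m⊔n p q) (m≤n⊔m (x ⊔ y) _))
      ba : A b a ≡ true
      ba = trans (G.A-sym b a) ab
      dc : B d c ≡ true
      dc = trans (H.A-sym d c) cd
      from : ∀ {t} → t < N → t < (x ⊔ y) ⊔ (p ⊔ q) → Rule₄ T k v l w t
      from t< lt with pick-⊔ {a = x ⊔ y} lt
      ... | inj₁ lt' with pick-⊔ {a = x} lt'
      ...   | inj₁ z = a , b , s , ab , c , d , s' , cd , inj₁ (proj₂ (hx t<) z)
      ...   | inj₂ z = b , a , G.flip-split k< v<n s , ba , c , d , s' , cd , inj₁ (proj₂ (hy t<) z)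
      from t< lt | inj₂ lt' with pick-⊔ {a = p} lt'
      ...   | inj₁ z = a , b , s , ab , c , d , s' , cd , inj₂ (proj₂ (hp t<) z)
      ...   | inj₂ z = a , b , s , ab , d , c , H.flip-split l< w<m s' , dc , inj₂ (proj₂ (hq t<) z)

    sound : ∀ {t} → t < N → Rules T k v l w t → ∃ λ α → isα (C k v) (D l w) α × t < α
    sound t< (inj₁ (a , b , s , cond , sum)) = let (α , isa , h) = rule₁ s cond in α , isa , proj₁ (h t<) sum
    sound t< (inj₂ (inj₁ (c , d , s , cond , sum))) = let (α , isa , h) = rule₂ s cond in α , isa , proj₁ (h t<) sum
    sound t< (inj₂ (inj₂ (inj₁ (ns , ns' , refl)))) = 1 , rule₃ ns ns' , s≤s z≤n
    sound t< (inj₂ (inj₂ (inj₂ (a , b , s , ab , c , d , s' , cd , x)))) = let (α , isa , h) = rule₄ s ab s' cd in α , isa , proj₁ (h t<) x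

    complete : ∃ λ α → isα (C k v) (D l w) α × (∀ {t} → t < N → t < α → Rules T k v l w t)
    complete with G.splits? k v | H.splits? l w
    ... | inj₂ ns | inj₂ ns' = 1 , rule₃ ns ns' , λ _ lt → inj₂ (inj₂ (inj₁ (ns , ns' , n≤0⇒n≡0 (≤-pred lt))))
    ... | inj₁ (a , b , s) | inj₂ ns' = let (α , isa , h) = rule₁ s (inj₂ ns') in
            α , isa , λ t< lt → inj₁ (a , b , s , inj₂ ns' , proj₂ (h t<) lt)
    ... | inj₂ ns | inj₁ (c , d , s') = let (α , isa , h) = rule₂ s' (inj₂ ns) in
            α , isa , λ t< lt → inj₂ (inj₁ (c , d , s' , inj₂ ns , proj₂ (h t<) lt))
    ... | inj₁ (a , b , s) | inj₁ (c , d , s') = both (A a b) (B c d) refl refl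
      where
      both : ∀ x y → A a b ≡ x → B c d ≡ y → ∃ λ α → isα (C k v) (D l w) α × (∀ {t} → t < N → t < α → Rules T k v l w t)
      both false _ ab cd = let (α , isa , h) = rule₁ s (inj₁ ab) in α , isa , λ t< lt → inj₁ (a , b , s , inj₁ ab , proj₂ (h t<) lt)
      both true false ab cd = let (α , isa , h) = rule₂ s' (inj₁ cd) in α , isa , λ t< lt → inj₂ (inj₁ (c , d , s' , inj₁ cd , proj₂ (h t<) lt))
      both true true ab cd = let (α , isa , h) = rule₄ s ab s' cd in α , isa , λ t< lt → inj₂ (inj₂ (inj₂ (proj₂ (h t<) lt)))

  -- Every split makes one of the two classes smaller, so the sum of their sizes bounds the rounds
  -- needed. An entry may be derived by another rule than the one chosen in `complete`; `isα-unique`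
  -- identifies the values.
  table-correct : (T : ℕ → ℕ → ℕ → ℕ → ℕ → ℕ → Bool) →
    (∀ r {k v l w t} → k < N → v < N → l < N → w < N → t < N → T (suc r) k v l w t ≡ true ⟺ Rules (T r) k v l w t) →
    ∀ r {k v l w} → k < N → v < n → l < N → w < m → cnt N (C k v) + cnt N (D l w) ≤ r → Spec (T r) k v l w
  table-correct T step zero k< v<n l< w<m le =
    ⊥-elim (<⇒≱ (cnt-pos N (G.<n⇒<N v<n) (G.self k< v<n)) (≤-trans (m≤m+n _ _) le))
  table-correct T step (suc r) {k} {v} {l} {w} k< v<n l< w<m le =
    let (α , isa , h) = complete in
    α , isa , λ t< → (λ e → let (α' , isa' , lt) = sound t< (proj₁ (step r k< v< l< w< t<) e) in subst (_ <_) (isα-unique isa' isa) lt)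
                   , (λ lt → proj₂ (step r k< v< l< w< t<) (h t< lt))
    where
    v< = G.<n⇒<N v<n
    w< = H.<n⇒<N w<m
    open Step (T r) k< v<n l< w<m
      (λ s → table-correct T step r (G.sk< s) (G.a<n k< v<n s) l< w<m (≤-pred (≤-trans (+-monoˡ-≤ _ (G.smaller k< v<n s)) le)))
      (λ s → table-correct T step r k< v<n (H.sk< s) (H.a<n l< w<m s)
        (≤-pred (≤-trans (≤-reflexive (sym (+-suc _ _))) (≤-trans (+-monoʳ-≤ _ (H.smaller l< w<m s)) le))))

-- Formulas read as propositions

iterate-suc : ∀ {A : Set} n (f : A → A) x → iterate (suc n) f x ≡ f (iterate n f x)
iterate-suc zero    f x = refl
iterate-suc (suc n) f x = iterate-suc n f (f x)

not-true : ∀ {b} → not b ≡ true → ¬ (b ≡ true)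
not-true {false} _ ()

not-true⁻ : ∀ {b} → ¬ (b ≡ true) → not b ≡ true
not-true⁻ {false} _ = refl
not-true⁻ {true}  h = ⊥-elim (h refl)

anyFrom-true⁻ : ∀ x n {f : ℕ → Bool} → anyFrom x n f ≡ true → ∃ λ y → y < x + n × f y ≡ true
anyFrom-true⁻ x (suc n) {f} e with ∨-true⁻ {f x} e
... | inj₁ fx = x , ≤-trans (s≤s (m≤m+n x n)) (≤-reflexive (sym (+-suc x n))) , fx
... | inj₂ e' with anyFrom-true⁻ (suc x) n e'
...   | y , lt , fy = y , ≤-trans lt (≤-reflexive (sym (+-suc x n))) , fy

anyFrom-true : ∀ x n {f : ℕ → Bool} {y} → x ≤ y → y < x + n → f y ≡ true → anyFrom x n f ≡ true
anyFrom-true x zero    le lt fy = ⊥-elim (<⇒≱ (≤-trans lt (≤-reflexive (+-identityʳ x))) le)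
anyFrom-true x (suc n) {f} {y} le lt fy with f x in fx | m≤n⇒m<n∨m≡n le
... | true  | _        = refl
... | false | inj₂ refl = ⊥-elim (true≢false (trans (sym fy) fx))
... | false | inj₁ x<y = anyFrom-true (suc x) n x<y (≤-trans lt (≤-reflexive (+-suc x n))) fy

module Truth (V' X N : ℕ) where

  open Syntax V' X

  -- With genuine quantifiers a formula can be proved by giving witnesses. Since `Holds` computes on
  -- concrete formulas, later proofs write the unfolded type down directly.
  Holds : Store → Env → Fm → Set
  Holds S ρ (v ≐ w)  = ρ w ≡ ρ v
  Holds S ρ (v ⋖ w)  = ρ w ≡ suc (ρ v)
  Holds S ρ (Y ∋ vs) = S Y (mem (Vec.map ρ vs)) ≡ true
  Holds S ρ (Y ∋ᵇ v) = S Y (base (ρ v)) ≡ true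
  Holds S ρ (¬ᶠ φ)   = ¬ Holds S ρ φ
  Holds S ρ (φ ∧ᶠ ψ) = Holds S ρ φ × Holds S ρ ψ
  Holds S ρ (φ ∨ᶠ ψ) = Holds S ρ φ ⊎ Holds S ρ ψ
  Holds S ρ (∃ᶠ v φ) = ∃ λ x → x < N × Holds S (ρ [ v ≔ x ]) φ

  holds : ∀ S ρ φ → sem N S ρ φ ≡ true → Holds S ρ φ
  holds⁻ : ∀ S ρ φ → Holds S ρ φ → sem N S ρ φ ≡ true
  holds S ρ (v ≐ w)  e = ≡ᵇ-true⁻ e
  holds S ρ (v ⋖ w)  e = ≡ᵇ-true⁻ e
  holds S ρ (Y ∋ vs) e = e
  holds S ρ (Y ∋ᵇ v) e = e
  holds S ρ (¬ᶠ φ)   e = λ h → not-true e (holds⁻ S ρ φ h)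
  holds S ρ (φ ∧ᶠ ψ) e = holds S ρ φ (proj₁ (∧-true⁻ e)) , holds S ρ ψ (proj₂ (∧-true⁻ e))
  holds S ρ (φ ∨ᶠ ψ) e with ∨-true⁻ {sem N S ρ φ} e
  ... | inj₁ x = inj₁ (holds S ρ φ x)
  ... | inj₂ y = inj₂ (holds S ρ ψ y)
  holds S ρ (∃ᶠ v φ) e with anyFrom-true⁻ 0 N e
  ... | x , x< , ex = x , x< , holds S (ρ [ v ≔ x ]) φ ex
  holds⁻ S ρ (v ≐ w)  e = ≡ᵇ-true e
  holds⁻ S ρ (v ⋖ w)  e = ≡ᵇ-true e
  holds⁻ S ρ (Y ∋ vs) e = e
  holds⁻ S ρ (Y ∋ᵇ v) e = e
  holds⁻ S ρ (¬ᶠ φ)   h = not-true⁻ (λ e → h (holds S ρ φ e))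
  holds⁻ S ρ (φ ∧ᶠ ψ) (h , k) = ∧-true (holds⁻ S ρ φ h) (holds⁻ S ρ ψ k)
  holds⁻ S ρ (φ ∨ᶠ ψ) (inj₁ h) rewrite holds⁻ S ρ φ h = refl
  holds⁻ S ρ (φ ∨ᶠ ψ) (inj₂ h) with sem N S ρ φ
  ... | true  = refl
  ... | false = holds⁻ S ρ ψ h
  holds⁻ S ρ (∃ᶠ v φ) (x , x< , h) = anyFrom-true 0 N z≤n x< (holds⁻ S (ρ [ v ≔ x ]) φ h)

  touches : Fin X → Stm → Bool
  touches Y (asg k Z φ) = Y =? Z
  touches Y (s ⨟ t)     = touches Y s ∨ touches Y t
  touches Y (rep s)     = touches Y s

  untouched : ∀ s Y → touches Y s ≡ false → ∀ S a → semS N s S Y a ≡ S Y a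
  untouched (asg k Z φ) Y e S a = trans (assign-≡ N k Z φ S Y a) (cong (λ b → if b ∧ kind k (isBase a) then sem N S (envOf (arity k) a) φ else S Y a) e)
  untouched (s ⨟ t) Y e S a with touches Y s in es
  ... | false = trans (untouched t Y e (semS N s S) a) (untouched s Y es S a)
  untouched (rep s) Y e S a = go N S
    where
    go : ∀ n S → iterate n (semS N s) S Y a ≡ S Y a
    go zero    S = refl
    go (suc n) S = trans (go n (semS N s S)) (untouched s Y e S a)

  module Rounds (Y : Fin X) (φ : Fm) (S₀ : Store) where

    round : ℕ → Store
    round r = iterate r (semS N (asg false Y φ)) S₀

    -- The last round is unfolded, not the first: the new relation is read off the store one round
    -- earlier.
    round-suc : ∀ r x → round (suc r) Y (mem x) ≡ true ⟺ Holds (round r) (envOf 5 (mem x)) φ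
    round-suc r x = (λ e → holds _ _ φ (trans (sym eq) e)) , (λ h → trans eq (holds⁻ _ _ φ h))
      where
      eq : round (suc r) Y (mem x) ≡ sem N (round r) (envOf 5 (mem x)) φ
      eq = trans (cong (λ S → S Y (mem x)) (iterate-suc r (semS N (asg false Y φ)) S₀))
                 (trans (assign-≡ N false Y φ (round r) Y (mem x))
                        (cong (λ b → if b ∧ true then sem N (round r) (envOf 5 (mem x)) φ else round r Y (mem x)) (=?-refl Y)))

    round-other : ∀ r Z → (Z =? Y) ≡ false → ∀ a → round r Z a ≡ S₀ Z a
    round-other zero    Z e a = refl
    round-other (suc r) Z e a = trans (cong (λ S → S Z a) (iterate-suc r (semS N (asg false Y φ)) S₀))
      (trans (untouched (asg false Y φ) Z e (round r) a) (round-other r Z e a))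

-- The formulas of the algorithm

r₁ : {A : Set} → A → Vec A 5
r₁ a = a ∷ a ∷ a ∷ a ∷ a ∷ []

r₂ : {A : Set} → A → A → Vec A 5
r₂ a b = a ∷ b ∷ b ∷ b ∷ b ∷ []

r₃ : {A : Set} → A → A → A → Vec A 5
r₃ a b c = a ∷ b ∷ c ∷ c ∷ c ∷ []

r₅ : {A : Set} → A → A → A → A → A → Vec A 5
r₅ a b c d e = a ∷ b ∷ c ∷ d ∷ e ∷ []

-- Relations of smaller arity ignore the trailing coordinates.
module Formulas where

  open Syntax 6 13 public

  pattern IN1 = zero
  pattern INS = suc zero
  pattern ADD = suc (suc zero)
  pattern MUL = suc (suc (suc zero))
  pattern VG  = suc (suc (suc (suc zero)))
  pattern VH  = suc (suc (suc (suc (suc zero))))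
  pattern AG  = suc (suc (suc (suc (suc (suc zero)))))
  pattern AH  = suc (suc (suc (suc (suc (suc (suc zero))))))
  pattern CG  = suc (suc (suc (suc (suc (suc (suc (suc zero)))))))
  pattern CH  = suc (suc (suc (suc (suc (suc (suc (suc (suc zero))))))))
  pattern TT  = suc (suc (suc (suc (suc (suc (suc (suc (suc (suc zero)))))))))
  pattern BIT = suc (suc (suc (suc (suc (suc (suc (suc (suc (suc (suc zero))))))))))
  pattern OUT = suc (suc (suc (suc (suc (suc (suc (suc (suc (suc (suc (suc zero)))))))))))

  v0 v1 v2 v3 v4 v5 v6 v7 v8 v9 v10 : Fin V
  v0  = # 0
  v1  = # 1
  v2  = # 2
  v3  = # 3
  v4  = # 4
  v5  = # 5
  v6  = # 6
  v7  = # 7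
  v8  = # 8
  v9  = # 9
  v10 = # 10

  -- The last arguments of these abbreviations are the variables they bind.
  isZero : Fin V → Fin V → Fm
  isZero x f = ¬ᶠ ∃ᶠ f (f ⋖ x)

  less : Fin V → Fin V → Fin V → Fin V → Fm
  less x y f g = ∃ᶠ f (x ⋖ f ∧ᶠ ∃ᶠ g (ADD ∋ r₃ g f y))

  addF mulF vgF vhF agF ahF : Fm
  addF = v2 ≐ v1 ∧ᶠ isZero v0 v5
       ∨ᶠ ∃ᶠ v5 (∃ᶠ v6 (v5 ⋖ v0 ∧ᶠ v6 ⋖ v2 ∧ᶠ ADD ∋ r₃ v5 v1 v6))
  mulF = isZero v0 v5 ∧ᶠ isZero v2 v5
       ∨ᶠ ∃ᶠ v5 (∃ᶠ v6 (v5 ⋖ v0 ∧ᶠ MUL ∋ r₃ v5 v1 v6 ∧ᶠ ADD ∋ r₃ v6 v1 v2))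

  isOrderG : Fin V → Fin V → Fm
  isOrderG x f = ∃ᶠ f (MUL ∋ r₃ x x f ∧ᶠ INS ∋ᵇ f)

  -- Nothing marks the end of the second matrix, so its size is found from the last position: `h`,
  -- the separator position plus the square of `x`, must have no successor.
  isOrderH : Fin V → Fin V → Fin V → Fin V → Fin V → Fm
  isOrderH x f g h i = ∃ᶠ f (∃ᶠ g (∃ᶠ h (INS ∋ᵇ f ∧ᶠ MUL ∋ r₃ x x g ∧ᶠ ADD ∋ r₃ f g h ∧ᶠ ¬ᶠ ∃ᶠ i (h ⋖ i))))

  vgF = ∃ᶠ v5 (isOrderG v5 v6 ∧ᶠ less v0 v5 v6 v7)
  vhF = ∃ᶠ v5 (isOrderH v5 v6 v7 v8 v9 ∧ᶠ less v0 v5 v6 v7)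

  agF = VG ∋ r₁ v0 ∧ᶠ VG ∋ r₁ v1 ∧ᶠ
    ∃ᶠ v5 (isOrderG v5 v6 ∧ᶠ ∃ᶠ v6 (∃ᶠ v7 (MUL ∋ r₃ v0 v5 v6 ∧ᶠ ADD ∋ r₃ v6 v1 v7 ∧ᶠ IN1 ∋ᵇ v7)))
  -- The matrix of `H` starts right behind the separator, whence the final step from `v9` to `v10`.
  ahF = VH ∋ r₁ v0 ∧ᶠ VH ∋ r₁ v1 ∧ᶠ
    ∃ᶠ v5 (isOrderH v5 v6 v7 v8 v9 ∧ᶠ ∃ᶠ v6 (∃ᶠ v7 (∃ᶠ v8 (∃ᶠ v9 (∃ᶠ v10
      (MUL ∋ r₃ v0 v5 v6 ∧ᶠ ADD ∋ r₃ v6 v1 v7 ∧ᶠ INS ∋ᵇ v8 ∧ᶠ ADD ∋ r₃ v8 v7 v9 ∧ᶠ v9 ⋖ v10 ∧ᶠ IN1 ∋ᵇ v10))))))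

  reachF coreachF : Fin 13 → Fin 13 → Fin V → Fin V → Fin V → Fin V → Fm
  reachF A C k u x f   = x ≐ u ∨ᶠ A ∋ r₂ u x ∨ᶠ ∃ᶠ f (C ∋ r₃ k u f ∧ᶠ A ∋ r₂ u f ∧ᶠ A ∋ r₂ f x)
  coreachF A C k u x f = x ≐ u ∨ᶠ ¬ᶠ A ∋ r₂ u x ∨ᶠ ∃ᶠ f (C ∋ r₃ k u f ∧ᶠ ¬ᶠ A ∋ r₂ u f ∧ᶠ ¬ᶠ A ∋ r₂ f x)

  connectedF : Fin 13 → Fin 13 → Fin V → Fin V → Fin V → Fin V → Fm
  connectedF A C k u f g = ¬ᶠ ∃ᶠ f (C ∋ r₃ k u f ∧ᶠ ¬ᶠ reachF A C k u f g)

  sideF : Fin 13 → Fin 13 → Fin V → Fin V → Fin V → Fm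
  sideF A C k u x = connectedF A C k u v7 v8 ∧ᶠ coreachF A C k u x v7
                  ∨ᶠ ¬ᶠ connectedF A C k u v7 v8 ∧ᶠ reachF A C k u x v7

  sameF : Fm → Fm → Fm
  sameF φ ψ = φ ∧ᶠ ψ ∨ᶠ ¬ᶠ φ ∧ᶠ ¬ᶠ ψ

  classF : Fin 13 → Fin 13 → Fin 13 → Fm
  classF V A C = isZero v0 v5 ∧ᶠ V ∋ r₁ v1 ∧ᶠ V ∋ r₁ v2
    ∨ᶠ ∃ᶠ v5 (v5 ⋖ v0 ∧ᶠ C ∋ r₃ v5 v1 v2 ∧ᶠ ∃ᶠ v6 (C ∋ r₃ v5 v1 v6 ∧ᶠ ¬ᶠ ∃ᶠ v7 (C ∋ r₃ v5 v1 v7 ∧ᶠ less v7 v6 v8 v9)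
         ∧ᶠ sameF (sideF A C v5 v6 v1) (sideF A C v5 v6 v2)))

  splitF : Fin 13 → Fin V → Fin V → Fin V → Fin V → Fin V → Fm
  splitF C k v k' a b = k ⋖ k' ∧ᶠ C ∋ r₃ k v a ∧ᶠ C ∋ r₃ k v b ∧ᶠ ¬ᶠ C ∋ r₃ k' a b

  noSplitF : Fin 13 → Fin V → Fin V → Fm
  noSplitF C k v = ¬ᶠ ∃ᶠ v8 (∃ᶠ v9 (∃ᶠ v10 (splitF C k v v8 v9 v10)))

  sumF : (Fin V → Fm) → (Fin V → Fm) → Fm
  sumF F G = F v4 ∨ᶠ G v4 ∨ᶠ ∃ᶠ v8 (∃ᶠ v9 (∃ᶠ v10 (F v8 ∧ᶠ G v9 ∧ᶠ ADD ∋ r₃ v8 v9 v10 ∧ᶠ v10 ⋖ v4)))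

  tableF : Fm
  tableF =
       ∃ᶠ v5 (∃ᶠ v6 (∃ᶠ v7 (splitF CG v0 v1 v5 v6 v7 ∧ᶠ (¬ᶠ AG ∋ r₂ v6 v7 ∨ᶠ noSplitF CH v2 v3)
         ∧ᶠ sumF (λ t → TT ∋ r₅ v5 v6 v2 v3 t) (λ t → TT ∋ r₅ v5 v7 v2 v3 t))))
    ∨ᶠ ∃ᶠ v5 (∃ᶠ v6 (∃ᶠ v7 (splitF CH v2 v3 v5 v6 v7 ∧ᶠ (¬ᶠ AH ∋ r₂ v6 v7 ∨ᶠ noSplitF CG v0 v1)
         ∧ᶠ sumF (λ t → TT ∋ r₅ v0 v1 v5 v6 t) (λ t → TT ∋ r₅ v0 v1 v5 v7 t))))
    ∨ᶠ noSplitF CG v0 v1 ∧ᶠ noSplitF CH v2 v3 ∧ᶠ isZero v4 v5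
    ∨ᶠ ∃ᶠ v5 (∃ᶠ v6 (∃ᶠ v7 (splitF CG v0 v1 v5 v6 v7 ∧ᶠ AG ∋ r₂ v6 v7 ∧ᶠ
         ∃ᶠ v8 (∃ᶠ v9 (∃ᶠ v10 (splitF CH v2 v3 v8 v9 v10 ∧ᶠ AH ∋ r₂ v9 v10 ∧ᶠ
           (TT ∋ r₅ v5 v6 v2 v3 v4 ∨ᶠ TT ∋ r₅ v0 v1 v8 v9 v4)))))))

  -- Row `t` of `BIT` is the state of a binary counter after `t` increments, position 0 being the
  -- most significant.
  bitF : Fm
  bitF = ∃ᶠ v5 (v5 ⋖ v0 ∧ᶠ (BIT ∋ r₂ v5 v1 ∧ᶠ ¬ᶠ ones ∨ᶠ ¬ᶠ BIT ∋ r₂ v5 v1 ∧ᶠ ones))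
    where
    ones : Fm
    ones = ¬ᶠ ∃ᶠ v6 (less v1 v6 v7 v8 ∧ᶠ ¬ᶠ BIT ∋ r₂ v5 v6)

  -- Level 0 and vertex 0 name the full vertex sets. An empty graph has no class that splits, so the
  -- rules would treat it as a single vertex; the two vertex tests prevent this.
  belowF : Fin V → Fm
  belowF t = ∃ᶠ v7 (isZero v7 v8 ∧ᶠ VG ∋ r₁ v7 ∧ᶠ VH ∋ r₁ v7 ∧ᶠ TT ∋ r₅ v7 v7 v7 v7 t)

  -- Recovers a number from its unary form: it is not below itself, while its predecessor, if there
  -- is one, is.
  outF : Fm
  outF = ∃ᶠ v5 (¬ᶠ belowF v5 ∧ᶠ (isZero v5 v6 ∨ᶠ ∃ᶠ v6 (v6 ⋖ v5 ∧ᶠ belowF v6)) ∧ᶠ BIT ∋ r₂ v5 v0)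

  arith decode decompose table finish program : Stm
  arith     = rep (asg false ADD addF) ⨟ rep (asg false MUL mulF)
  decode    = asg false VG vgF ⨟ asg false VH vhF ⨟ asg false AG agF ⨟ asg false AH ahF
  decompose = rep (asg false CG (classF VG AG CG)) ⨟ rep (asg false CH (classF VH AH CH))
  table     = rep (asg false TT tableF)
  finish    = rep (asg false BIT bitF) ⨟ asg true OUT outF
  program   = arith ⨟ decode ⨟ decompose ⨟ table ⨟ finish

-- Addition, multiplication and order by iteration

module Arithmetic (N : ℕ) where

  open Formulas
  open Truth 6 13 N public

  zero-test : ∀ {p} → p < N → (¬ ∃ λ x → x < N × p ≡ suc x) ⟺ p ≡ 0
  zero-test {zero}  _  = (λ _ → refl) , (λ { _ (x , _ , ()) })
  zero-test {suc p} p< = (λ h → ⊥-elim (h (p , <-trans (n<1+n p) p< , refl))) , (λ ())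

  Added Multiplied : Store → Set
  Added S      = ∀ {p q t} → p < N → q < N → t < N → S ADD (mem (r₃ p q t)) ≡ true ⟺ p + q ≡ t
  Multiplied S = ∀ {p q t} → p < N → q < N → t < N → S MUL (mem (r₃ p q t)) ≡ true ⟺ p * q ≡ t

  -- After `r` rounds the relation is right for first summands below `r`, whatever it contained at
  -- the start.
  added : ∀ S₀ → Added (semS N (rep (asg false ADD addF)) S₀)
  added S₀ p< q< t< = go N p< p< q< t<
    where
    open Rounds ADD addF S₀
    go : ∀ r {p q t} → p < r → p < N → q < N → t < N → round r ADD (mem (r₃ p q t)) ≡ true ⟺ p + q ≡ t
    go (suc r) {p} {q} {t} p<r p< q< t< = (λ e → to (proj₁ (round-suc r _) e)) , (λ e → proj₂ (round-suc r _) (from p p<r p< refl t t< refl e))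
      where
      Step : Set
      Step = (q ≡ t × (¬ ∃ λ x → x < N × p ≡ suc x))
           ⊎ ∃ λ x → x < N × ∃ λ y → y < N × (p ≡ suc x × t ≡ suc y × round r ADD (mem (r₃ x q y)) ≡ true)
      to : Step → p + q ≡ t
      to (inj₁ (e , nz)) = trans (cong (_+ q) (proj₁ (zero-test p<) nz)) e
      to (inj₂ (x , x< , y , y< , refl , refl , e)) = cong suc (proj₁ (go r (≤-pred p<r) x< q< y<) e)
      from : ∀ p' → p' < suc r → p' < N → p ≡ p' → ∀ t' → t' < N → t ≡ t' → p + q ≡ t → Step
      from zero     _    _   refl _        _   _    e = inj₁ (e , proj₂ (zero-test p<) refl)
      from (suc p') p'<r p'< refl (suc t') t'< refl e = inj₂ (p' , <-trans (n<1+n p') p'< , t' , <-trans (n<1+n t') t'< , refl , refl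
        , proj₂ (go r (≤-pred p'<r) (<-trans (n<1+n p') p'<) q< (<-trans (n<1+n t') t'<)) (suc-injective e))

  -- Partial products do not exceed the final product, so they are all available as witnesses below
  -- N.
  multiplied : ∀ S₀ → Added S₀ → Multiplied (semS N (rep (asg false MUL mulF)) S₀)
  multiplied S₀ add p< q< t< = go N p< p< q< t<
    where
    open Rounds MUL mulF S₀
    go : ∀ r {p q t} → p < r → p < N → q < N → t < N → round r MUL (mem (r₃ p q t)) ≡ true ⟺ p * q ≡ t
    go (suc r) {p} {q} {t} p<r p< q< t< = (λ e → to (proj₁ (round-suc r _) e)) , (λ e → proj₂ (round-suc r _) (from p p<r p< refl e))
      where
      addR : ∀ {p q t} → p < N → q < N → t < N → round r ADD (mem (r₃ p q t)) ≡ true ⟺ p + q ≡ t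
      addR {p} {q} {t} a b c = subst (λ z → (z ≡ true) ⟺ (p + q ≡ t)) (sym (round-other r ADD refl (mem (r₃ p q t)))) (add a b c)
      Step : Set
      Step = ((¬ ∃ λ x → x < N × p ≡ suc x) × (¬ ∃ λ x → x < N × t ≡ suc x))
           ⊎ ∃ λ x → x < N × ∃ λ y → y < N × (p ≡ suc x × round r MUL (mem (r₃ x q y)) ≡ true × round r ADD (mem (r₃ y q t)) ≡ true)
      to : Step → p * q ≡ t
      to (inj₁ (pz , tz)) = trans (cong (_* q) (proj₁ (zero-test p<) pz)) (sym (proj₁ (zero-test t<) tz))
      to (inj₂ (x , x< , y , y< , refl , e , f)) = trans (cong (q +_) (proj₁ (go r (≤-pred p<r) x< q< y<) e)) (trans (+-comm q y) (proj₁ (addR y< q< t<) f))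
      from : ∀ p' → p' < suc r → p' < N → p ≡ p' → p * q ≡ t → Step
      from zero     _    _   refl e = inj₁ (proj₂ (zero-test p<) refl , proj₂ (zero-test t<) (sym e))
      from (suc p') p'<r p'< refl e = inj₂ (p' , p'<' , p' * q , y< , refl , proj₂ (go r (≤-pred p'<r) p'<' q< y<) refl
        , proj₂ (addR y< q< t<) (trans (+-comm (p' * q) q) e))
        where
        p'<' = <-trans (n<1+n p') p'<
        y< : p' * q < N
        y< = ≤-<-trans (≤-trans (m≤n+m (p' * q) q) (≤-reflexive e)) t<

  Less : Store → ℕ → ℕ → Set
  Less S x y = ∃ λ s → s < N × (s ≡ suc x × ∃ λ d → d < N × S ADD (mem (r₃ d s y)) ≡ true)

  less-⟺ : ∀ {S x y} → Added S → y < N → Less S x y ⟺ x < y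
  less-⟺ {S} {x} {y} add y< = to , from
    where
    to : Less S x y → x < y
    to (s , s< , refl , d , d< , e) = ≤-trans (m≤n+m (suc x) d) (≤-reflexive (proj₁ (add d< s< y<) e))
    from : x < y → Less S x y
    from lt = suc x , ≤-<-trans lt y< , refl , y ∸ suc x , ≤-<-trans (m∸n≤m y (suc x)) y<
            , proj₂ (add (≤-<-trans (m∸n≤m y (suc x)) y<) (≤-<-trans lt y<) y<) (m∸n+n≡m lt)

  -- A frame rule: what is known of a relation survives statements that do not assign it, a
  -- condition settled by computation.
  keep : ∀ s Y → touches Y s ≡ false → ∀ {S a P} → S Y a ≡ true ⟺ P → semS N s S Y a ≡ true ⟺ P
  keep s Y e {S} {a} {P} h = subst (λ b → (b ≡ true) ⟺ P) (sym (untouched s Y e S a)) h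

  assigned : ∀ {Y φ S x} → semS N (asg false Y φ) S Y (mem x) ≡ true ⟺ Holds S (envOf 5 (mem x)) φ
  assigned {Y} {φ} {S} {x} = Rounds.round-suc Y φ S 0 x

-- Decoding the two graphs from the input word

-- The input shows only the squares of the two orders.
square-injective : ∀ {x y} → x * x ≡ y * y → x ≡ y
square-injective {x} {y} e with <-cmp x y
... | tri≈ _ x≡y _ = x≡y
... | tri< lt _ _ = ⊥-elim (<⇒≢ (*-mono-< lt lt) e)
... | tri> _ _ gt = ⊥-elim (<⇒≢ (*-mono-< gt gt) (sym e))

m≤m*m : ∀ m → m ≤ m * m
m≤m*m zero    = z≤n
m≤m*m (suc m) = m≤m+n (suc m) (m * suc m)

matrix-bound : ∀ {i j n} → i < n → j < n → i * n + j < n * n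
matrix-bound {i} {j} {n} i< j< = ≤-trans (≤-reflexive (sym (+-suc (i * n) j))) (≤-trans (+-monoʳ-≤ (i * n) j<)
  (≤-trans (≤-reflexive (+-comm (i * n) n)) (*-monoˡ-≤ n i<)))

module Decode (n m : ℕ) (A B : ℕ → ℕ → Bool) where

  open Formulas

  -- The length of the input: two adjacency matrices and a separator.
  N : ℕ
  N = n * n + suc (m * m)

  open Arithmetic N public

  record Input (S : Store) : Set where
    field
      separator : ∀ {p} → p < N → S INS (base p) ≡ true ⟺ p ≡ n * n
      bitG      : ∀ {i j} → i < n → j < n → S IN1 (base (i * n + j)) ≡ true ⟺ A i j ≡ true
      bitH      : ∀ {i j} → i < m → j < m → S IN1 (base (suc (n * n + (i * m + j)))) ≡ true ⟺ B i j ≡ true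
  open Input

  n<N : n < N
  n<N = ≤-trans (s≤s (≤-trans (m≤m*m n) (m≤m+n (n * n) (m * m)))) (≤-reflexive (sym (+-suc (n * n) (m * m))))

  m<N : m < N
  m<N = ≤-trans (s≤s (≤-trans (m≤m*m m) (m≤n+m (m * m) (n * n)))) (≤-reflexive (sym (+-suc (n * n) (m * m))))

  nn<N : n * n < N
  nn<N = ≤-trans (s≤s (m≤m+n (n * n) (m * m))) (≤-reflexive (sym (+-suc (n * n) (m * m))))

  nn+mm<N : n * n + m * m < N
  nn+mm<N = ≤-reflexive (sym (+-suc (n * n) (m * m)))

  OrderG OrderH : Store → ℕ → Set
  OrderG S x = ∃ λ p → p < N × (S MUL (mem (r₃ x x p)) ≡ true × S INS (base p) ≡ true)
  OrderH S x = ∃ λ f → f < N × ∃ λ g → g < N × ∃ λ h → h < N ×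
    (S INS (base f) ≡ true × S MUL (mem (r₃ x x g)) ≡ true × S ADD (mem (r₃ f g h)) ≡ true × ¬ ∃ λ i → i < N × i ≡ suc h)

  module _ {S : Store} (inp : Input S) (add : Added S) (mul : Multiplied S) where

    orderG : ∀ {x} → x < N → OrderG S x ⟺ x ≡ n
    orderG x< = (λ { (p , p< , e , s) → square-injective (trans (proj₁ (mul x< x< p<) e) (proj₁ (separator inp p<) s)) })
              , (λ { refl → n * n , nn<N , proj₂ (mul x< x< nn<N) refl , proj₂ (separator inp nn<N) refl })

    orderH : ∀ {x} → x < N → OrderH S x ⟺ x ≡ m
    orderH {x} x< = to , from
      where
      to : OrderH S x → x ≡ m
      to (f , f< , g , g< , h , h< , ef , eg , eh , last) = square-injective (trans (proj₁ (mul x< x< g<) eg)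
        (+-cancelˡ-≡ (n * n) g (m * m) (trans (cong (_+ g) (sym (proj₁ (separator inp f<) ef))) (trans (proj₁ (add f< g< h<) eh) h≡))))
        where
        h≡ : h ≡ n * n + m * m
        h≡ with m≤n⇒m<n∨m≡n h<
        ... | inj₁ lt = ⊥-elim (last (suc h , lt , refl))
        ... | inj₂ e  = suc-injective (trans e (+-suc (n * n) (m * m)))
      from : x ≡ m → OrderH S x
      from refl = n * n , nn<N , m * m , mm< , n * n + m * m , nn+mm<N , proj₂ (separator inp nn<N) refl , proj₂ (mul x< x< mm<) refl
                , proj₂ (add nn<N mm< nn+mm<N) refl , λ { (i , i< , refl) → <-irrefl (sym (+-suc (n * n) (m * m))) i< }
        where
        mm< : m * m < N
        mm< = ≤-<-trans (m≤n+m (m * m) (n * n)) nn+mm<N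

  Vertex : Store → Fin 13 → ℕ → Set
  Vertex S Y k = ∀ {i} → i < N → S Y (mem (r₁ i)) ≡ true ⟺ i < k

  Adjacent : Store → Fin 13 → (ℕ → ℕ → Bool) → Set
  Adjacent S Y E = ∀ {i j} → i < N → j < N → S Y (mem (r₂ i j)) ≡ true ⟺ E i j ≡ true

  vertexG : ∀ {S} → Input S → Added S → Multiplied S → Vertex (semS N (asg false VG vgF) S) VG n
  vertexG {S} inp add mul {i} i< = (λ e → to (proj₁ (assigned {VG} {vgF} {S} {r₁ i}) e)) , (λ lt → proj₂ (assigned {VG} {vgF} {S} {r₁ i}) (from lt))
    where
    to : (∃ λ x → x < N × (OrderG S x × Less S i x)) → i < n
    to (x , x< , o , l) = ≤-trans (proj₁ (less-⟺ {S} add x<) l) (≤-reflexive (proj₁ (orderG inp add mul x<) o))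
    from : i < n → ∃ λ x → x < N × (OrderG S x × Less S i x)
    from lt = n , n<N , proj₂ (orderG inp add mul n<N) refl , proj₂ (less-⟺ {S} add n<N) lt

  vertexH : ∀ {S} → Input S → Added S → Multiplied S → Vertex (semS N (asg false VH vhF) S) VH m
  vertexH {S} inp add mul {i} i< = (λ e → to (proj₁ (assigned {VH} {vhF} {S} {r₁ i}) e)) , (λ lt → proj₂ (assigned {VH} {vhF} {S} {r₁ i}) (from lt))
    where
    to : (∃ λ x → x < N × (OrderH S x × Less S i x)) → i < m
    to (x , x< , o , l) = ≤-trans (proj₁ (less-⟺ {S} add x<) l) (≤-reflexive (proj₁ (orderH inp add mul x<) o))
    from : i < m → ∃ λ x → x < N × (OrderH S x × Less S i x)
    from lt = m , m<N , proj₂ (orderH inp add mul m<N) refl , proj₂ (less-⟺ {S} add m<N) lt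

  -- The vertex tests in `agF` guard the address `i * n + j`: a column index from `n` on would hit
  -- an entry of another row or leave the matrix.
  adjacentG : ∀ {S} → Input S → Added S → Multiplied S → Vertex S VG n → (∀ {i j} → A i j ≡ true → i < n × j < n) →
    Adjacent (semS N (asg false AG agF) S) AG A
  adjacentG {S} inp add mul ver supp {i} {j} i< j< = (λ e → to (proj₁ (assigned {AG} {agF} {S} {r₂ i j}) e)) , (λ e → proj₂ (assigned {AG} {agF} {S} {r₂ i j}) (from e))
    where
    Step : Set
    Step = S VG (mem (r₁ i)) ≡ true × S VG (mem (r₁ j)) ≡ true × ∃ λ x → x < N × (OrderG S x ×
      ∃ λ a → a < N × ∃ λ b → b < N × (S MUL (mem (r₃ i x a)) ≡ true × S ADD (mem (r₃ a j b)) ≡ true × S IN1 (base b) ≡ true))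
    to : Step → A i j ≡ true
    to (vi , vj , x , x< , o , a , a< , b , b< , ea , eb , e)
      with proj₁ (orderG inp add mul x<) o
    ... | refl with proj₁ (mul i< x< a<) ea
    ...   | refl with proj₁ (add a< j< b<) eb
    ...     | refl = proj₁ (bitG inp (proj₁ (ver i<) vi) (proj₁ (ver j<) vj)) e
    from : A i j ≡ true → Step
    from e = proj₂ (ver i<) i<n , proj₂ (ver j<) j<n , n , n<N , proj₂ (orderG inp add mul n<N) refl
           , i * n , a< , i * n + j , b< , proj₂ (mul i< n<N a<) refl , proj₂ (add a< j< b<) refl , proj₂ (bitG inp i<n j<n) e
      where
      i<n = proj₁ (supp e)
      j<n = proj₂ (supp e)
      b< : i * n + j < N
      b< = <-trans (matrix-bound i<n j<n) nn<N
      a< : i * n < N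
      a< = ≤-<-trans (m≤m+n (i * n) j) b<

  adjacentH : ∀ {S} → Input S → Added S → Multiplied S → Vertex S VH m → (∀ {i j} → B i j ≡ true → i < m × j < m) →
    Adjacent (semS N (asg false AH ahF) S) AH B
  adjacentH {S} inp add mul ver supp {i} {j} i< j< = (λ e → to (proj₁ (assigned {AH} {ahF} {S} {r₂ i j}) e)) , (λ e → proj₂ (assigned {AH} {ahF} {S} {r₂ i j}) (from e))
    where
    Step : Set
    Step = S VH (mem (r₁ i)) ≡ true × S VH (mem (r₁ j)) ≡ true × ∃ λ x → x < N × (OrderH S x ×
      ∃ λ a → a < N × ∃ λ b → b < N × ∃ λ s → s < N × ∃ λ c → c < N × ∃ λ d → d < N ×
      (S MUL (mem (r₃ i x a)) ≡ true × S ADD (mem (r₃ a j b)) ≡ true × S INS (base s) ≡ true × S ADD (mem (r₃ s b c)) ≡ true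
       × d ≡ suc c × S IN1 (base d) ≡ true))
    to : Step → B i j ≡ true
    to (vi , vj , x , x< , o , a , a< , b , b< , s , s< , c , c< , d , d< , ea , eb , es , ec , refl , e)
      with proj₁ (orderH inp add mul x<) o
    ... | refl with proj₁ (mul i< x< a<) ea
    ...   | refl with proj₁ (add a< j< b<) eb | proj₁ (separator inp s<) es
    ...     | refl | refl with proj₁ (add s< b< c<) ec
    ...       | refl = proj₁ (bitH inp (proj₁ (ver i<) vi) (proj₁ (ver j<) vj)) e
    from : B i j ≡ true → Step
    from e = proj₂ (ver i<) i<m , proj₂ (ver j<) j<m , m , m<N , proj₂ (orderH inp add mul m<N) refl
           , i * m , a< , i * m + j , b< , n * n , nn<N , n * n + (i * m + j) , c< , suc (n * n + (i * m + j)) , d<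
           , proj₂ (mul i< m<N a<) refl , proj₂ (add a< j< b<) refl , proj₂ (separator inp nn<N) refl
           , proj₂ (add nn<N b< c<) refl , refl , proj₂ (bitH inp i<m j<m) e
      where
      i<m = proj₁ (supp e)
      j<m = proj₂ (supp e)
      d< : suc (n * n + (i * m + j)) < N
      d< = ≤-trans (s≤s (≤-reflexive (sym (+-suc (n * n) (i * m + j))))) (≤-trans (s≤s (+-monoʳ-≤ (n * n) (matrix-bound i<m j<m))) nn+mm<N)
      c< : n * n + (i * m + j) < N
      c< = <-trans (n<1+n _) d<
      b< : i * m + j < N
      b< = ≤-<-trans (m≤n+m (i * m + j) (n * n)) c<
      a< : i * m < N
      a< = ≤-<-trans (m≤m+n (i * m) j) b<

-- Congruence rules for logical equivalence

⟺-refl : ∀ {P} → P ⟺ P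
⟺-refl = (λ p → p) , (λ p → p)

⟺-sym : ∀ {P Q} → P ⟺ Q → Q ⟺ P
⟺-sym (f , g) = g , f

⟺-trans : ∀ {P Q R} → P ⟺ Q → Q ⟺ R → P ⟺ R
⟺-trans (f , g) (h , k) = (λ p → h (f p)) , (λ r → g (k r))

⟺-× : ∀ {P Q P' Q'} → P ⟺ P' → Q ⟺ Q' → P × Q ⟺ P' × Q'
⟺-× (f , g) (h , k) = (λ { (p , q) → f p , h q }) , (λ { (p , q) → g p , k q })

⟺-⊎ : ∀ {P Q P' Q'} → P ⟺ P' → Q ⟺ Q' → P ⊎ Q ⟺ P' ⊎ Q'
⟺-⊎ (f , g) (h , k) = (λ { (inj₁ p) → inj₁ (f p) ; (inj₂ q) → inj₂ (h q) }) , (λ { (inj₁ p) → inj₁ (g p) ; (inj₂ q) → inj₂ (k q) })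

⟺-¬ : ∀ {P P'} → P ⟺ P' → ¬ P ⟺ ¬ P'
⟺-¬ (f , g) = (λ np p' → np (g p')) , (λ np' p → np' (f p))

⟺-∃ : ∀ {N} {P Q : ℕ → Set} → (∀ {x} → x < N → P x ⟺ Q x) → (∃ λ x → x < N × P x) ⟺ (∃ λ x → x < N × Q x)
⟺-∃ h = (λ { (x , x< , p) → x , x< , proj₁ (h x<) p }) , (λ { (x , x< , q) → x , x< , proj₂ (h x<) q })

≡⇒⟺ : ∀ {a b : Bool} → a ≡ b → a ≡ true ⟺ b ≡ true
≡⇒⟺ refl = ⟺-refl

⟺⇒≡ : ∀ {a b : Bool} → a ≡ true ⟺ b ≡ true → a ≡ b
⟺⇒≡ (f , g) = bool-ext f g

¬true-⟺ : ∀ {b} → ¬ (b ≡ true) ⟺ b ≡ false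
¬true-⟺ = ¬true⇒false , (λ e t → true≢false (trans (sym t) e))

not-⟺ : ∀ {b} → ¬ (b ≡ true) ⟺ not b ≡ true
not-⟺ {true}  = (λ h → ⊥-elim (h refl)) , (λ ())
not-⟺ {false} = (λ _ → refl) , (λ _ ())

same-⟺ : ∀ {P Q P' Q'} → P ⟺ P' → Q ⟺ Q' → Same P Q ⟺ Same P' Q'
same-⟺ h k = ⟺-⊎ (⟺-× h k) (⟺-× (⟺-¬ h) (⟺-¬ k))

-- Correctness of the computed partitions

module ClassStage (N n : ℕ) (E : ℕ → ℕ → Bool) (Vr Ar Cr : Fin 13)
  (V≢C : (Vr =? Cr) ≡ false) (A≢C : (Ar =? Cr) ≡ false) (ADD≢C : (suc (suc zero) =? Cr) ≡ false) where

  open Formulas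
  open Arithmetic N

  module _ (S₀ : Store) (add₀ : Added S₀) (ver₀ : ∀ {i} → i < N → S₀ Vr (mem (r₁ i)) ≡ true ⟺ i < n)
    (adj₀ : ∀ {i j} → i < N → j < N → S₀ Ar (mem (r₂ i j)) ≡ true ⟺ E i j ≡ true) where

    open Rounds Cr (classF Vr Ar Cr) S₀

    -- Level `k` is settled after `suc k` rounds; freezing it at that round defines the partitions
    -- before stability has been proved.
    C : ℕ → ℕ → ℕ → Bool
    C k v x = round (suc k) Cr (mem (r₃ k v x))

    open Side N E C

    -- One round at level k + 1, read off a store that is already correct at level k.
    module Read (r k : ℕ) (cl : ∀ {v x} → v < N → x < N → round r Cr (mem (r₃ k v x)) ≡ C k v x) where

      private
        S = round r

        add : Added S
        add a b c = ⟺-trans (≡⇒⟺ (round-other r ADD ADD≢C _)) (add₀ a b c)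

        edge : ∀ {i j} → i < N → j < N → S Ar (mem (r₂ i j)) ≡ true ⟺ E i j ≡ true
        edge a b = ⟺-trans (≡⇒⟺ (round-other r Ar A≢C _)) (adj₀ a b)

        cls : ∀ {v x} → v < N → x < N → S Cr (mem (r₃ k v x)) ≡ true ⟺ C k v x ≡ true
        cls v< x< = ≡⇒⟺ (cl v< x<)

        ReachH : (ℕ → ℕ → Set) → ℕ → ℕ → Set
        ReachH R u x = u ≡ x ⊎ R u x ⊎ ∃ λ y → y < N × (S Cr (mem (r₃ k u y)) ≡ true × R u y × R y x)

        reach-⟺ : ∀ {R E'} → (∀ {i j} → i < N → j < N → R i j ⟺ E' i j ≡ true) → ∀ {u x} → u < N → x < N →
          ReachH R u x ⟺ Reach₂ N E' (C k u) u x
        reach-⟺ h u< x< = ⟺-⊎ ⟺-refl (⟺-⊎ (h u< x<) (⟺-∃ (λ y< → ⟺-× (cls u< y<) (⟺-× (h u< y<) (h y< x<)))))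

        Edge NonEdge : ℕ → ℕ → Set
        Edge i j    = S Ar (mem (r₂ i j)) ≡ true
        NonEdge i j = ¬ (S Ar (mem (r₂ i j)) ≡ true)

        ConnectedH : ℕ → Set
        ConnectedH u = ¬ ∃ λ y → y < N × (S Cr (mem (r₃ k u y)) ≡ true × ¬ ReachH Edge u y)

        connected-⟺ : ∀ {u} → u < N → ConnectedH u ⟺ Connected k u
        connected-⟺ {u} u< = to , from
          where
          to : ConnectedH u → Connected k u
          to h {y} y< c with reach₂? N E (C k u) u y
          ... | yes r = r
          ... | no nr = ⊥-elim (h (y , y< , proj₂ (cls u< y<) c , λ r → nr (proj₁ (reach-⟺ edge u< y<) r)))
          from : Connected k u → ConnectedH u
          from h (y , y< , c , nr) = nr (proj₂ (reach-⟺ edge u< y<) (h y< (proj₁ (cls u< y<) c)))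

        SideH : ℕ → ℕ → Set
        SideH u x = (ConnectedH u × ReachH NonEdge u x) ⊎ (¬ ConnectedH u × ReachH Edge u x)

        side-⟺ : ∀ {u x} → u < N → x < N → SideH u x ⟺ Side k u x
        side-⟺ u< x< = ⟺-⊎ (⟺-× (connected-⟺ u<) (reach-⟺ (λ i< j< → ⟺-trans (⟺-¬ (edge i< j<)) not-⟺) u< x<))
                            (⟺-× (⟺-¬ (connected-⟺ u<)) (reach-⟺ edge u< x<))

        LeastH : ℕ → ℕ → Set
        LeastH v u = ¬ ∃ λ y → y < N × (S Cr (mem (r₃ k v y)) ≡ true × Less S y u)

        least-⟺ : ∀ {v u} → v < N → u < N → LeastH v u ⟺ Least k v u
        least-⟺ v< u< = (λ h y y< c → ≮⇒≥ (λ lt → h (y , y< , proj₂ (cls v< y<) c , proj₂ (less-⟺ {S} add u<) lt)))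
                       , (λ { h (y , y< , c , l) → <⇒≱ (proj₁ (less-⟺ {S} add u<) l) (h y y< (proj₁ (cls v< y<) c)) })

      RefineH : ℕ → ℕ → Set
      RefineH v x = S Cr (mem (r₃ k v x)) ≡ true × ∃ λ u → u < N × (S Cr (mem (r₃ k v u)) ≡ true × LeastH v u × Same (SideH u v) (SideH u x))

      refine-⟺ : ∀ {v x} → v < N → x < N → RefineH v x ⟺ Refine k v x
      refine-⟺ v< x< = ⟺-× (cls v< x<) (⟺-∃ (λ u< → ⟺-× (cls v< u<) (⟺-× (least-⟺ v< u<) (same-⟺ (side-⟺ u< v<) (side-⟺ u< x<)))))

    level-zero : ∀ r {v x} → 0 < N → v < N → x < N → round (suc r) Cr (mem (r₃ 0 v x)) ≡ true ⟺ (v < n × x < n)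
    level-zero r 0< v< x< = ⟺-trans (round-suc r _)
      ( (λ { (inj₁ (_ , a , b)) → proj₁ (ver v<) a , proj₁ (ver x<) b ; (inj₂ (_ , _ , () , _)) })
      , (λ { (a , b) → inj₁ (proj₂ (zero-test 0<) refl , proj₂ (ver v<) a , proj₂ (ver x<) b) }))
      where
      ver : ∀ {i} → i < N → round r Vr (mem (r₁ i)) ≡ true ⟺ i < n
      ver i< = ⟺-trans (≡⇒⟺ (round-other r Vr V≢C _)) (ver₀ i<)

    level-suc : ∀ r k (cl : ∀ {v x} → v < N → x < N → round r Cr (mem (r₃ k v x)) ≡ C k v x) →
      ∀ {v x} → suc k < N → v < N → x < N → round (suc r) Cr (mem (r₃ (suc k) v x)) ≡ true ⟺ Refine k v x
    level-suc r k cl sk< v< x< = ⟺-trans (round-suc r _) (⟺-trans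
      ( (λ { (inj₁ (nz , _)) → ⊥-elim (nz (k , <-trans (n<1+n k) sk< , refl)) ; (inj₂ (.k , _ , refl , h)) → h })
      , (λ h → inj₂ (k , <-trans (n<1+n k) sk< , refl , h)))
      (Read.refine-⟺ r k cl v< x<))

    -- Level 0 is recomputed from the vertex set alone, and level `suc k` from level `k` of the
    -- preceding round.
    stable : ∀ k r → k < r → k < N → ∀ {v x} → v < N → x < N → round r Cr (mem (r₃ k v x)) ≡ C k v x
    stable zero (suc r) _ k< v< x< = ⟺⇒≡ (⟺-trans (level-zero r k< v< x<) (⟺-sym (level-zero 0 k< v< x<)))
    stable (suc k) (suc r) (s≤s k<r) sk< v< x< = ⟺⇒≡ (⟺-trans
      (level-suc r k (stable k r k<r (<-trans (n<1+n k) sk<)) sk< v< x<)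
      (⟺-sym (level-suc (suc k) k (λ _ _ → refl) sk< v< x<)))

    decomposition : n < N → Symmetric E → (∀ a → E a a ≡ false) → P4Free E → Decomposition N n E C
    decomposition n<N s i p = record
      { n<N = n<N ; A-sym = s ; A-irr = i ; A-P4 = p
      ; C-zero = λ v< x< → level-zero 0 (≤-<-trans z≤n n<N) v< x<
      ; C-suc = λ {k} sk< v< x< → level-suc (suc k) k (λ _ _ → refl) sk< v< x< }

    computed : ∀ {k v x} → k < N → v < N → x < N → semS N (rep (asg false Cr (classF Vr Ar Cr))) S₀ Cr (mem (r₃ k v x)) ≡ C k v x
    computed {k} k< v< x< = stable k N k< k< v< x<

-- Correctness of the computed table

module TableStage (N n m : ℕ) {A B : ℕ → ℕ → Bool} {C D : ℕ → ℕ → ℕ → Bool} (dG : Decomposition N n A C) (dH : Decomposition N m B D) where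

  open Formulas
  open Arithmetic N
  private
    module G = Splitting dG
    module H = Splitting dH
  open Table dG dH
  open Alpha N A B

  module _ (S₀ : Store) (add₀ : Added S₀)
    (adjG₀ : ∀ {i j} → i < N → j < N → S₀ AG (mem (r₂ i j)) ≡ true ⟺ A i j ≡ true)
    (adjH₀ : ∀ {i j} → i < N → j < N → S₀ AH (mem (r₂ i j)) ≡ true ⟺ B i j ≡ true)
    (clsG₀ : ∀ {k v x} → k < N → v < N → x < N → S₀ CG (mem (r₃ k v x)) ≡ true ⟺ C k v x ≡ true)
    (clsH₀ : ∀ {k v x} → k < N → v < N → x < N → S₀ CH (mem (r₃ k v x)) ≡ true ⟺ D k v x ≡ true) where

    open Rounds TT tableF S₀

    Tab : ℕ → ℕ → ℕ → ℕ → ℕ → ℕ → Bool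
    Tab r k v l w t = round r TT (mem (r₅ k v l w t))

    module _ (r : ℕ) where

      private
        S = round r

      SplitH : Fin 13 → ℕ → ℕ → ℕ → ℕ → ℕ → Set
      SplitH Y k v k' a b = k' ≡ suc k × S Y (mem (r₃ k v a)) ≡ true × S Y (mem (r₃ k v b)) ≡ true × ¬ (S Y (mem (r₃ k' a b)) ≡ true)

      SumH : (ℕ → Bool) → (ℕ → Bool) → ℕ → Set
      SumH F G t = F t ≡ true ⊎ G t ≡ true ⊎
        ∃ λ p → p < N × ∃ λ q → q < N × ∃ λ s → s < N × (F p ≡ true × G q ≡ true × S ADD (mem (r₃ p q s)) ≡ true × t ≡ suc s)

      sum-⟺ : ∀ {F G t} → SumH F G t ⟺ Sum N F G t
      sum-⟺ = ⟺-⊎ ⟺-refl (⟺-⊎ ⟺-refl (⟺-∃ (λ p< → ⟺-∃ (λ q< → ⟺-∃ (λ s< → ⟺-× ⟺-refl (⟺-× ⟺-refl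
        (⟺-× (⟺-trans (≡⇒⟺ (round-other r ADD refl _)) (add₀ p< q< s<)) ⟺-refl)))))))

      adjG : ∀ {i j} → i < N → j < N → S AG (mem (r₂ i j)) ≡ true ⟺ A i j ≡ true
      adjG i< j< = ⟺-trans (≡⇒⟺ (round-other r AG refl _)) (adjG₀ i< j<)

      adjH : ∀ {i j} → i < N → j < N → S AH (mem (r₂ i j)) ≡ true ⟺ B i j ≡ true
      adjH i< j< = ⟺-trans (≡⇒⟺ (round-other r AH refl _)) (adjH₀ i< j<)

      clsG : ∀ {k v x} → k < N → v < N → x < N → S CG (mem (r₃ k v x)) ≡ true ⟺ C k v x ≡ true
      clsG k< v< x< = ⟺-trans (≡⇒⟺ (round-other r CG refl _)) (clsG₀ k< v< x<)

      clsH : ∀ {k v x} → k < N → v < N → x < N → S CH (mem (r₃ k v x)) ≡ true ⟺ D k v x ≡ true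
      clsH k< v< x< = ⟺-trans (≡⇒⟺ (round-other r CH refl _)) (clsH₀ k< v< x<)

      module _ {k v l w : ℕ} (k< : k < N) (v< : v < N) (l< : l < N) (w< : w < N) where

        splitG : ∀ {a b} → suc k < N → a < N → b < N → SplitH CG k v (suc k) a b → G.Split k v a b
        splitG sk< a< b< (refl , x , y , z) = G.split sk< a< b< (proj₁ (clsG k< v< a<) x) (proj₁ (clsG k< v< b<) y) (λ e → z (proj₂ (clsG sk< a< b<) e))

        splitG⁻ : ∀ {a b} → G.Split k v a b → SplitH CG k v (suc k) a b
        splitG⁻ (G.split sk< a< b< x y z) = refl , proj₂ (clsG k< v< a<) x , proj₂ (clsG k< v< b<) y , (λ e → z (proj₁ (clsG sk< a< b<) e))

        splitH : ∀ {a b} → suc l < N → a < N → b < N → SplitH CH l w (suc l) a b → H.Split l w a b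
        splitH sl< a< b< (refl , x , y , z) = H.split sl< a< b< (proj₁ (clsH l< w< a<) x) (proj₁ (clsH l< w< b<) y) (λ e → z (proj₂ (clsH sl< a< b<) e))

        splitH⁻ : ∀ {a b} → H.Split l w a b → SplitH CH l w (suc l) a b
        splitH⁻ (H.split sl< a< b< x y z) = refl , proj₂ (clsH l< w< a<) x , proj₂ (clsH l< w< b<) y , (λ e → z (proj₁ (clsH sl< a< b<) e))

        NoSplitH : Fin 13 → ℕ → ℕ → Set
        NoSplitH Y k v = ¬ ∃ λ k' → k' < N × ∃ λ a → a < N × ∃ λ b → b < N × SplitH Y k v k' a b

        noSplitG : NoSplitH CG k v ⟺ G.NoSplit k v
        noSplitG = (λ h s → h (suc k , G.sk< s , _ , G.a< s , _ , G.b< s , splitG⁻ s))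
                 , (λ { h (.(suc k) , k'< , a , a< , b , b< , s@(refl , _)) → h (splitG k'< a< b< s) })

        noSplitH : NoSplitH CH l w ⟺ H.NoSplit l w
        noSplitH = (λ h s → h (suc l , H.sk< s , _ , H.a< s , _ , H.b< s , splitH⁻ s))
                 , (λ { h (.(suc l) , k'< , a , a< , b , b< , s@(refl , _)) → h (splitH k'< a< b< s) })

        module _ {t : ℕ} (t< : t < N) where

          condG : ∀ {a b} → a < N → b < N → (¬ (S AG (mem (r₂ a b)) ≡ true) ⊎ NoSplitH CH l w) ⟺ (A a b ≡ false ⊎ H.NoSplit l w)
          condG a< b< = ⟺-⊎ (⟺-trans (⟺-¬ (adjG a< b<)) ¬true-⟺) noSplitH

          condH : ∀ {a b} → a < N → b < N → (¬ (S AH (mem (r₂ a b)) ≡ true) ⊎ NoSplitH CG k v) ⟺ (B a b ≡ false ⊎ G.NoSplit k v)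
          condH a< b< = ⟺-⊎ (⟺-trans (⟺-¬ (adjH a< b<)) ¬true-⟺) noSplitG

          -- The disjuncts of `tableF`, unfolded. There the next level is a bound variable, which
          -- matching on `refl` identifies with the successor that the rules use.
          Step₁ Step₂ Step₃ Step₄ : Set
          Step₁ = ∃ λ k' → k' < N × ∃ λ a → a < N × ∃ λ b → b < N × (SplitH CG k v k' a b × (¬ (S AG (mem (r₂ a b)) ≡ true) ⊎ NoSplitH CH l w)
                  × SumH (Tab r k' a l w) (Tab r k' b l w) t)
          Step₂ = ∃ λ l' → l' < N × ∃ λ a → a < N × ∃ λ b → b < N × (SplitH CH l w l' a b × (¬ (S AH (mem (r₂ a b)) ≡ true) ⊎ NoSplitH CG k v)
                  × SumH (Tab r k v l' a) (Tab r k v l' b) t)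
          Step₃ = NoSplitH CG k v × NoSplitH CH l w × ¬ ∃ λ x → x < N × t ≡ suc x
          Step₄ = ∃ λ k' → k' < N × ∃ λ a → a < N × ∃ λ b → b < N × (SplitH CG k v k' a b × S AG (mem (r₂ a b)) ≡ true ×
                  ∃ λ l' → l' < N × ∃ λ c → c < N × ∃ λ d → d < N × (SplitH CH l w l' c d × S AH (mem (r₂ c d)) ≡ true ×
                  (Tab r k' a l w t ≡ true ⊎ Tab r k v l' c t ≡ true)))

          step₁ : Step₁ ⟺ Rule₁ (Tab r) k v l w t
          step₁ = (λ { (.(suc k) , k'< , a , a< , b , b< , s@(refl , _) , c , u) → a , b , splitG k'< a< b< s , proj₁ (condG a< b<) c , proj₁ sum-⟺ u })
                , (λ { (a , b , s , c , u) → suc k , G.sk< s , a , G.a< s , b , G.b< s , splitG⁻ s , proj₂ (condG (G.a< s) (G.b< s)) c , proj₂ sum-⟺ u })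

          step₂ : Step₂ ⟺ Rule₂ (Tab r) k v l w t
          step₂ = (λ { (.(suc l) , l'< , a , a< , b , b< , s@(refl , _) , c , u) → a , b , splitH l'< a< b< s , proj₁ (condH a< b<) c , proj₁ sum-⟺ u })
                , (λ { (a , b , s , c , u) → suc l , H.sk< s , a , H.a< s , b , H.b< s , splitH⁻ s , proj₂ (condH (H.a< s) (H.b< s)) c , proj₂ sum-⟺ u })

          step₃ : Step₃ ⟺ Rule₃ (Tab r) k v l w t
          step₃ = ⟺-× noSplitG (⟺-× noSplitH (zero-test t<))

          step₄ : Step₄ ⟺ Rule₄ (Tab r) k v l w t
          step₄ = (λ { (.(suc k) , k'< , a , a< , b , b< , s@(refl , _) , ab , .(suc l) , l'< , c , c< , d , d< , s'@(refl , _) , cd , u) →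
                      a , b , splitG k'< a< b< s , proj₁ (adjG a< b<) ab , c , d , splitH l'< c< d< s' , proj₁ (adjH c< d<) cd , u })
                , (λ { (a , b , s , ab , c , d , s' , cd , u) →
                      suc k , G.sk< s , a , G.a< s , b , G.b< s , splitG⁻ s , proj₂ (adjG (G.a< s) (G.b< s)) ab
                    , suc l , H.sk< s' , c , H.a< s' , d , H.b< s' , splitH⁻ s' , proj₂ (adjH (H.a< s') (H.b< s')) cd , u })

          round-step : Tab (suc r) k v l w t ≡ true ⟺ Rules (Tab r) k v l w t
          round-step = ⟺-trans (round-suc r _) (⟺-⊎ step₁ (⟺-⊎ step₂ (⟺-⊎ step₃ step₄)))

    tabulated : ∀ {k v l w} → k < N → v < n → l < N → w < m → cnt N (C k v) + cnt N (D l w) ≤ N →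
      Spec (Tab N) k v l w
    tabulated = table-correct Tab (λ r k< v< l< w< t< → round-step r k< v< l< w< t<) N

-- Binary representation, most significant bit first

value : ℕ → ℕ → (ℕ → Bool) → ℕ
value x zero    f = 0
value x (suc n) f = ind (f x) * 2 ^ n + value (suc x) n f

readBinary-value : ∀ (f : ℕ → Bool) n x acc → readBinary (map (λ p → if f p then suc (suc zero) else suc zero) (range x n)) acc ≡ acc * 2 ^ n + value x n f
readBinary-value f zero    x acc = sym (trans (+-identityʳ (acc * 1)) (*-identityʳ acc))
readBinary-value f (suc n) x acc with f x
... | false = trans (readBinary-value f n (suc x) (2 * acc)) (cong (_+ value (suc x) n f) (trans (cong (_* 2 ^ n) (*-comm 2 acc)) (*-assoc acc 2 (2 ^ n))))
... | true  = begin
  readBinary (map (λ p → if f p then suc (suc zero) else suc zero) (range (suc x) n)) (2 * acc + 1) ≡⟨ readBinary-value f n (suc x) (2 * acc + 1) ⟩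
  (2 * acc + 1) * 2 ^ n + value (suc x) n f         ≡⟨ cong (_+ value (suc x) n f) (*-distribʳ-+ (2 ^ n) (2 * acc) 1) ⟩
  (2 * acc * 2 ^ n + 1 * 2 ^ n) + value (suc x) n f ≡⟨ +-assoc (2 * acc * 2 ^ n) (1 * 2 ^ n) _ ⟩
  2 * acc * 2 ^ n + (1 * 2 ^ n + value (suc x) n f) ≡⟨ cong (_+ (1 * 2 ^ n + value (suc x) n f)) (trans (cong (_* 2 ^ n) (*-comm 2 acc)) (*-assoc acc 2 (2 ^ n))) ⟩
  acc * 2 ^ suc n + (1 * 2 ^ n + value (suc x) n f) ∎
  where open ≡-Reasoning

ones : ℕ → ℕ → (ℕ → Bool) → Bool
ones x zero    f = true
ones x (suc n) f = f x ∧ ones (suc x) n f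

ones-⟺ : ∀ x n {f} → ones x n f ≡ true ⟺ (∀ {j} → x ≤ j → j < x + n → f j ≡ true)
ones-⟺ x zero    = (λ _ {j} le lt → ⊥-elim (<⇒≱ (≤-trans lt (≤-reflexive (+-identityʳ x))) le)) , (λ _ → refl)
ones-⟺ x (suc n) {f} = to , (λ h → ∧-true (h ≤-refl (≤-trans (s≤s (m≤m+n x n)) (≤-reflexive (sym (+-suc x n)))))
    (proj₂ (ones-⟺ (suc x) n) (λ le lt → h (<⇒≤ le) (≤-trans lt (≤-reflexive (sym (+-suc x n)))))))
  where
  to : f x ∧ ones (suc x) n f ≡ true → ∀ {j} → x ≤ j → j < x + suc n → f j ≡ true
  to e {j} le lt with m≤n⇒m<n∨m≡n le
  ... | inj₂ refl = proj₁ (∧-true⁻ e)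
  ... | inj₁ x<j  = proj₁ (ones-⟺ (suc x) n) (proj₂ (∧-true⁻ e)) x<j (≤-trans lt (≤-reflexive (+-suc x n)))

-- Bit i flips exactly when all less significant bits are ones.
increment-bits : ℕ → (ℕ → Bool) → ℕ → Bool
increment-bits N f i = f i xor ones (suc i) (N ∸ suc i) f

-- The second summand is the carry out of position `x`. It makes the equation exact for every final
-- segment of the positions, so that induction can start at the least significant end.
increment-value : ∀ N f n x → x + n ≡ N →
  value x n (increment-bits N f) + ind (ones x n f) * 2 ^ n ≡ suc (value x n f)
increment-value N f zero    x xn = refl
increment-value N f (suc n) x xn = subst (λ k → ind (f x xor ones (suc x) k f) * 2 ^ n + value (suc x) n (increment-bits N f) + ind (f x ∧ ones (suc x) n f) * (2 ^ suc n)
    ≡ suc (ind (f x) * 2 ^ n + value (suc x) n f)) (sym N∸) (cases (f x) (ones (suc x) n f) (increment-value N f n (suc x) (trans (sym (+-suc x n)) xn)))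
  where
  N∸ : N ∸ suc x ≡ n
  N∸ = trans (cong (_∸ suc x) (sym (trans (sym (+-suc x n)) xn))) (m+n∸m≡n (suc x) n)
  P = 2 ^ n
  v' = value (suc x) n (increment-bits N f)
  v = value (suc x) n f
  cases : ∀ b c → v' + ind c * P ≡ suc v → ind (b xor c) * P + v' + ind (b ∧ c) * (2 ^ suc n) ≡ suc (ind b * P + v)
  cases false false e = trans (+-identityʳ v') (trans (sym (+-identityʳ v')) e)
  cases true  false e = trans (+-identityʳ _) (trans (cong (1 * P +_) (trans (sym (+-identityʳ v')) e)) (+-suc (1 * P) v))
  cases false true  e = trans (+-identityʳ _) (trans (+-comm (1 * P) v') e)
  cases true  true  e = trans (cong (v' +_) (trans (*-identityˡ (2 ^ suc n)) (cong (_+ (P + 0)) (sym (+-identityʳ P)))))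
    (trans (sym (+-assoc v' (1 * P) (P + 0))) (trans (cong (_+ (P + 0)) e) (cong suc (+-comm v (P + 0)))))

bits : ℕ → ℕ → ℕ → Bool
bits N zero    i = false
bits N (suc t) i = increment-bits N (bits N t) i

n<2^n : ∀ n → n < 2 ^ n
n<2^n zero    = s≤s z≤n
n<2^n (suc n) = ≤-trans (≤-reflexive (cong suc (sym (+-comm n 1)))) (≤-trans (+-mono-≤ (n<2^n n) (m^n>0 2 n)) (≤-reflexive (cong (2 ^ n +_) (sym (+-identityʳ (2 ^ n))))))

-- The counter never overflows, because `t < N < 2 ^ N`.
bits-value : ∀ N t → t < N → value 0 N (bits N t) ≡ t
bits-value N zero    t< = zeros N 0
  where
  zeros : ∀ n x → value x n (λ _ → false) ≡ 0
  zeros zero    x = refl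
  zeros (suc n) x = zeros n (suc x)
bits-value N (suc t) t< = trans (sym (trans (cong (value 0 N (bits N (suc t)) +_) (no-carry (ones 0 N (bits N t)) total)) (+-identityʳ _))) total
  where
  total : value 0 N (bits N (suc t)) + ind (ones 0 N (bits N t)) * 2 ^ N ≡ suc t
  total = trans (increment-value N (bits N t) N 0 refl) (cong suc (bits-value N t (<-trans (n<1+n t) t<)))
  no-carry : ∀ c → value 0 N (bits N (suc t)) + ind c * 2 ^ N ≡ suc t → ind c * 2 ^ N ≡ 0
  no-carry false e = refl
  no-carry true  e = ⊥-elim (<⇒≱ (<-trans t< (n<2^n N)) (≤-trans (≤-trans (≤-reflexive (sym (*-identityˡ (2 ^ N)))) (m≤n+m (1 * 2 ^ N) (value 0 N (bits N (suc t))))) (≤-reflexive e)))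

-- Correctness of the printed bits

module OutputStage (N : ℕ) where

  open Formulas
  open Arithmetic N

  module _ (S₀ : Store) (add₀ : Added S₀) where

    open Rounds BIT bitF S₀

    bit-rounds : ∀ t r → t < r → t < N → ∀ {i} → i < N → round r BIT (mem (r₂ t i)) ≡ bits N t i
    bit-rounds t (suc r) (s≤s t≤r) t< {i} i< = ⟺⇒≡ (⟺-trans (round-suc r (r₂ t i)) (cases t refl t≤r t<))
      where
      S = round r
      Ones : ℕ → Set
      Ones x = ¬ ∃ λ j → j < N × (Less S i j × ¬ (S BIT (mem (r₂ x j)) ≡ true))
      Step : Set
      Step = ∃ λ x → x < N × (t ≡ suc x × ((S BIT (mem (r₂ x i)) ≡ true × ¬ Ones x) ⊎ (¬ (S BIT (mem (r₂ x i)) ≡ true) × Ones x)))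
      add : Added S
      add a b c = ⟺-trans (≡⇒⟺ (round-other r ADD refl _)) (add₀ a b c)
      xor-⟺ : ∀ {a b P Q} → P ⟺ a ≡ true → Q ⟺ b ≡ true → ((P × ¬ Q) ⊎ (¬ P × Q)) ⟺ (a xor b) ≡ true
      xor-⟺ {true}  {true}  (_ , g) (_ , k) = (λ { (inj₁ (_ , nq)) → ⊥-elim (nq (k refl)) ; (inj₂ (np , _)) → ⊥-elim (np (g refl)) }) , (λ ())
      xor-⟺ {true}  {false} (_ , g) (h , _) = (λ _ → refl) , (λ _ → inj₁ (g refl , λ q → true≢false (sym (h q))))
      xor-⟺ {false} {true}  (f , _) (_ , k) = (λ _ → refl) , (λ _ → inj₂ ((λ p → true≢false (sym (f p))) , k refl))
      xor-⟺ {false} {false} (f , _) (h , _) = (λ { (inj₁ (p , _)) → f p ; (inj₂ (_ , q)) → h q }) , (λ ())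
      cases : ∀ t' → t ≡ t' → t' ≤ r → t' < N → Step ⟺ bits N t' i ≡ true
      cases zero refl _ _ = (λ { (_ , _ , () , _) }) , (λ ())
      cases (suc x) refl x<r sx< = ⟺-trans ((λ { (.x , _ , refl , h) → h }) , (λ h → x , x< , refl , h))
        (xor-⟺ (≡⇒⟺ (bit-rounds x r x<r x< i<)) (to , from))
        where
        x< : x < N
        x< = <-trans (n<1+n x) sx<
        earlier : ∀ {j} → j < N → S BIT (mem (r₂ x j)) ≡ bits N x j
        earlier = bit-rounds x r x<r x<
        end : suc i + (N ∸ suc i) ≡ N
        end = m+[n∸m]≡n i<
        to : Ones x → ones (suc i) (N ∸ suc i) (bits N x) ≡ true
        to h = proj₂ (ones-⟺ (suc i) (N ∸ suc i)) above
          where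
          above : ∀ {j} → suc i ≤ j → j < suc i + (N ∸ suc i) → bits N x j ≡ true
          above {j} le lt with bits N x j in e
          ... | true  = refl
          ... | false = ⊥-elim (h (j , j< , proj₂ (less-⟺ {S} add j<) le , λ b → true≢false (trans (sym b) (trans (earlier j<) e))))
            where
            j< : j < N
            j< = ≤-trans lt (≤-reflexive end)
        from : ones (suc i) (N ∸ suc i) (bits N x) ≡ true → Ones x
        from h (j , j< , l , nb) = nb (trans (earlier j<) (proj₁ (ones-⟺ (suc i) (N ∸ suc i)) h (proj₁ (less-⟺ {S} add j<) l) (≤-trans j< (≤-reflexive (sym end)))))

    bits-computed : ∀ {t i} → t < N → i < N → semS N (rep (asg false BIT bitF)) S₀ BIT (mem (r₂ t i)) ≡ bits N t i
    bits-computed {t} t< i< = bit-rounds t N t< t< i<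

  Below : Store → ℕ → Set
  Below S t = ∃ λ z → z < N × ((¬ ∃ λ x → x < N × z ≡ suc x) × S VG (mem (r₁ z)) ≡ true × S VH (mem (r₁ z)) ≡ true × S TT (mem (r₅ z z z z t)) ≡ true)

  out-correct : ∀ S {a} → a < N → (∀ {t} → t < N → Below S t ⟺ t < a) →
    (∀ {t i} → t < N → i < N → S BIT (mem (r₂ t i)) ≡ bits N t i) →
    ∀ {p} → p < N → semS N (asg true OUT outF) S OUT (base p) ≡ bits N a p
  out-correct S {a} a< below bit {p} p< = ⟺⇒≡ (⟺-trans (≡⇒⟺ (assign-≡ N true OUT outF S OUT (base p)))
    ((λ e → to (holds S ρ outF e)) , (λ e → holds⁻ S ρ outF (from e))))
    where
    ρ = envOf 1 (base p)
    Step : Set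
    Step = ∃ λ t → t < N × (¬ Below S t × ((¬ ∃ λ x → x < N × t ≡ suc x) ⊎ ∃ λ x → x < N × (t ≡ suc x × Below S x)) × S BIT (mem (r₂ t p)) ≡ true)
    to : Step → bits N a p ≡ true
    -- `nb` gives `a ≤ t`; that `t` is 0 or has its predecessor below `a` gives `t ≤ a`.
    to (t , t< , nb , c , e) = subst (λ z → bits N z p ≡ true) (≤-antisym (upper c) (≮⇒≥ (λ lt → nb (proj₂ (below t<) lt)))) (trans (sym (bit t< p<)) e)
      where
      upper : (¬ ∃ λ x → x < N × t ≡ suc x) ⊎ (∃ λ x → x < N × (t ≡ suc x × Below S x)) → t ≤ a
      upper (inj₁ z) = ≤-trans (≤-reflexive (proj₁ (zero-test t<) z)) z≤n
      upper (inj₂ (x , x< , refl , b)) = proj₁ (below x<) b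
    from : bits N a p ≡ true → Step
    from e = a , a< , (λ b → <-irrefl refl (proj₁ (below a<) b)) , lower a a< ≤-refl , trans (bit a< p<) e
      where
      lower : ∀ a' → a' < N → a' ≤ a → (¬ ∃ λ x → x < N × a' ≡ suc x) ⊎ ∃ λ x → x < N × (a' ≡ suc x × Below S x)
      lower zero     z< _  = inj₁ (proj₂ (zero-test z<) refl)
      lower (suc a') s< le = inj₂ (a' , <-trans (n<1+n a') s< , refl , proj₂ (below (<-trans (n<1+n a') s<)) le)

-- Graphs on initial segments of the natural numbers

adjℕ : ∀ {n} → Graph n → ℕ → ℕ → Bool
adjℕ {n} G i j with i <? n | j <? n
... | yes i< | yes j< = adj G (fromℕ< i<) (fromℕ< j<)
... | _      | _      = false

adjℕ-toℕ : ∀ {n} (G : Graph n) a b → adjℕ G (toℕ a) (toℕ b) ≡ adj G a b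
adjℕ-toℕ {n} G a b with toℕ a <? n | toℕ b <? n
... | yes a< | yes b< = cong₂ (adj G) (fromℕ<-toℕ a a<) (fromℕ<-toℕ b b<)
... | no a≮  | _      = ⊥-elim (a≮ (toℕ<n a))
... | yes _  | no b≮  = ⊥-elim (b≮ (toℕ<n b))

adjℕ-support : ∀ {n} (G : Graph n) {i j} → adjℕ G i j ≡ true → i < n × j < n
adjℕ-support {n} G {i} {j} e with i <? n | j <? n
... | yes i< | yes j< = i< , j<

module _ {n : ℕ} {G : Graph n} (simple : SimpleGraph G) where

  open SimpleGraph simple

  adjℕ-sym : Symmetric (adjℕ G)
  adjℕ-sym i j with i <? n | j <? n
  ... | yes i< | yes j< = symmetric _ _
  ... | yes _  | no _   = refl
  ... | no _   | yes _  = refl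
  ... | no _   | no _   = refl

  adjℕ-irr : ∀ i → adjℕ G i i ≡ false
  adjℕ-irr i with i <? n
  ... | yes _ = irreflexive _
  ... | no _  = refl

  adjℕ-P4Free : Cograph G → P4Free (adjℕ G)
  adjℕ-P4Free cograph a b c d ab bc cd ac bd ad =
    cograph a' b' c' d' (move a< b< ab) (move b< c< bc) (move c< d< cd) (move a< c< ac) (move b< d< bd) (move a< d< ad)
    where
    a< = proj₁ (adjℕ-support G ab)
    b< = proj₁ (adjℕ-support G bc)
    c< = proj₁ (adjℕ-support G cd)
    d< = proj₂ (adjℕ-support G cd)
    a' = fromℕ< a<
    b' = fromℕ< b<
    c' = fromℕ< c<
    d' = fromℕ< d<
    move : ∀ {x y t} (x< : x < n) (y< : y < n) → adjℕ G x y ≡ t → adj G (fromℕ< x<) (fromℕ< y<) ≡ t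
    move x< y< e = trans (sym (adjℕ-toℕ G _ _)) (trans (cong₂ (adjℕ G) (toℕ-fromℕ< x<) (toℕ-fromℕ< y<)) e)

-- Cardinalities of subsets of a product

get : ∀ {k} → Vec Bool k → ℕ → Bool
get []      _       = false
get (b ∷ S) zero    = b
get (b ∷ S) (suc p) = get S p

get-lookup : ∀ {k} (S : Vec Bool k) x → get S (toℕ x) ≡ lookup S x
get-lookup (b ∷ S) zero    = refl
get-lookup (b ∷ S) (suc x) = get-lookup S x

Σ-head : ∀ n f → Σ< (suc n) f ≡ f 0 + Σ< n (λ i → f (suc i))
Σ-head zero    f = +-comm 0 (f 0)
Σ-head (suc n) f = trans (cong (_+ f (suc n)) (Σ-head n f)) (+-assoc (f 0) _ _)

card : ∀ {k} (S : Subset k) → ∣ S ∣ ≡ Σ< k (λ p → ind (get S p))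
card []                = refl
card {suc k} (b ∷ S) = trans (head b) (sym (Σ-head k (λ p → ind (get (b ∷ S) p))))
  where
  head : ∀ b → ∣ b ∷ S ∣ ≡ ind b + Σ< k (λ p → ind (get S p))
  head true  = cong suc (card S)
  head false = card S

Σ-split : ∀ a b f → Σ< (a + b) f ≡ Σ< a f + Σ< b (λ j → f (a + j))
Σ-split a zero    f = trans (cong (λ z → Σ< z f) (+-identityʳ a)) (sym (+-identityʳ _))
Σ-split a (suc b) f = trans (cong (λ z → Σ< z f) (+-suc a b)) (trans (cong (_+ f (a + b)) (Σ-split a b f)) (+-assoc (Σ< a f) _ _))

Σ-product : ∀ n m f → Σ< (n * m) f ≡ Σ< n (λ i → Σ< m (λ j → f (i * m + j)))
Σ-product zero    m f = refl
Σ-product (suc n) m f = trans (cong (λ z → Σ< z f) (+-comm m (n * m))) (trans (Σ-split (n * m) m f) (cong (_+ Σ< m (λ j → f (n * m + j))) (Σ-product n m f)))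

Σ-trim : ∀ {n N} f → n ≤ N → (∀ i → n ≤ i → i < N → f i ≡ 0) → Σ< N f ≡ Σ< n f
Σ-trim {n} {N} f le h = trans (cong (λ z → Σ< z f) (sym (m+[n∸m]≡n le))) (trans (Σ-split n (N ∸ n) f)
  (trans (cong (Σ< n f +_) (trans (Σ-cong (N ∸ n) (λ j j< → h (n + j) (m≤m+n n j) (≤-trans (+-monoʳ-< n j<) (≤-reflexive (m+[n∸m]≡n le))))) (Σ-zero (N ∸ n)))) (+-identityʳ _)))

module Product {n m N : ℕ} (n≤N : n ≤ N) (m≤N : m ≤ N) (G : Graph n) (H : Graph m) where

  open Alpha N (adjℕ G) (adjℕ H)

  area-trim : ∀ W → (∀ {i j} → i < N → j < N → W i j ≡ true → i < n × j < m) →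
    area W ≡ Σ< n (λ i → Σ< m (λ j → ind (W i j)))
  area-trim W h = trans (Σ-trim _ n≤N (λ i n≤i i< → trans (Σ-cong N (λ j j< → off (λ e → <⇒≱ (proj₁ (h i< j< e)) n≤i))) (Σ-zero N)))
    (Σ-cong n (λ i i< → Σ-trim _ m≤N (λ j m≤j j< → off (λ e → <⇒≱ (proj₂ (h (≤-trans i< n≤N) j< e)) m≤j))))
    where
    off : ∀ {b} → ¬ (b ≡ true) → ind b ≡ 0
    off h = cong ind (¬true⇒false h)

  index : ∀ {i j} → i < n → j < m → Fin (n * m)
  index i< j< = combine (fromℕ< i<) (fromℕ< j<)

  toℕ-index : ∀ {i j} (i< : i < n) (j< : j < m) → toℕ (index i< j<) ≡ i * m + j
  toℕ-index {i} {j} i< j< = trans (toℕ-combine (fromℕ< i<) (fromℕ< j<))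
    (cong₂ _+_ (trans (cong (m *_) (toℕ-fromℕ< i<)) (*-comm m i)) (toℕ-fromℕ< j<))

  row : Fin (n * m) → Fin n
  row x = proj₁ (remQuot {n} m x)

  col : Fin (n * m) → Fin m
  col x = proj₂ (remQuot {n} m x)

  adj-⊗ : ∀ x y → adj (G ⊗ H) x y ≡ adjℕ G (toℕ (row x)) (toℕ (row y)) ∧ adjℕ H (toℕ (col x)) (toℕ (col y))
  adj-⊗ x y = sym (cong₂ _∧_ (adjℕ-toℕ G (row x) (row y)) (adjℕ-toℕ H (col x) (col y)))

  pairs : Subset (n * m) → ℕ → ℕ → Bool
  pairs S i j = ((i <ᵇ n) ∧ (j <ᵇ m)) ∧ get S (i * m + j)

  pairs-support : ∀ S {i j} → pairs S i j ≡ true → i < n × j < m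
  pairs-support S e = let (a , b) = ∧-true⁻ (proj₁ (∧-true⁻ e)) in <ᵇ-true⁻ a , <ᵇ-true⁻ b

  pairs-area : ∀ S → area (pairs S) ≡ ∣ S ∣
  pairs-area S = trans (area-trim (pairs S) (λ _ _ e → pairs-support S e))
    (trans (Σ-cong n (λ i i< → Σ-cong m (λ j j< → cong (λ b → ind (b ∧ get S (i * m + j))) (∧-true (<ᵇ-true i<) (<ᵇ-true j<)))))
           (sym (trans (card S) (Σ-product n m (λ p → ind (get S p))))))

  pairs-indep : ∀ S → Independent (G ⊗ H) S → Indep (pairs S)
  pairs-indep S ind {i} {j} {i'} {j'} _ _ _ _ e e' ea eb =
    true≢false (trans (sym (trans (adj-⊗ x x') (∧-true (trans (cong₂ (adjℕ G) (rowEq i< j<) (rowEq i'< j'<)) ea) (trans (cong₂ (adjℕ H) (colEq i< j<) (colEq i'< j'<)) eb))))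
      (ind x x' (member i< j< e) (member i'< j'< e')))
    where
    i< = proj₁ (pairs-support S e)
    j< = proj₂ (pairs-support S e)
    i'< = proj₁ (pairs-support S e')
    j'< = proj₂ (pairs-support S e')
    x = index i< j<
    x' = index i'< j'<
    rowEq : ∀ {i j} (i< : i < n) (j< : j < m) → toℕ (row (index i< j<)) ≡ i
    rowEq i< j< = trans (cong (λ z → toℕ (proj₁ z)) (remQuot-combine (fromℕ< i<) (fromℕ< j<))) (toℕ-fromℕ< i<)
    colEq : ∀ {i j} (i< : i < n) (j< : j < m) → toℕ (col (index i< j<)) ≡ j
    colEq i< j< = trans (cong (λ z → toℕ (proj₂ z)) (remQuot-combine (fromℕ< i<) (fromℕ< j<))) (toℕ-fromℕ< j<)
    member : ∀ {i j} (i< : i < n) (j< : j < m) → pairs S i j ≡ true → index i< j< ∈ˢ S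
    member i< j< e = lookup⇒[]= (index i< j<) S (trans (sym (get-lookup S (index i< j<))) (trans (cong (get S) (toℕ-index i< j<)) (proj₂ (∧-true⁻ e))))

  unpair : (ℕ → ℕ → Bool) → Subset (n * m)
  unpair W = tabulate (λ x → W (toℕ (row x)) (toℕ (col x)))

  get-unpair : ∀ W {i j} → i < n → j < m → get (unpair W) (i * m + j) ≡ W i j
  get-unpair W {i} {j} i< j< = trans (cong (get (unpair W)) (sym (toℕ-index i< j<))) (trans (get-lookup (unpair W) (index i< j<))
    (trans (lookup∘tabulate _ (index i< j<)) (cong₂ W
      (trans (cong (λ z → toℕ (proj₁ z)) (remQuot-combine (fromℕ< i<) (fromℕ< j<))) (toℕ-fromℕ< i<))
      (trans (cong (λ z → toℕ (proj₂ z)) (remQuot-combine (fromℕ< i<) (fromℕ< j<))) (toℕ-fromℕ< j<)))))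

  -- Matrices and subsets of `Fin (n * m)` are translated into each other at position `i * m + j`,
  -- the numbering behind `remQuot`.
  independence-number : ∀ {P Q a} → (∀ {i} → i < N → P i ≡ true ⟺ i < n) → (∀ {j} → j < N → Q j ≡ true ⟺ j < m) →
    isα P Q a → IsIndependenceNumber (G ⊗ H) a
  independence-number {P} {Q} {a} hP hQ ((W , w , ind-W , area≡) , ub) = (unpair W , indep , size≡) , upper
    where
    in-W : ∀ {x} → x ∈ˢ unpair W → W (toℕ (row x)) (toℕ (col x)) ≡ true
    in-W {x} x∈ = trans (sym (lookup∘tabulate _ x)) ([]=⇒lookup x∈)
    r< : ∀ x → toℕ (row x) < N
    r< x = ≤-trans (toℕ<n (row x)) n≤N
    c< : ∀ x → toℕ (col x) < N
    c< x = ≤-trans (toℕ<n (col x)) m≤N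
    indep : Independent (G ⊗ H) (unpair W)
    indep x y x∈ y∈ = ¬true⇒false (λ e → let (ea , eb) = ∧-true⁻ (trans (sym (adj-⊗ x y)) e) in
      ind-W (r< x) (c< x) (r< y) (c< y) (in-W x∈) (in-W y∈) ea eb)
    size≡ : ∣ unpair W ∣ ≡ a
    size≡ = trans (card (unpair W)) (trans (Σ-product n m (λ p → ind (get (unpair W) p)))
      (trans (Σ-cong n (λ i i< → Σ-cong m (λ j j< → cong ind (get-unpair W i< j<))))
        (trans (sym (area-trim W (λ i< j< e → proj₁ (hP i<) (proj₁ (w i< j< e)) , proj₁ (hQ j<) (proj₂ (w i< j< e))))) area≡)))
    upper : ∀ S → Independent (G ⊗ H) S → ∣ S ∣ ≤ a
    upper S ind = ≤-trans (≤-reflexive (sym (pairs-area S))) (ub (pairs S)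
      (λ i< j< e → proj₂ (hP i<) (proj₁ (pairs-support S e)) , proj₂ (hQ j<) (proj₂ (pairs-support S e))) (pairs-indep S ind))

-- The input word

bit3 : Bool → Fin 3
bit3 b = if b then suc zero else zero

sep3 : Fin 3
sep3 = suc (suc zero)

matrix : ∀ {n} → Graph n → List (Fin 3)
matrix {n} G = concatMap (λ i → map (λ j → bit3 (adj G i j)) (allFin n)) (allFin n)

word : ∀ {n m} → Graph n → Graph m → List (Fin 3)
word G H = matrix G ++ sep3 ∷ matrix H

module _ {X : Set} {d : X} where

  nth-++ˡ : ∀ (xs ys : List X) {p} → p < length xs → nth d (xs ++ ys) p ≡ nth d xs p
  nth-++ˡ (x ∷ xs) ys {zero}  _        = refl
  nth-++ˡ (x ∷ xs) ys {suc p} (s≤s lt) = nth-++ˡ xs ys lt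

  nth-++ʳ : ∀ (xs ys : List X) q → nth d (xs ++ ys) (length xs + q) ≡ nth d ys q
  nth-++ʳ []       ys q = refl
  nth-++ʳ (x ∷ xs) ys q = nth-++ʳ xs ys q

  nth-tabulate : ∀ {k} (f : Fin k → X) i → nth d (tabulateᴸ f) (toℕ i) ≡ f i
  nth-tabulate f zero    = refl
  nth-tabulate f (suc i) = nth-tabulate (λ j → f (suc j)) i

  nth-map : ∀ {Y : Set} {e : Y} (f : Y → X) ys {p} → p < length ys → nth d (map f ys) p ≡ f (nth e ys p)
  nth-map f (y ∷ ys) {zero}  _        = refl
  nth-map f (y ∷ ys) {suc p} (s≤s lt) = nth-map f ys lt

  nth-All : ∀ {P : X → Set} → P d → ∀ {xs} → All P xs → ∀ p → P (nth d xs p)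
  nth-All pd []         p       = pd
  nth-All pd (px ∷ pxs) zero    = px
  nth-All pd (px ∷ pxs) (suc p) = nth-All pd pxs p

  nth-concat : ∀ {k l m} (g : Fin l → List X) (h : Fin k → Fin l) → (∀ i → length (g i) ≡ m) → ∀ i {j} → j < m →
    nth d (concatMap g (tabulateᴸ h)) (toℕ i * m + j) ≡ nth d (g (h i)) j
  nth-concat g h len zero    {j} j< = nth-++ˡ (g (h zero)) _ (≤-trans j< (≤-reflexive (sym (len (h zero)))))
  nth-concat {m = m} g h len (suc i) {j} j< = trans (cong (nth d (concatMap g (tabulateᴸ h))) (trans (+-assoc m (toℕ i * m) j) (cong (_+ (toℕ i * m + j)) (sym (len (h zero))))))
    (trans (nth-++ʳ (g (h zero)) _ (toℕ i * m + j)) (nth-concat g (λ j → h (suc j)) len i j<))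

length-concat : ∀ {X : Set} {k l m} (g : Fin l → List X) (h : Fin k → Fin l) → (∀ i → length (g i) ≡ m) → length (concatMap g (tabulateᴸ h)) ≡ k * m
length-concat {k = zero}  g h len = refl
length-concat {k = suc k} g h len = trans (length-++ (g (h zero))) (cong₂ _+_ (len (h zero)) (length-concat g (λ j → h (suc j)) len))

module _ {n : ℕ} (G : Graph n) where

  private
    line : Fin n → List (Fin 3)
    line i = map (λ j → bit3 (adj G i j)) (allFin n)

    length-line : ∀ i → length (line i) ≡ n
    length-line i = trans (length-map _ (allFin n)) (length-tabulate {n = n} (λ i → i))

  length-matrix : length (matrix G) ≡ n * n
  length-matrix = length-concat line (λ i → i) length-line

  nth-matrix : ∀ {i j} → i < n → j < n → nth zero (matrix G) (i * n + j) ≡ bit3 (adjℕ G i j)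
  nth-matrix {i} {j} i< j< = trans (cong (λ z → nth zero (matrix G) (z * n + j)) (sym (toℕ-fromℕ< i<)))
    (trans (nth-concat line (λ i → i) length-line (fromℕ< i<) j<)
      (trans (cong (nth zero (line (fromℕ< i<))) (sym (toℕ-fromℕ< j<)))
        (trans (nth-map {e = fromℕ< j<} (λ j → bit3 (adj G (fromℕ< i<) j)) (allFin n) (≤-trans (toℕ<n (fromℕ< j<)) (≤-reflexive (sym (length-tabulate {n = n} (λ i → i))))))
          (trans (cong (λ z → bit3 (adj G (fromℕ< i<) z)) (nth-tabulate (λ i → i) (fromℕ< j<)))
            (cong bit3 (trans (sym (adjℕ-toℕ G (fromℕ< i<) (fromℕ< j<))) (cong₂ (adjℕ G) (toℕ-fromℕ< i<) (toℕ-fromℕ< j<))))))))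

  matrix-bits : All (_≢ sep3) (matrix G)
  matrix-bits = AllP.concat⁺ (AllP.map⁺ (All.universal (λ i → AllP.map⁺ (All.universal (λ j → bit≢sep (adj G i j)) (allFin n))) (allFin n)))
    where
    bit≢sep : ∀ b → bit3 b ≢ sep3
    bit≢sep true  ()
    bit≢sep false ()

module _ {n m : ℕ} (G : Graph n) (H : Graph m) where

  length-word : length (word G H) ≡ n * n + suc (m * m)
  length-word = trans (length-++ (matrix G)) (cong₂ (λ a b → a + suc b) (length-matrix G) (length-matrix H))

  word-G : ∀ {p} → p < n * n → nth zero (word G H) p ≡ nth zero (matrix G) p
  word-G lt = nth-++ˡ (matrix G) _ (≤-trans lt (≤-reflexive (sym (length-matrix G))))

  word-tail : ∀ q → nth zero (word G H) (n * n + q) ≡ nth zero (sep3 ∷ matrix H) q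
  word-tail q = trans (cong (λ z → nth zero (word G H) (z + q)) (sym (length-matrix G))) (nth-++ʳ (matrix G) _ q)

  -- Both matrices consist of bits, so the separator occurs once. Past the end of the word `nth`
  -- returns its default `zero`, which is a bit as well.
  word-separator : ∀ {p} → nth zero (word G H) p ≡ sep3 ⟺ p ≡ n * n
  word-separator {p} = to , from
    where
    from : p ≡ n * n → nth zero (word G H) p ≡ sep3
    from refl = trans (cong (nth zero (word G H)) (sym (+-identityʳ (n * n)))) (word-tail 0)
    to : nth zero (word G H) p ≡ sep3 → p ≡ n * n
    to e with <-cmp p (n * n)
    ... | tri≈ _ q _ = q
    ... | tri< lt _ _ = ⊥-elim (nth-All (λ ()) (matrix-bits G) p (trans (sym (word-G lt)) e))
    ... | tri> _ _ gt = ⊥-elim (nth-All (λ ()) (matrix-bits H) (p ∸ suc (n * n))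
            (trans (sym (trans (cong (nth zero (word G H)) split) (word-tail (suc (p ∸ suc (n * n)))))) e))
      where
      split : p ≡ n * n + suc (p ∸ suc (n * n))
      split = trans (sym (m+[n∸m]≡n gt)) (sym (+-suc (n * n) (p ∸ suc (n * n))))

-- The program run on an encoded pair of cographs

open Formulas

initRel : Fin 13 → Fin 4 → Bool
initRel IN1 (suc (suc zero))       = true
initRel INS (suc (suc (suc zero))) = true
initRel _   _                      = false

module Code = Assemble 6 13 program tt initRel OUT

module Computation {n m : ℕ} (G : Graph n) (H : Graph m) (simpleG : SimpleGraph G) (simpleH : SimpleGraph H)
  (cographG : Cograph G) (cographH : Cograph H) where

  A B : ℕ → ℕ → Bool
  A = adjℕ G
  B = adjℕ H

  open Decode n m A B

  S₀ : Store
  S₀ = Code.initial-store (word G H)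

  input₀ : Input S₀
  input₀ = record
    { separator = λ _ → ⟺-trans sep-⟺ (word-separator G H)
    ; bitG = λ {i} {j} i< j< → subst (λ s → (initRel IN1 (suc s) ≡ true) ⟺ (A i j ≡ true))
        (sym (trans (word-G G H (matrix-bound i< j<)) (nth-matrix G i< j<))) (bit-⟺ (A i j))
    ; bitH = λ {i} {j} i< j< → subst (λ s → (initRel IN1 (suc s) ≡ true) ⟺ (B i j ≡ true))
        (sym (trans (cong (nth zero (word G H)) (sym (+-suc (n * n) (i * m + j)))) (trans (word-tail G H (suc (i * m + j))) (nth-matrix H i< j<)))) (bit-⟺ (B i j)) }
    where
    bit-⟺ : ∀ b → initRel IN1 (suc (bit3 b)) ≡ true ⟺ b ≡ true
    bit-⟺ true  = ⟺-refl
    bit-⟺ false = ⟺-refl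
    sep-⟺ : ∀ {s} → initRel INS (suc s) ≡ true ⟺ s ≡ sep3
    sep-⟺ {zero}             = (λ ()) , (λ ())
    sep-⟺ {suc zero}         = (λ ()) , (λ ())
    sep-⟺ {suc (suc zero)}   = (λ _ → refl) , (λ _ → refl)

  keepInput : ∀ s {S} → touches IN1 s ≡ false → touches INS s ≡ false → Input S → Input (semS N s S)
  keepInput s e f i = record
    { separator = λ p< → keep s INS f (Input.separator i p<)
    ; bitG = λ i< j< → keep s IN1 e (Input.bitG i i< j<)
    ; bitH = λ i< j< → keep s IN1 e (Input.bitH i i< j<) }

  keepAdded : ∀ s {S} → touches ADD s ≡ false → Added S → Added (semS N s S)
  keepAdded s e a p< q< t< = keep s ADD e (a p< q< t<)

  keepMultiplied : ∀ s {S} → touches MUL s ≡ false → Multiplied S → Multiplied (semS N s S)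
  keepMultiplied s e a p< q< t< = keep s MUL e (a p< q< t<)

  S₁ S₂ S₃ S₄ S₅ S₆ S₇ S₈ S₉ S₁₀ S₁₁ : Store
  S₁  = semS N (rep (asg false ADD addF)) S₀
  S₂  = semS N (rep (asg false MUL mulF)) S₁
  S₃  = semS N (asg false VG vgF) S₂
  S₄  = semS N (asg false VH vhF) S₃
  S₅  = semS N (asg false AG agF) S₄
  S₆  = semS N (asg false AH ahF) S₅
  S₇  = semS N (rep (asg false CG (classF VG AG CG))) S₆
  S₈  = semS N (rep (asg false CH (classF VH AH CH))) S₇
  S₉  = semS N table S₈
  S₁₀ = semS N (rep (asg false BIT bitF)) S₉
  S₁₁ = semS N (asg true OUT outF) S₁₀

  input₂ : Input S₂
  input₂ = keepInput (rep (asg false MUL mulF)) refl refl (keepInput (rep (asg false ADD addF)) refl refl input₀)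

  add₂ : Added S₂
  add₂ = keepAdded (rep (asg false MUL mulF)) refl (added S₀)

  mul₂ : Multiplied S₂
  mul₂ = multiplied S₁ (added S₀)

  input₃ : Input S₃
  input₃ = keepInput (asg false VG vgF) refl refl input₂

  add₃ : Added S₃
  add₃ = keepAdded (asg false VG vgF) refl add₂

  mul₃ : Multiplied S₃
  mul₃ = keepMultiplied (asg false VG vgF) refl mul₂

  input₄ : Input S₄
  input₄ = keepInput (asg false VH vhF) refl refl input₃

  add₄ : Added S₄
  add₄ = keepAdded (asg false VH vhF) refl add₃

  mul₄ : Multiplied S₄
  mul₄ = keepMultiplied (asg false VH vhF) refl mul₃

  vg₄ : Vertex S₄ VG n
  vg₄ i< = keep (asg false VH vhF) VG refl (vertexG input₂ add₂ mul₂ i<)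

  input₅ : Input S₅
  input₅ = keepInput (asg false AG agF) refl refl input₄

  add₅ : Added S₅
  add₅ = keepAdded (asg false AG agF) refl add₄

  mul₅ : Multiplied S₅
  mul₅ = keepMultiplied (asg false AG agF) refl mul₄

  vh₅ : Vertex S₅ VH m
  vh₅ i< = keep (asg false AG agF) VH refl (vertexH input₃ add₃ mul₃ i<)

  add₆ : Added S₆
  add₆ = keepAdded (asg false AH ahF) refl add₅

  vg₆ : Vertex S₆ VG n
  vg₆ i< = keep (asg false AG agF ⨟ asg false AH ahF) VG refl (vg₄ i<)

  vh₆ : Vertex S₆ VH m
  vh₆ i< = keep (asg false AH ahF) VH refl (vh₅ i<)

  ag₆ : Adjacent S₆ AG A
  ag₆ i< j< = keep (asg false AH ahF) AG refl (adjacentG input₄ add₄ mul₄ vg₄ (adjℕ-support G) i< j<)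

  ah₆ : Adjacent S₆ AH B
  ah₆ = adjacentH input₅ add₅ mul₅ vh₅ (adjℕ-support H)

  module ClassesG = ClassStage N n A VG AG CG refl refl refl

  dG : Decomposition N n A (ClassesG.C S₆ add₆ vg₆ ag₆)
  dG = ClassesG.decomposition S₆ add₆ vg₆ ag₆ n<N (adjℕ-sym simpleG) (adjℕ-irr simpleG) (adjℕ-P4Free simpleG cographG)

  add₇ : Added S₇
  add₇ = keepAdded (rep (asg false CG (classF VG AG CG))) refl add₆

  vh₇ : Vertex S₇ VH m
  vh₇ i< = keep (rep (asg false CG (classF VG AG CG))) VH refl (vh₆ i<)

  ah₇ : Adjacent S₇ AH B
  ah₇ i< j< = keep (rep (asg false CG (classF VG AG CG))) AH refl (ah₆ i< j<)

  module ClassesH = ClassStage N m B VH AH CH refl refl refl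

  dH : Decomposition N m B (ClassesH.C S₇ add₇ vh₇ ah₇)
  dH = ClassesH.decomposition S₇ add₇ vh₇ ah₇ m<N (adjℕ-sym simpleH) (adjℕ-irr simpleH) (adjℕ-P4Free simpleH cographH)

  module TableGH = TableStage N n m dG dH

  tabulated₉ : ∀ {k v l w} → k < N → v < n → l < N → w < m →
    cnt N (ClassesG.C S₆ add₆ vg₆ ag₆ k v) + cnt N (ClassesH.C S₇ add₇ vh₇ ah₇ l w) ≤ N →
    Table.Spec dG dH (λ k v l w t → S₉ TT (mem (r₅ k v l w t))) k v l w
  tabulated₉ = TableGH.tabulated S₈ (keepAdded (rep (asg false CH (classF VH AH CH))) refl add₇)
    (λ i< j< → keep (rep (asg false CG (classF VG AG CG)) ⨟ rep (asg false CH (classF VH AH CH))) AG refl (ag₆ i< j<))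
    (λ i< j< → keep (rep (asg false CH (classF VH AH CH))) AH refl (ah₇ i< j<))
    (λ k< v< x< → keep (rep (asg false CH (classF VH AH CH))) CG refl (≡⇒⟺ (ClassesG.computed S₆ add₆ vg₆ ag₆ k< v< x<)))
    (λ k< v< x< → ≡⇒⟺ (ClassesH.computed S₇ add₇ vh₇ ah₇ k< v< x<))

  later : Stm
  later = rep (asg false CG (classF VG AG CG)) ⨟ rep (asg false CH (classF VH AH CH)) ⨟ table ⨟ rep (asg false BIT bitF)

  vg₁₀ : Vertex S₁₀ VG n
  vg₁₀ i< = keep later VG refl (vg₆ i<)

  vh₁₀ : Vertex S₁₀ VH m
  vh₁₀ i< = keep later VH refl (vh₆ i<)

  add₉ : Added S₉
  add₉ = keepAdded (rep (asg false CG (classF VG AG CG)) ⨟ rep (asg false CH (classF VH AH CH)) ⨟ table) refl add₆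

  open OutputStage N

  -- `n * m` is at most the square of the larger order.
  product<N : n * m < N
  product<N = ≤-<-trans (product≤ (≤-total n m)) nn+mm<N
    where
    product≤ : n ≤ m ⊎ m ≤ n → n * m ≤ n * n + m * m
    product≤ (inj₁ le) = ≤-trans (*-monoˡ-≤ m le) (m≤n+m (m * m) (n * n))
    product≤ (inj₂ le) = ≤-trans (*-monoʳ-≤ n le) (m≤m+n (n * n) (m * m))

  n≤N = <⇒≤ n<N
  m≤N = <⇒≤ m<N
  0<N : 0 < N
  0<N = ≤-<-trans z≤n n<N

  α-bounded : ∀ {a} → IsIndependenceNumber (G ⊗ H) a → a < N
  α-bounded ((S , _ , refl) , _) = ≤-<-trans (∣p∣≤n S) product<N

  Solution : Set
  Solution = ∃ λ a → IsIndependenceNumber (G ⊗ H) a × (∀ {t} → t < N → Below S₁₀ t ⟺ t < a)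

  -- The classes at level 0 are the full vertex sets; as neither graph is empty, vertex 0 may
  -- represent them.
  nonempty-solution : 0 < n → 0 < m → Solution
  nonempty-solution 0<n 0<m = build (tabulated₉ 0<N 0<n 0<N 0<m fits)
    where
    open Decomposition
    classG : ∀ {i} → i < N → ClassesG.C S₆ add₆ vg₆ ag₆ 0 0 i ≡ true ⟺ i < n
    classG i< = (λ e → proj₂ (proj₁ (C-zero dG 0<N i<) e)) , (λ lt → proj₂ (C-zero dG 0<N i<) (0<n , lt))
    classH : ∀ {i} → i < N → ClassesH.C S₇ add₇ vh₇ ah₇ 0 0 i ≡ true ⟺ i < m
    classH i< = (λ e → proj₂ (proj₁ (C-zero dH 0<N i<) e)) , (λ lt → proj₂ (C-zero dH 0<N i<) (0<m , lt))
    -- N rounds fill this entry of the table, because `n + m` is at most `n * n + m * m`.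
    fits : cnt N (ClassesG.C S₆ add₆ vg₆ ag₆ 0 0) + cnt N (ClassesH.C S₇ add₇ vh₇ ah₇ 0 0) ≤ N
    fits = ≤-trans (+-mono-≤ (≤-trans (cnt-≤ N (λ i i< c → proj₁ (classG i<) c)) (m≤m*m n)) (≤-trans (cnt-≤ N (λ i i< c → proj₁ (classH i<) c)) (m≤m*m m)))
                   (<⇒≤ nn+mm<N)
    build : Table.Spec dG dH (λ k v l w t → S₉ TT (mem (r₅ k v l w t))) 0 0 0 0 → Solution
    build (a , isa , h) = a , Product.independence-number n≤N m≤N G H classG classH isa , λ t< → to t< , from t<
      where
      at-10 : ∀ {t} → t < N → S₁₀ TT (mem (r₅ 0 0 0 0 t)) ≡ true ⟺ t < a
      at-10 t< = keep (rep (asg false BIT bitF)) TT refl (h t<)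
      to : ∀ {t} → t < N → Below S₁₀ t → t < a
      to {t} t< (z , z< , nz , _ , _ , e) = proj₁ (at-10 t<) (subst (λ z → S₁₀ TT (mem (r₅ z z z z t)) ≡ true) (proj₁ (zero-test z<) nz) e)
      from : ∀ {t} → t < N → t < a → Below S₁₀ t
      from t< lt = 0 , 0<N , proj₂ (zero-test 0<N) refl , proj₂ (vg₁₀ 0<N) 0<n , proj₂ (vh₁₀ 0<N) 0<m , proj₂ (at-10 t<) lt

  empty-product : n * m ≡ 0 → IsIndependenceNumber (G ⊗ H) 0
  empty-product e = (Vec.replicate (n * m) false , (λ i → ⊥-elim (no-index e i)) , n≤0⇒n≡0 (≤-trans (∣p∣≤n (Vec.replicate (n * m) false)) (≤-reflexive e)))
          , λ S _ → ≤-trans (∣p∣≤n S) (≤-reflexive e)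
    where
    no-index : ∀ {k} → k ≡ 0 → Fin k → ⊥
    no-index refl ()

  solve : Dec (0 < n) → Dec (0 < m) → Solution
  solve (yes 0<n) (yes 0<m) = nonempty-solution 0<n 0<m
  solve (no n≮) _ = 0 , empty-product (cong (_* m) (n≤0⇒n≡0 (≮⇒≥ n≮)))
    , λ t< → (λ { (z , z< , nz , v , _) → ⊥-elim (n≮ (≤-<-trans z≤n (proj₁ (vg₁₀ z<) v))) }) , (λ ())
  solve (yes _) (no m≮) = 0 , empty-product (trans (cong (n *_) (n≤0⇒n≡0 (≮⇒≥ m≮))) (*-zeroʳ n))
    , λ t< → (λ { (z , z< , nz , _ , v , _) → ⊥-elim (m≮ (≤-<-trans z≤n (proj₁ (vh₁₀ z<) v))) }) , (λ ())

  solution : Solution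
  solution = solve (0 <? n) (0 <? m)

  α : ℕ
  α = proj₁ solution

  α-correct : IsIndependenceNumber (G ⊗ H) α
  α-correct = proj₁ (proj₂ solution)

  out-bits : ∀ {p} → p < N → S₁₁ OUT (base p) ≡ bits N α p
  out-bits = out-correct S₁₀ (α-bounded α-correct) (proj₂ (proj₂ solution)) (bits-computed S₉ add₉)

  value-cong : ∀ n x {f g} → (∀ {p} → p < x + n → f p ≡ g p) → value x n f ≡ value x n g
  value-cong zero    x h = refl
  value-cong (suc n) x h = cong₂ (λ b v → ind b * 2 ^ n + v) (h (≤-trans (s≤s (m≤m+n x n)) (≤-reflexive (sym (+-suc x n)))))
    (value-cong n (suc x) (λ lt → h (≤-trans lt (≤-reflexive (sym (+-suc x n))))))

  printed : readBinary (map (λ p → if semS N program S₀ OUT (base p) then suc (suc zero) else suc zero) (range 0 N)) 0 ≡ α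
  printed = trans (readBinary-value (λ p → S₁₁ OUT (base p)) N 0 0)
    (trans (value-cong N 0 out-bits) (bits-value N α (α-bounded α-correct)))

open Formulas

-- From the program to a Turing machine with a polynomial bound

module Deliver {F C : Set} (finF : Finite F) (finC : Finite C) (P : Prog F C)
  (f₀ : F) (inp : Fin 4 → C) (out : C → Fin 4) where

  open Realise finF finC P f₀ inp out

  result : List (Fin 3) → ℕ
  result w = readBinary (map out (proj₂ (exec (length w) P (f₀ , map (λ s → inp (suc s)) w)))) 0

  realise-word : ∀ w T → 1 ≤ length w → time (length w) ≤ T → Σ (Config machine) λ final →
    run machine T (initial machine (map symbol w)) ≡ just final × output machine final ≡ result w
  realise-word (x ∷ xs) T _ le = realise x xs T le

  encodeGraph≡ : ∀ {n} (G : Graph n) → encodeGraph machine G ≡ map symbol (matrix G)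
  encodeGraph≡ {n} G = trans (concatMap-cong (λ i → trans (map-cong (λ j → bit≡ (adj G i j)) (allFin n)) (map-∘ (allFin n))) (allFin n))
    (sym (map-concatMap symbol (λ i → map (λ j → bit3 (adj G i j)) (allFin n)) (allFin n)))
    where
    bit≡ : ∀ b → bit machine b ≡ symbol (bit3 b)
    bit≡ true  = refl
    bit≡ false = refl

  encodePair≡ : ∀ {n m} (G : Graph n) (H : Graph m) → encodePair machine G H ≡ map symbol (word G H)
  encodePair≡ G H = trans (cong₂ (λ xs ys → xs ++ suc (suc (suc zero)) ∷ ys) (encodeGraph≡ G) (encodeGraph≡ H))
    (sym (map-++ symbol (matrix G) (sep3 ∷ matrix H)))

  open PolyBounded poly-time

  -- The separator is present even if both graphs are empty; it provides the first cell that every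
  -- pass needs.
  length-word>0 : ∀ {n m} (G : Graph n) (H : Graph m) → 1 ≤ length (word G H)
  length-word>0 {n} {m} G H = ≤-trans (s≤s z≤n) (≤-trans (m≤n+m (suc (m * m)) (n * n)) (≤-reflexive (sym (length-word G H))))

  deliver : (∀ {n m : ℕ} (G : Graph n) (H : Graph m) → SimpleGraph G → SimpleGraph H → Cograph G → Cograph H →
               IsIndependenceNumber (G ⊗ H) (result (word G H))) →
    Σ TM λ M → Σ ℕ λ c → Σ ℕ λ d →
    ∀ {n m : ℕ} (G : Graph n) (H : Graph m) →
    SimpleGraph G → SimpleGraph H → Cograph G → Cograph H →
    Σ (Config M) λ final →
    run M (c * suc (length (encodePair M G H)) ^ d) (initial M (encodePair M G H)) ≡ just final
    × IsIndependenceNumber (G ⊗ H) (output M final)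
  deliver good = machine , coeff , degree , λ G H sG sH cG cH →
    let w = word G H
        (final , runs , out≡) = realise-word w (coeff * suc (length w) ^ degree) (length-word>0 G H) (bound (length w))
    in final
     , trans (cong₂ (λ l xs → run machine (coeff * suc l ^ degree) (initial machine xs))
                    (trans (cong length (encodePair≡ G H)) (length-map symbol w)) (encodePair≡ G H)) runs
     , subst (IsIndependenceNumber (G ⊗ H)) (sym out≡) (good G H sG sH cG cH)

module Solver = Deliver finite-Flags finite-Word Code.code Code.start Code.inputCell Code.outSym

solved : ∀ {n m : ℕ} (G : Graph n) (H : Graph m) → SimpleGraph G → SimpleGraph H → Cograph G → Cograph H →
  IsIndependenceNumber (G ⊗ H) (Solver.result (word G H))
solved G H sG sH cG cH = subst (IsIndependenceNumber (G ⊗ H)) (sym result≡) α-correct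
  where
  open Computation G H sG sH cG cH using (α; α-correct; printed; S₀)
  result≡ : Solver.result (word G H) ≡ α
  result≡ = trans (Code.code-output (word G H) (length (word G H)) refl (Solver.length-word>0 G H))
    (subst (λ N → readBinary (map (λ p → if semS N program S₀ OUT (base p) then suc (suc zero) else suc zero) (range 0 N)) 0 ≡ α)
           (sym (length-word G H)) printed)

theorem1 : Σ TM λ M → Σ ℕ λ c → Σ ℕ λ d →
    ∀ {n m : ℕ} (G : Graph n) (H : Graph m) →
    SimpleGraph G → SimpleGraph H → Cograph G → Cograph H →
    Σ (Config M) λ final →
    run M (c * suc (length (encodePair M G H)) ^ d) (initial M (encodePair M G H)) ≡ just final
    × IsIndependenceNumber (G ⊗ H) (output M final)
theorem1 = Solver.deliver solved
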